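{- Let $k\ge 3$ and $s\geq k+3$ be integers, and let $\eta$ be a positive number. Then there exists a positive number $\gamma$ such that for all $A\ge 1$, $$\#\{\mathbf{a}\in(\mathbb{Z}\setminus\{0\})^s: |\mathbf{a}|\leq A,\ 0<\mathfrak{S}_{\mathbf{a}}<A^{ -\eta}\}\ll A^{s-\gamma},$$ the implicit constant depending only on $k,s,\eta$.
   Context: $|\mathbf{a}|=\max_j|a_j|$. For $\mathbf{a}=(a_1,\dots,a_s)$ with non-zero integer entries and a prime $p$, $\chi_p(\mathbf{a})=\lim_{h\to\infty}p^{h(1-s)}\#\{1\le x_j\le p^h\ (1\le j\le s): a_1x_1^k+\dots+a_sx_s^k\equiv 0 \pmod{p^h}\}$ (these limits exist), and $\mathfrak{S}_{\mathbf{a}}=\prod_p\chi_p(\mathbf{a})$ (a convergent product). -}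

module Defs where

import Algebra.Properties.CommutativeSemigroup as CommutativeSemigroup
open import Algebra.Bundles using (CommutativeMonoid)
open import Data.Integer as ℤ using (ℤ; 0ℤ)
open import Data.List as List using (List; []; _∷_; length; filter; upTo; cartesianProductWith)
open import Data.List.Relation.Unary.All as ListAll using ()
open import Data.List.Relation.Unary.Unique.Propositional using (Unique)
open import Data.Nat as ℕ using (ℕ; zero; suc; NonZero)
open import Data.Nat.Primality using (Prime; prime?; prime⇒nonZero)
import Data.Nat.Divisibility as ℕ
import Data.Nat.Properties as ℕ
open import Data.Product using (Σ; ∃; _×_; _,_)
open import Data.Rational as ℚ using (ℚ; 0ℚ; 1ℚ; ½)
import Data.Rational.Properties as ℚ
open import Data.Vec as Vec using (Vec; []; _∷_)
open import Data.Vec.Relation.Unary.All using (All)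
open import Relation.Binary.PropositionalEquality using (_≡_; _≢_; sym; trans; cong; cong₂; subst)

Cauchy : (ℕ → ℚ) → Set
Cauchy x = ∀ ε → 0ℚ ℚ.< ε →
  ∃ λ N → ∀ m n → N ℕ.≤ m → N ℕ.≤ n → ℚ.∣ x m ℚ.- x n ∣ ℚ.≤ ε

record ℝ : Set where
  constructor mkℝ
  field
    seq    : ℕ → ℚ
    cauchy : Cauchy seq

open ℝ public

infix 4 _<_ _≤_

_<_ : ℝ → ℝ → Set
x < y = ∃ λ ε → 0ℚ ℚ.< ε × ∃ λ N → ∀ n → N ℕ.≤ n → seq x n ℚ.+ ε ℚ.≤ seq y n

_≤_ : ℝ → ℝ → Set
x ≤ y = ∀ ε → 0ℚ ℚ.< ε → ∃ λ N → ∀ n → N ℕ.≤ n → seq x n ℚ.≤ seq y n ℚ.+ ε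

private

  open CommutativeSemigroup (CommutativeMonoid.commutativeSemigroup ℚ.+-0-commutativeMonoid)
    using (interchange)

  half-pos : ∀ {ε} → 0ℚ ℚ.< ε → 0ℚ ℚ.< ½ ℚ.* ε
  half-pos {ε} 0<ε =
    subst (ℚ._< ½ ℚ.* ε) (ℚ.*-zeroʳ ½) (ℚ.*-monoʳ-<-pos ½ 0<ε)

  halves : ∀ ε → ½ ℚ.* ε ℚ.+ ½ ℚ.* ε ≡ ε
  halves ε = trans (sym (ℚ.*-distribʳ-+ ε ½ ½)) (ℚ.*-identityˡ ε)

  +-diff : ∀ a b c d → (a ℚ.+ b) ℚ.- (c ℚ.+ d) ≡ (a ℚ.- c) ℚ.+ (b ℚ.- d)
  +-diff a b c d = trans
    (cong ((a ℚ.+ b) ℚ.+_) (ℚ.neg-distrib-+ c d))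
    (interchange a b (ℚ.- c) (ℚ.- d))

  neg-diff : ∀ a b → (ℚ.- a) ℚ.- (ℚ.- b) ≡ ℚ.- (a ℚ.- b)
  neg-diff a b = sym (ℚ.neg-distrib-+ a (ℚ.- b))

  sub-add : ∀ a b → (a ℚ.- b) ℚ.+ b ≡ a
  sub-add a b = trans (ℚ.+-assoc a (ℚ.- b) b)
    (trans (cong (a ℚ.+_) (ℚ.+-inverseˡ b)) (ℚ.+-identityʳ a))

  add-sub : ∀ a b → a ≡ b ℚ.+ (a ℚ.- b)
  add-sub a b = sym (trans (ℚ.+-comm b (a ℚ.- b)) (sub-add a b))

  telescope : ∀ a b c → (a ℚ.- b) ℚ.+ (b ℚ.- c) ≡ a ℚ.- c
  telescope a b c = trans (sym (ℚ.+-assoc (a ℚ.- b) b (ℚ.- c)))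
    (cong (ℚ._- c) (sub-add a b))

  *-diff : ∀ a b c d → a ℚ.* b ℚ.- c ℚ.* d ≡ a ℚ.* (b ℚ.- d) ℚ.+ (a ℚ.- c) ℚ.* d
  *-diff a b c d = sym (trans
    (cong₂ ℚ._+_
      (trans (ℚ.*-distribˡ-+ a b (ℚ.- d))
        (cong (a ℚ.* b ℚ.+_) (sym (ℚ.neg-distribʳ-* a d))))
      (trans (ℚ.*-distribʳ-+ d a (ℚ.- c))
        (cong (a ℚ.* d ℚ.+_) (sym (ℚ.neg-distribˡ-* c d)))))
    (telescope (a ℚ.* b) (a ℚ.* d) (c ℚ.* d)))

  const-cauchy : ∀ q → Cauchy (λ _ → q)
  const-cauchy q ε 0<ε = 0 , λ _ _ _ _ →
    subst (ℚ._≤ ε) (sym (cong ℚ.∣_∣ (ℚ.+-inverseʳ q))) (ℚ.<⇒≤ 0<ε)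

  neg-cauchy : ∀ {x} → Cauchy x → Cauchy (λ n → ℚ.- x n)
  neg-cauchy {x} cx ε 0<ε with cx ε 0<ε
  ... | N , close = N , λ m n N≤m N≤n →
    subst (ℚ._≤ ε)
      (sym (trans (cong ℚ.∣_∣ (neg-diff (x m) (x n))) (ℚ.∣-p∣≡∣p∣ (x m ℚ.- x n))))
      (close m n N≤m N≤n)

  +-cauchy : ∀ {x y} → Cauchy x → Cauchy y → Cauchy (λ n → x n ℚ.+ y n)
  +-cauchy {x} {y} cx cy ε 0<ε
    with cx (½ ℚ.* ε) (half-pos 0<ε) | cy (½ ℚ.* ε) (half-pos 0<ε)
  ... | N , close | N′ , close′ = N ℕ.⊔ N′ , λ m n le le′ → begin
      ℚ.∣ (x m ℚ.+ y m) ℚ.- (x n ℚ.+ y n) ∣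
        ≡⟨ cong ℚ.∣_∣ (+-diff (x m) (y m) (x n) (y n)) ⟩
      ℚ.∣ (x m ℚ.- x n) ℚ.+ (y m ℚ.- y n) ∣
        ≤⟨ ℚ.∣p+q∣≤∣p∣+∣q∣ (x m ℚ.- x n) (y m ℚ.- y n) ⟩
      ℚ.∣ x m ℚ.- x n ∣ ℚ.+ ℚ.∣ y m ℚ.- y n ∣
        ≤⟨ ℚ.+-mono-≤ (close m n (ℕ.m⊔n≤o⇒m≤o N N′ le) (ℕ.m⊔n≤o⇒m≤o N N′ le′))
                      (close′ m n (ℕ.m⊔n≤o⇒n≤o N N′ le) (ℕ.m⊔n≤o⇒n≤o N N′ le′)) ⟩
      ½ ℚ.* ε ℚ.+ ½ ℚ.* ε
        ≡⟨ halves ε ⟩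
      ε ∎
    where open ℚ.≤-Reasoning

  0<1 : 0ℚ ℚ.< 1ℚ
  0<1 = ℚ.positive⁻¹ 1ℚ

  bounded : ∀ {x} → Cauchy x →
    ∃ λ K → 0ℚ ℚ.< K × ∃ λ N → ∀ n → N ℕ.≤ n → ℚ.∣ x n ∣ ℚ.≤ K
  bounded {x} cx with cx 1ℚ 0<1
  ... | N , close = ℚ.∣ x N ∣ ℚ.+ 1ℚ , ℚ.+-mono-≤-< (ℚ.0≤∣p∣ (x N)) 0<1 , N , λ n N≤n → begin
      ℚ.∣ x n ∣                          ≡⟨ cong ℚ.∣_∣ (add-sub (x n) (x N)) ⟩
      ℚ.∣ x N ℚ.+ (x n ℚ.- x N) ∣        ≤⟨ ℚ.∣p+q∣≤∣p∣+∣q∣ (x N) (x n ℚ.- x N) ⟩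
      ℚ.∣ x N ∣ ℚ.+ ℚ.∣ x n ℚ.- x N ∣    ≤⟨ ℚ.+-monoʳ-≤ ℚ.∣ x N ∣ (close n N N≤n ℕ.≤-refl) ⟩
      ℚ.∣ x N ∣ ℚ.+ 1ℚ                   ∎
    where open ℚ.≤-Reasoning

  shrink : ∀ {ε K} → 0ℚ ℚ.< ε → 0ℚ ℚ.< K → ∃ λ δ → 0ℚ ℚ.< δ × K ℚ.* δ ≡ ε
  shrink {ε} {K} 0<ε 0<K =
    K⁻¹ ℚ.* ε ,
    subst (ℚ._< K⁻¹ ℚ.* ε) (ℚ.*-zeroʳ K⁻¹) (ℚ.*-monoʳ-<-pos K⁻¹ 0<ε) ,
    trans (sym (ℚ.*-assoc K K⁻¹ ε)) (trans (cong (ℚ._* ε) (ℚ.*-inverseʳ K)) (ℚ.*-identityˡ ε))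
    where
    instance
      K-pos : ℚ.Positive K
      K-pos = ℚ.positive 0<K
      K≢0 : ℚ.NonZero K
      K≢0 = ℚ.pos⇒nonZero K
    K⁻¹ = ℚ.1/ K
    instance
      K⁻¹-pos : ℚ.Positive K⁻¹
      K⁻¹-pos = ℚ.1/pos⇒pos K

  abs-*-≤ : ∀ a b {K L} → ℚ.∣ a ∣ ℚ.≤ K → ℚ.∣ b ∣ ℚ.≤ L → ℚ.∣ a ℚ.* b ∣ ℚ.≤ K ℚ.* L
  abs-*-≤ a b {K} {L} a≤K b≤L = begin
      ℚ.∣ a ℚ.* b ∣          ≡⟨ ℚ.∣p*q∣≡∣p∣*∣q∣ a b ⟩
      ℚ.∣ a ∣ ℚ.* ℚ.∣ b ∣    ≤⟨ ℚ.*-monoʳ-≤-nonNeg ℚ.∣ b ∣ {{ℚ.∣-∣-nonNeg b}} a≤K ⟩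
      K ℚ.* ℚ.∣ b ∣          ≤⟨ ℚ.*-monoˡ-≤-nonNeg K {{ℚ.nonNegative (ℚ.≤-trans (ℚ.0≤∣p∣ a) a≤K)}} b≤L ⟩
      K ℚ.* L                ∎
    where open ℚ.≤-Reasoning

  *-cauchy : ∀ {x y} → Cauchy x → Cauchy y → Cauchy (λ n → x n ℚ.* y n)
  *-cauchy {x} {y} cx cy ε 0<ε with bounded {x} cx | bounded {y} cy
  ... | K , 0<K , M , x≤K | L , 0<L , M′ , y≤L
    with shrink (half-pos 0<ε) 0<K | shrink (half-pos 0<ε) 0<L
  ... | δ , 0<δ , Kδ | δ′ , 0<δ′ , Lδ′
    with cy δ 0<δ | cx δ′ 0<δ′
  ... | N , close | N′ , close′ =
    (M ℕ.⊔ M′) ℕ.⊔ (N ℕ.⊔ N′) , λ m n le le′ →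
      let l  = ℕ.m⊔n≤o⇒n≤o (M ℕ.⊔ M′) (N ℕ.⊔ N′) le
          l′ = ℕ.m⊔n≤o⇒n≤o (M ℕ.⊔ M′) (N ℕ.⊔ N′) le′
          b  = ℕ.m⊔n≤o⇒m≤o (M ℕ.⊔ M′) (N ℕ.⊔ N′) le
          b′ = ℕ.m⊔n≤o⇒m≤o (M ℕ.⊔ M′) (N ℕ.⊔ N′) le′
      in begin
      ℚ.∣ x m ℚ.* y m ℚ.- x n ℚ.* y n ∣
        ≡⟨ cong ℚ.∣_∣ (*-diff (x m) (y m) (x n) (y n)) ⟩
      ℚ.∣ x m ℚ.* (y m ℚ.- y n) ℚ.+ (x m ℚ.- x n) ℚ.* y n ∣
        ≤⟨ ℚ.∣p+q∣≤∣p∣+∣q∣ (x m ℚ.* (y m ℚ.- y n)) ((x m ℚ.- x n) ℚ.* y n) ⟩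
      ℚ.∣ x m ℚ.* (y m ℚ.- y n) ∣ ℚ.+ ℚ.∣ (x m ℚ.- x n) ℚ.* y n ∣
        ≤⟨ ℚ.+-mono-≤
             (abs-*-≤ (x m) (y m ℚ.- y n) (x≤K m (ℕ.m⊔n≤o⇒m≤o M M′ b))
               (close m n (ℕ.m⊔n≤o⇒m≤o N N′ l) (ℕ.m⊔n≤o⇒m≤o N N′ l′)))
             (abs-*-≤ (x m ℚ.- x n) (y n)
               (close′ m n (ℕ.m⊔n≤o⇒n≤o N N′ l) (ℕ.m⊔n≤o⇒n≤o N N′ l′))
               (y≤L n (ℕ.m⊔n≤o⇒n≤o M M′ b′))) ⟩
      K ℚ.* δ ℚ.+ δ′ ℚ.* L
        ≡⟨ cong₂ ℚ._+_ Kδ (trans (ℚ.*-comm δ′ L) Lδ′) ⟩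
      ½ ℚ.* ε ℚ.+ ½ ℚ.* ε
        ≡⟨ halves ε ⟩
      ε ∎
    where open ℚ.≤-Reasoning

infixl 6 _+_ _-_
infixl 7 _*_
infixr 8 _^_
infix  8 -_

_+_ : ℝ → ℝ → ℝ
seq    (x + y) n = seq x n ℚ.+ seq y n
cauchy (x + y)   = +-cauchy {seq x} {seq y} (cauchy x) (cauchy y)

-_ : ℝ → ℝ
seq    (- x) n = ℚ.- seq x n
cauchy (- x)   = neg-cauchy {seq x} (cauchy x)

_-_ : ℝ → ℝ → ℝ
x - y = x + (- y)

_*_ : ℝ → ℝ → ℝ
seq    (x * y) n = seq x n ℚ.* seq y n
cauchy (x * y)   = *-cauchy {seq x} {seq y} (cauchy x) (cauchy y)

fromℚ : ℚ → ℝ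
seq    (fromℚ q) _ = q
cauchy (fromℚ q)   = const-cauchy q

fromℕ : ℕ → ℝ
fromℕ n = fromℚ (ℤ.+ n ℚ./ 1)

0ℝ 1ℝ : ℝ
0ℝ = fromℕ 0
1ℝ = fromℕ 1

_^_ : ℝ → ℕ → ℝ
x ^ zero  = 1ℝ
x ^ suc n = x * x ^ n

-- For A ≥ 1, "y = A^t" with a real exponent t: the number y > 0 lies above
-- A^q for all rationals q < t and below A^q for all rationals q > t.
-- With q = (i − j)/n, the inequality A^q ≤ y is written A^i ≤ A^j y^n.
-- This determines y uniquely; for A < 1 the conditions are not meant to be used.
record IsPower (A t y : ℝ) : Set where
  field
    positive : 0ℝ < y
    above    : ∀ i j n → .{{_ : NonZero n}} →
               fromℚ ((i ℤ.⊖ j) ℚ./ n) < t → A ^ i ≤ A ^ j * y ^ n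
    below    : ∀ i j n → .{{_ : NonZero n}} →
               t < fromℚ ((i ℤ.⊖ j) ℚ./ n) → A ^ j * y ^ n ≤ A ^ i

ConvergesTo : (ℕ → ℝ) → ℝ → Set
ConvergesTo u l = ∀ ε → 0ℝ < ε →
  ∃ λ N → ∀ n → N ℕ.≤ n → (l - ε < u n) × (u n < l + ε)

diagonalForm : ∀ {s} → ℕ → Vec ℤ s → Vec ℕ s → ℤ
diagonalForm k a x =
  Vec.foldr′ ℤ._+_ 0ℤ (Vec.zipWith (λ aⱼ xⱼ → aⱼ ℤ.* (ℤ.+ xⱼ) ℤ.^ k) a x)

-- All x with 1 ≤ xⱼ ≤ n, each listed once.
box : ∀ s → ℕ → List (Vec ℕ s)
box zero    n = [] ∷ []
box (suc s) n = cartesianProductWith _∷_ (List.map suc (upTo n)) (box s n)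

solutionCount : ∀ {s} → ℕ → Vec ℤ s → ℕ → ℕ
solutionCount {s} k a q =
  length (filter (λ x → q ℕ.∣? ℤ.∣ diagonalForm k a x ∣) (box s q))

-- p^(h(1-s)) is written as p^h / p^(hs).
normalisedCount : ∀ {s} → ℕ → Vec ℤ s → (p : ℕ) → .{{NonZero p}} → ℕ → ℚ
normalisedCount {s} k a p h =
  (ℤ.+ (p ℕ.^ h ℕ.* solutionCount k a (p ℕ.^ h))) ℚ./ (p ℕ.^ (h ℕ.* s))
  where instance _ = ℕ.m^n≢0 p (h ℕ.* s)

IsLocalDensity : ∀ {s} → ℕ → Vec ℤ s → (p : ℕ) → .{{NonZero p}} → ℝ → Set
IsLocalDensity k a p = ConvergesTo (λ h → fromℚ (normalisedCount k a p h))

productOverPrimes≤ : ℕ → (ℕ → ℝ) → ℝ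
productOverPrimes≤ n χ = List.foldr (λ p r → χ p * r) 1ℝ (filter prime? (upTo (suc n)))

-- The infinite product is the limit of the products over primes p ≤ n; χ is
-- unconstrained, and unused, at non-primes.
IsSingularSeries : ∀ {s} → ℕ → Vec ℤ s → ℝ → Set
IsSingularSeries k a 𝔖 = Σ (ℕ → ℝ) λ χ →
  (∀ p (p-prime : Prime p) → IsLocalDensity k a p {{prime⇒nonZero p-prime}} (χ p)) ×
  ConvergesTo (λ n → productOverPrimes≤ n χ) 𝔖

maxNorm : ∀ {s} → Vec ℤ s → ℕ
maxNorm a = Vec.foldr′ ℕ._⊔_ 0 (Vec.map ℤ.∣_∣ a)

record SmallSingularSeries {s} (k : ℕ) (A P : ℝ) (a : Vec ℤ s) : Set where
  field
    nonZero   : All (_≢ 0ℤ) a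
    norm≤     : fromℕ (maxNorm a) ≤ A
    𝔖         : ℝ
    𝔖-series  : IsSingularSeries k a 𝔖
    𝔖-pos     : 0ℝ < 𝔖
    𝔖-small   : 𝔖 < P

-- "#{x | S x} ≤ b", for predicates S that need not be decidable: every list of
-- distinct elements of S has length at most b.
CardinalityAtMost : {X : Set} → (X → Set) → ℝ → Set
CardinalityAtMost {X} S b =
  (xs : List X) → Unique xs → ListAll.All S xs → fromℕ (length xs) ≤ b

-- The local densities are bounded below by elementary means.  Let f be the
-- diagonal form.  For a prime p dividing at most one coefficient, the deviation
-- of the number of zeros of f mod p from p^(s-1) is O(p^((s+1)/2)): adding one
-- variable convolves a p-periodic function of mean zero with the k-th powers,
-- and the L² norm of the result depends only on the class of the coefficient
-- modulo k-th powers, so it can be averaged over all coefficients.  As s ≥ 6,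
-- Hensel lifting gives χ_p ≥ 1 - O(p^(-3/2)), and the product over these p
-- converges.  For the other primes, 𝔖 > 0 forces a primitive solution modulo a
-- power p^m with m comparable to the exponents of p in the coefficients (without
-- one, χ_p = 0 because s > k), and χ_p ≥ p^(-ms).  If all gcd(a_i, a_j) and all
-- t with t² ∣ a_j are at most T, these factors multiply to at least a fixed
-- power of 1/T, so 𝔖 ≫ T^(-E).  All but O(A^s / T) vectors satisfy this
-- condition, and T is chosen as a small power of A.

module Submission where

open import Data.Bool using (false; if_then_else_; true)
import Data.Integer.Properties as ℤ
open import Data.List using (List; []; _++_; _∷_; cartesianProductWith; filter; foldr; length; map; upTo)
open import Data.List.Membership.Propositional using (_∈_)
open import Data.List.Relation.Unary.AllPairs as AllPairs using (AllPairs; []; _∷_)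
open import Data.List.Relation.Unary.Any using (here; there)
open import Data.List.Relation.Unary.Unique.Propositional using (Unique)
open import Data.Nat as ℕ using (NonZero; suc; s≤s; zero; z≤n; ℕ)
import Data.Nat.Divisibility as ℕ
open import Data.Nat.Primality using (Prime; euclidsLemma; prime?; prime⇒irreducible; prime⇒nonTrivial; prime⇒nonZero)
import Data.Nat.Properties as ℕ
import Data.Nat.Tactic.RingSolver as ℕ
open import Data.Product using (_,_; _×_; proj₁; proj₂; Σ; ∃)
open import Data.Sum using ([_,_]′; _⊎_; inj₁; inj₂)
open import Data.Vec using (Vec; []; _∷_)
open import Data.Vec.Relation.Unary.All as All using (All; []; _∷_)
open import Function using (_∘_)
open import Level using (0ℓ)
open import Relation.Binary.PropositionalEquality using (_≡_; _≢_; cong; cong₂; module ≡-Reasoning; refl; subst; subst₂; sym; trans)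
open import Relation.Nullary using (Dec; contradiction; does; no; yes; ¬_)
open import Relation.Nullary.Decidable using (decidable-stable; dec⇒maybe)
open import Relation.Unary using (Decidable; Pred)

-- The definition gives 𝔖 and the densities as limits, with nothing decided about them. From 𝔖 > 0
-- follows only that insolubility modulo p^m is impossible, so the lower bound for 𝔖 is carried
-- under a double negation, removed at the end where it proves an inequality `T ≤ D` of natural
-- numbers.
--
-- No real exponent enters the estimates. An integer N comparable to A replaces A, the cube of ⌊√p⌋
-- replaces p^(3/2), and A^(-η) and A^(s-γ) are used through one rational exponent each: -1/n above
-- -η, and s - 1/K below s - γ. From 1/(4cT^E) ≤ 𝔖 < A^(-1/n) follows N ≤ 12(4cT^E)^n. With K = En +
-- 1 and T the integer part of N^(1/K) this forces T ≤ D for a constant D. So either T ≤ D, and the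
-- trivial count is good enough, or no counted vector is balanced.
--
-- At the bad primes the full exponents of p in the coefficients enter, and their product may be of
-- the size of A. Rounding them down to even numbers avoids this: the squares so obtained are at
-- most T², and the rounding costs at most the product of the bad primes, which all divide a fixed
-- factorial times the product of the gcds.

-- Finite sums of integers

module FiniteSums where

  open import Data.Integer using (ℤ; 0ℤ; 1ℤ; _+_; _*_; _-_; -_; _≤_; +≤+; nonNegative; ∣_∣; _^_) renaming (+_ to pos)
  open import Data.Integer.Tactic.RingSolver using (solve-∀)

  private
    interchange : ∀ a b c d → (a + b) + (c + d) ≡ (a + c) + (b + d)
    interchange = solve-∀

  ∑ : {X : Set} → List X → (X → ℤ) → ℤ
  ∑ []       f = 0ℤ
  ∑ (x ∷ xs) f = f x + ∑ xs f

  module _ {X : Set} where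

    ∑-cong : (xs : List X) {f g : X → ℤ} → (∀ x → f x ≡ g x) → ∑ xs f ≡ ∑ xs g
    ∑-cong []       eq = refl
    ∑-cong (x ∷ xs) eq = cong₂ _+_ (eq x) (∑-cong xs eq)

    ∑-mono-∈ : (xs : List X) {f g : X → ℤ} → (∀ {x} → x ∈ xs → f x ≤ g x) → ∑ xs f ≤ ∑ xs g
    ∑-mono-∈ []       le = ℤ.≤-refl
    ∑-mono-∈ (x ∷ xs) le = ℤ.+-mono-≤ (le (here refl)) (∑-mono-∈ xs λ x∈ → le (there x∈))

    ∑-mono : (xs : List X) {f g : X → ℤ} → (∀ x → f x ≤ g x) → ∑ xs f ≤ ∑ xs g
    ∑-mono xs le = ∑-mono-∈ xs λ {x} _ → le x

    ∑-0 : (xs : List X) → ∑ xs (λ _ → 0ℤ) ≡ 0ℤ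
    ∑-0 []       = refl
    ∑-0 (x ∷ xs) = trans (ℤ.+-identityˡ _) (∑-0 xs)

    ∑-nonneg : (xs : List X) {f : X → ℤ} → (∀ x → 0ℤ ≤ f x) → 0ℤ ≤ ∑ xs f
    ∑-nonneg xs 0≤f = ℤ.≤-trans (ℤ.≤-reflexive (sym (∑-0 xs))) (∑-mono xs 0≤f)

    ∑-+ : (xs : List X) (f g : X → ℤ) → ∑ xs (λ x → f x + g x) ≡ ∑ xs f + ∑ xs g
    ∑-+ []       f g = refl
    ∑-+ (x ∷ xs) f g = trans (cong ((f x + g x) +_) (∑-+ xs f g))
      (interchange (f x) (g x) (∑ xs f) (∑ xs g))

    ∑-*ˡ : (xs : List X) (c : ℤ) (f : X → ℤ) → ∑ xs (λ x → c * f x) ≡ c * ∑ xs f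
    ∑-*ˡ []       c f = sym (ℤ.*-zeroʳ c)
    ∑-*ˡ (x ∷ xs) c f = trans (cong (c * f x +_) (∑-*ˡ xs c f)) (sym (ℤ.*-distribˡ-+ c (f x) (∑ xs f)))

    ∑-*ʳ : (xs : List X) (c : ℤ) (f : X → ℤ) → ∑ xs (λ x → f x * c) ≡ ∑ xs f * c
    ∑-*ʳ xs c f = trans (∑-cong xs λ x → ℤ.*-comm (f x) c) (trans (∑-*ˡ xs c f) (ℤ.*-comm c (∑ xs f)))

    ∑-neg : (xs : List X) (f : X → ℤ) → ∑ xs (λ x → - f x) ≡ - ∑ xs f
    ∑-neg xs f = trans (∑-cong xs λ x → sym (ℤ.-1*i≡-i (f x))) (trans (∑-*ˡ xs (- 1ℤ) f) (ℤ.-1*i≡-i _))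

    ∑-- : (xs : List X) (f g : X → ℤ) → ∑ xs (λ x → f x - g x) ≡ ∑ xs f - ∑ xs g
    ∑-- xs f g = trans (∑-+ xs f (λ x → - g x)) (cong (∑ xs f +_) (∑-neg xs g))

    ∑-const : (xs : List X) (c : ℤ) → ∑ xs (λ _ → c) ≡ pos (length xs) * c
    ∑-const []       c = refl
    ∑-const (x ∷ xs) c = trans (cong (c +_) (∑-const xs c)) (sym (ℤ.suc-* (pos (length xs)) c))

    ∑-++ : (xs ys : List X) (f : X → ℤ) → ∑ (xs ++ ys) f ≡ ∑ xs f + ∑ ys f
    ∑-++ []       ys f = sym (ℤ.+-identityˡ _)
    ∑-++ (x ∷ xs) ys f = trans (cong (f x +_) (∑-++ xs ys f)) (sym (ℤ.+-assoc (f x) _ _))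

    ∈⇒≤∑ : {xs : List X} {f : X → ℤ} → (∀ x → 0ℤ ≤ f x) → ∀ {x} → x ∈ xs → f x ≤ ∑ xs f
    ∈⇒≤∑ {x ∷ xs} {f} 0≤f (here refl) = subst (_≤ f x + ∑ xs f) (ℤ.+-identityʳ (f x)) (ℤ.+-monoʳ-≤ (f x) (∑-nonneg xs 0≤f))
    ∈⇒≤∑ {y ∷ xs} {f} 0≤f (there x∈)  = ℤ.≤-trans (∈⇒≤∑ 0≤f x∈)
      (subst (_≤ f y + ∑ xs f) (ℤ.+-identityˡ _) (ℤ.+-monoˡ-≤ (∑ xs f) (0≤f y)))

    ∑-filter-length : {P : Pred X 0ℓ} (P? : Decidable P) (xs : List X) →
      pos (length (filter P? xs)) ≡ ∑ xs (λ x → if does (P? x) then 1ℤ else 0ℤ)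
    ∑-filter-length P? []       = refl
    ∑-filter-length P? (x ∷ xs) with does (P? x)
    ... | true  = cong (1ℤ +_) (∑-filter-length P? xs)
    ... | false = trans (∑-filter-length P? xs) (sym (ℤ.+-identityˡ _))

  ∑-map : {X Y : Set} (g : X → Y) (xs : List X) (f : Y → ℤ) → ∑ (map g xs) f ≡ ∑ xs (λ x → f (g x))
  ∑-map g []       f = refl
  ∑-map g (x ∷ xs) f = cong (f (g x) +_) (∑-map g xs f)

  ∑-swap : {X Y : Set} (xs : List X) (ys : List Y) (f : X → Y → ℤ) →
    ∑ xs (λ x → ∑ ys (λ y → f x y)) ≡ ∑ ys (λ y → ∑ xs (λ x → f x y))
  ∑-swap []       ys f = sym (∑-0 ys)
  ∑-swap (x ∷ xs) ys f = trans (cong (∑ ys (f x) +_) (∑-swap xs ys f)) (sym (∑-+ ys (f x) _))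

  ∑-product : {X Y Z : Set} (g : X → Y → Z) (xs : List X) (ys : List Y) (f : Z → ℤ) →
    ∑ (cartesianProductWith g xs ys) f ≡ ∑ xs (λ x → ∑ ys (λ y → f (g x y)))
  ∑-product g []       ys f = refl
  ∑-product g (x ∷ xs) ys f = trans (∑-++ (map (g x) ys) _ f)
    (cong₂ _+_ (∑-map (g x) ys f) (∑-product g xs ys f))

  ∑-*-∑ : {X Y : Set} (xs : List X) (ys : List Y) (f : X → ℤ) (g : Y → ℤ) →
    ∑ xs f * ∑ ys g ≡ ∑ xs (λ x → ∑ ys (λ y → f x * g y))
  ∑-*-∑ xs ys f g = sym (trans (∑-cong xs λ x → ∑-*ˡ ys (f x) g) (∑-*ʳ xs (∑ ys g) f))

  *-monoˡ : ∀ {a b} c → 0ℤ ≤ c → a ≤ b → c * a ≤ c * b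
  *-monoˡ c 0≤c = ℤ.*-monoˡ-≤-nonNeg c {{nonNegative 0≤c}}

  *-monoʳ : ∀ {a b} c → 0ℤ ≤ c → a ≤ b → a * c ≤ b * c
  *-monoʳ c 0≤c = ℤ.*-monoʳ-≤-nonNeg c {{nonNegative 0≤c}}

  0≤* : ∀ {a b} → 0ℤ ≤ a → 0ℤ ≤ b → 0ℤ ≤ a * b
  0≤* {a} {b} 0≤a 0≤b = subst (_≤ a * b) (ℤ.*-zeroʳ a) (*-monoˡ a 0≤a 0≤b)

  0≤pos : ∀ {n} → 0ℤ ≤ pos n
  0≤pos = +≤+ z≤n

  0≤² : ∀ a → 0ℤ ≤ a * a
  0≤² a = subst (0ℤ ≤_) (trans (ℤ.pos-* ∣ a ∣ ∣ a ∣) (square (ℤ.+∣i∣≡i⊎+∣i∣≡-i a))) 0≤pos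
    where
    neg² : ∀ a → - a * - a ≡ a * a
    neg² = solve-∀
    square : (pos ∣ a ∣ ≡ a) ⊎ (pos ∣ a ∣ ≡ - a) → pos ∣ a ∣ * pos ∣ a ∣ ≡ a * a
    square (inj₁ eq) = cong₂ _*_ eq eq
    square (inj₂ eq) = trans (cong₂ _*_ eq eq) (neg² a)

  ^-distrib-* : ∀ a b n → (a * b) ^ n ≡ a ^ n * b ^ n
  ^-distrib-* a b zero    = refl
  ^-distrib-* a b (suc n) = trans (cong (a * b *_) (^-distrib-* a b n)) (lemma a b (a ^ n) (b ^ n))
    where
    lemma : ∀ a b c d → a * b * (c * d) ≡ a * c * (b * d)
    lemma = solve-∀

  pos-^ : ∀ m n → pos (m ℕ.^ n) ≡ pos m ^ n
  pos-^ m zero    = refl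
  pos-^ m (suc n) = trans (ℤ.pos-* m (m ℕ.^ n)) (cong (pos m *_) (pos-^ m n))

-- Sums over residue classes and indicators of divisibility

module Residues where

  open FiniteSums
  open import Data.Integer using (ℤ; 0ℤ; 1ℤ; _+_; _*_; _-_; -_; _≤_; +≤+; ∣_∣; _^_) renaming (+_ to pos)
  open import Data.Integer.DivMod using (_%ℕ_; _/ℕ_; a≡a%ℕn+[a/ℕn]*n; n%ℕd<d)
  open import Data.Integer.Divisibility.Signed
  open import Algebra.Properties.AbelianGroup ℤ.+-0-abelianGroup using (∙-cancelˡ)
  open import Data.Integer.Tactic.RingSolver using (solve-∀)
  open import Data.List.Membership.Propositional.Properties using (∈-map⁺; ∈-map⁻; ∈-upTo⁺; ∈-upTo⁻)
  open import Data.List.Properties using (upTo-∷ʳ; map-++; length-map; length-upTo)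
  open import Data.Nat.Coprimality using (Coprime; coprime-Bézout)
  open import Data.Nat.GCD using (module Bézout)

  opaque

    -- The indicator of divisibility takes integer values, so that solution counts become sums which
    -- can be expanded, interchanged and compared termwise.
    𝟙 : ℕ → ℤ → ℤ
    𝟙 m x = if does (m ℕ.∣? ∣ x ∣) then 1ℤ else 0ℤ

  opaque
    unfolding 𝟙

    𝟙-if : ∀ m x → 𝟙 m x ≡ (if does (m ℕ.∣? ∣ x ∣) then 1ℤ else 0ℤ)
    𝟙-if m x = refl

    𝟙-yes : ∀ {m x} → pos m ∣ x → 𝟙 m x ≡ 1ℤ
    𝟙-yes {m} {x} m∣x with m ℕ.∣? ∣ x ∣
    ... | yes _  = refl
    ... | no m∤x = contradiction (∣⇒∣ᵤ m∣x) m∤x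

    𝟙-no : ∀ {m x} → ¬ pos m ∣ x → 𝟙 m x ≡ 0ℤ
    𝟙-no {m} {x} m∤x with m ℕ.∣? ∣ x ∣
    ... | yes m∣x = contradiction (∣ᵤ⇒∣ m∣x) m∤x
    ... | no _    = refl

    0≤𝟙 : ∀ m x → 0ℤ ≤ 𝟙 m x
    0≤𝟙 m x with does (m ℕ.∣? ∣ x ∣)
    ... | true  = +≤+ z≤n
    ... | false = +≤+ z≤n

    𝟙≤1 : ∀ m x → 𝟙 m x ≤ 1ℤ
    𝟙≤1 m x with does (m ℕ.∣? ∣ x ∣)
    ... | true  = +≤+ (s≤s z≤n)
    ... | false = +≤+ z≤n

  𝟙-mono : ∀ {m n x y} → (pos m ∣ x → pos n ∣ y) → 𝟙 m x ≤ 𝟙 n y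
  𝟙-mono {m} {n} {x} {y} imp with pos m ∣? x
  ... | yes m∣x = ℤ.≤-reflexive (trans (𝟙-yes m∣x) (sym (𝟙-yes (imp m∣x))))
  ... | no  m∤x = subst (_≤ 𝟙 n y) (sym (𝟙-no m∤x)) (0≤𝟙 n y)

  𝟙-cong : ∀ {m n x y} → (pos m ∣ x → pos n ∣ y) → (pos n ∣ y → pos m ∣ x) → 𝟙 m x ≡ 𝟙 n y
  𝟙-cong f g = ℤ.≤-antisym (𝟙-mono f) (𝟙-mono g)

  ∣-shift : ∀ {m x y} → m ∣ x - y → m ∣ x → m ∣ y
  ∣-shift {m} {x} {y} m∣x-y m∣x = subst (m ∣_) (lemma x y) (∣m∣n⇒∣m-n m∣x m∣x-y)
    where
    lemma : ∀ x y → x - (x - y) ≡ y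
    lemma = solve-∀

  ∣-flip : ∀ {m} x y → m ∣ x - y → m ∣ y - x
  ∣-flip {m} x y m∣x-y = subst (m ∣_) (lemma x y) (∣m⇒∣-m m∣x-y)
    where
    lemma : ∀ x y → - (x - y) ≡ y - x
    lemma = solve-∀

  Periodic : {X : Set} → ℕ → (ℤ → X) → Set
  Periodic n F = ∀ x y → pos n ∣ x - y → F x ≡ F y

  𝟙-periodic : ∀ m → Periodic m (𝟙 m)
  𝟙-periodic m x y m∣x-y = 𝟙-cong (∣-shift m∣x-y) (∣-shift (∣-flip x y m∣x-y))

  resid : ℕ → List ℕ
  resid n = map suc (upTo n)

  ∑ᵣ : ℕ → (ℤ → ℤ) → ℤ
  ∑ᵣ n F = ∑ (resid n) (F ∘ pos)

  length-resid : ∀ n → length (resid n) ≡ n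
  length-resid n = trans (length-map suc (upTo n)) (length-upTo n)

  ∑ᵣ-const : ∀ n c → ∑ᵣ n (λ _ → c) ≡ pos n * c
  ∑ᵣ-const n c = trans (∑-const (resid n) c) (cong (λ l → pos l * c) (length-resid n))

  ∑ᵣ-suc : ∀ n F → ∑ᵣ (suc n) F ≡ ∑ᵣ n F + F (pos (suc n))
  ∑ᵣ-suc n F = begin
    ∑ᵣ (suc n) F                              ≡⟨ cong (λ l → ∑ (map suc l) (F ∘ pos)) (sym (upTo-∷ʳ n)) ⟩
    ∑ (map suc (upTo n ++ n ∷ [])) (F ∘ pos)  ≡⟨ cong (λ l → ∑ l (F ∘ pos)) (map-++ suc (upTo n) (n ∷ [])) ⟩
    ∑ (resid n ++ suc n ∷ []) (F ∘ pos)       ≡⟨ ∑-++ (resid n) _ _ ⟩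
    ∑ᵣ n F + (F (pos (suc n)) + 0ℤ)           ≡⟨ cong (∑ᵣ n F +_) (ℤ.+-identityʳ _) ⟩
    ∑ᵣ n F + F (pos (suc n))                  ∎
    where open ≡-Reasoning

  ∑ᵣ-split : ∀ m n F → ∑ᵣ (n ℕ.+ m) F ≡ ∑ᵣ m F + ∑ᵣ n (λ x → F (x + pos m))
  ∑ᵣ-split m zero    F = sym (ℤ.+-identityʳ _)
  ∑ᵣ-split m (suc n) F = begin
    ∑ᵣ (suc (n ℕ.+ m)) F                       ≡⟨ ∑ᵣ-suc (n ℕ.+ m) F ⟩
    ∑ᵣ (n ℕ.+ m) F + F (pos (suc (n ℕ.+ m)))   ≡⟨ cong (_+ F (pos (suc (n ℕ.+ m)))) (∑ᵣ-split m n F) ⟩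
    ∑ᵣ m F + ∑ᵣ n G + G (pos (suc n))          ≡⟨ ℤ.+-assoc (∑ᵣ m F) _ _ ⟩
    ∑ᵣ m F + (∑ᵣ n G + G (pos (suc n)))        ≡⟨ cong (∑ᵣ m F +_) (sym (∑ᵣ-suc n G)) ⟩
    ∑ᵣ m F + ∑ᵣ (suc n) G                      ∎
    where
    open ≡-Reasoning
    G : ℤ → ℤ
    G x = F (x + pos m)

  suc∈resid : ∀ {i n} → i ℕ.< n → suc i ∈ resid n
  suc∈resid i<n = ∈-map⁺ suc (∈-upTo⁺ i<n)

  ∈resid⇒bounds : ∀ {x n} → x ∈ resid n → (1 ℕ.≤ x) × (x ℕ.≤ n)
  ∈resid⇒bounds x∈ with ∈-map⁻ suc x∈
  ... | i , i∈ , refl = s≤s z≤n , ∈-upTo⁻ i∈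

  module _ {n : ℕ} .{{_ : NonZero n}} where

    representative : ∀ y → ∃ λ i → (i ∈ resid n) × (pos n ∣ y - pos i)
    -- Residues run from 1 to `n`, so the remainder of `y - 1` is taken and then increased by 1.
    representative y = suc r , suc∈resid (n%ℕd<d (y - 1ℤ) n) , divides ((y - 1ℤ) /ℕ n) eq
      where
      r : ℕ
      r = (y - 1ℤ) %ℕ n
      lemma : ∀ y r q → y - 1ℤ ≡ r + q → y - (1ℤ + r) ≡ q
      lemma y r q e = trans (re y r) (trans (cong (_- r) e) (re′ r q))
        where
        re : ∀ y r → y - (1ℤ + r) ≡ (y - 1ℤ) - r
        re = solve-∀
        re′ : ∀ r q → r + q - r ≡ q
        re′ = solve-∀
      eq : y - pos (suc r) ≡ (y - 1ℤ) /ℕ n * pos n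
      eq = lemma y (pos r) _ (a≡a%ℕn+[a/ℕn]*n (y - 1ℤ) n)

    ≤∑ᵣ : ∀ {F} → Periodic n F → (∀ x → 0ℤ ≤ F x) → ∀ y → F y ≤ ∑ᵣ n F
    ≤∑ᵣ {F} per 0≤F y with representative y
    ... | i , i∈ , n∣ = subst (_≤ ∑ᵣ n F) (sym (per y (pos i) n∣)) (∈⇒≤∑ (λ x → 0≤F (pos x)) i∈)

    private
      -- From the sum over `1, ..., n + 1` one splits off the first term or the last; periodicity
      -- makes these two terms equal.
      shift₁ : ∀ {F} → Periodic n F → ∑ᵣ n (λ x → F (x + 1ℤ)) ≡ ∑ᵣ n F
      shift₁ {F} per = ∙-cancelˡ (F 1ℤ) _ _ (begin
        F 1ℤ + ∑ᵣ n (λ x → F (x + 1ℤ))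
          ≡⟨ cong (_+ ∑ᵣ n (λ x → F (x + 1ℤ))) (sym (ℤ.+-identityʳ (F 1ℤ))) ⟩
        ∑ᵣ 1 F + ∑ᵣ n (λ x → F (x + 1ℤ))
          ≡⟨ sym (∑ᵣ-split 1 n F) ⟩
        ∑ᵣ (n ℕ.+ 1) F
          ≡⟨ cong (λ k → ∑ᵣ k F) (ℕ.+-comm n 1) ⟩
        ∑ᵣ (suc n) F
          ≡⟨ ∑ᵣ-suc n F ⟩
        ∑ᵣ n F + F (pos (suc n))
          ≡⟨ cong (∑ᵣ n F +_) (per _ _ (divides 1ℤ (lemma (pos n)))) ⟩
        ∑ᵣ n F + F 1ℤ
          ≡⟨ ℤ.+-comm (∑ᵣ n F) (F 1ℤ) ⟩
        F 1ℤ + ∑ᵣ n F ∎)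
        where
        open ≡-Reasoning
        lemma : ∀ m → 1ℤ + m - 1ℤ ≡ 1ℤ * m
        lemma = solve-∀

      shiftℕ : ∀ {F} → Periodic n F → ∀ t → ∑ᵣ n (λ x → F (x + pos t)) ≡ ∑ᵣ n F
      shiftℕ {F} per zero    = ∑-cong (resid n) λ x → cong F (ℤ.+-identityʳ (pos x))
      shiftℕ {F} per (suc t) = begin
        ∑ᵣ n (λ x → F (x + pos (suc t)))    ≡⟨ ∑-cong (resid n) (λ x → cong F (lemma (pos x) (pos t))) ⟩
        ∑ᵣ n (λ x → F (x + 1ℤ + pos t))     ≡⟨ shift₁ per′ ⟩
        ∑ᵣ n (λ x → F (x + pos t))          ≡⟨ shiftℕ per t ⟩
        ∑ᵣ n F ∎
        where
        open ≡-Reasoning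
        lemma : ∀ x t → x + (1ℤ + t) ≡ x + 1ℤ + t
        lemma = solve-∀
        lemma′ : ∀ x y t → x - y ≡ (x + t) - (y + t)
        lemma′ = solve-∀
        per′ : Periodic n (λ x → F (x + pos t))
        per′ x y d = per _ _ (subst (pos n ∣_) (lemma′ x y (pos t)) d)

    ∑ᵣ-shift : ∀ {F} → Periodic n F → ∀ t → ∑ᵣ n (λ x → F (x + t)) ≡ ∑ᵣ n F
    ∑ᵣ-shift {F} per t with representative t
    ... | i , _ , d = trans
      (∑-cong (resid n) λ x → per _ _ (subst (pos n ∣_) (lemma (pos x) t (pos i)) d))
      (shiftℕ per i)
      where
      lemma : ∀ x t i → t - i ≡ (x + t) - (x + i)
      lemma = solve-∀

    ∑ᵣ-multiple : ∀ {F} → Periodic n F → ∀ r → ∑ᵣ (r ℕ.* n) F ≡ pos r * ∑ᵣ n F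
    ∑ᵣ-multiple         per zero    = refl
    ∑ᵣ-multiple {F} per (suc r) = begin
      ∑ᵣ (n ℕ.+ r ℕ.* n) F
        ≡⟨ ∑ᵣ-split (r ℕ.* n) n F ⟩
      ∑ᵣ (r ℕ.* n) F + ∑ᵣ n (λ x → F (x + pos (r ℕ.* n)))
        ≡⟨ cong₂ _+_ (∑ᵣ-multiple per r) (∑ᵣ-shift per (pos (r ℕ.* n))) ⟩
      pos r * ∑ᵣ n F + ∑ᵣ n F
        ≡⟨ ℤ.+-comm (pos r * ∑ᵣ n F) (∑ᵣ n F) ⟩
      ∑ᵣ n F + pos r * ∑ᵣ n F
        ≡⟨ sym (ℤ.suc-* (pos r) (∑ᵣ n F)) ⟩
      pos (suc r) * ∑ᵣ n F ∎
      where open ≡-Reasoning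

  ∑ᵣ-𝟙₀ : ∀ n .{{_ : NonZero n}} → ∑ᵣ n (𝟙 n) ≡ 1ℤ
  ∑ᵣ-𝟙₀ (suc n) = begin
    ∑ᵣ (suc n) (𝟙 (suc n))
      ≡⟨ ∑ᵣ-suc n (𝟙 (suc n)) ⟩
    ∑ᵣ n (𝟙 (suc n)) + 𝟙 (suc n) (pos (suc n))
      ≡⟨ cong₂ _+_ zeros (𝟙-yes ∣-refl) ⟩
    0ℤ + 1ℤ ∎
    where
    open ≡-Reasoning
    zeros : ∑ᵣ n (𝟙 (suc n)) ≡ 0ℤ
    zeros = ℤ.≤-antisym
      (ℤ.≤-trans (∑-mono-∈ (resid n) λ x∈ → ℤ.≤-reflexive (small (∈resid⇒bounds x∈)))
        (ℤ.≤-reflexive (∑-0 (resid n))))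
      (∑-nonneg (resid n) λ x → 0≤𝟙 (suc n) (pos x))
      where
      small : ∀ {x} → (1 ℕ.≤ x) × (x ℕ.≤ n) → 𝟙 (suc n) (pos x) ≡ 0ℤ
      small {suc x} (_ , x≤n) = 𝟙-no λ d → ℕ.>⇒∤ (s≤s x≤n) (∣⇒∣ᵤ d)

  ∑ᵣ-𝟙 : ∀ n .{{_ : NonZero n}} t → ∑ᵣ n (λ x → 𝟙 n (x - t)) ≡ 1ℤ
  ∑ᵣ-𝟙 n t = trans (∑ᵣ-shift (𝟙-periodic n) (- t)) (∑ᵣ-𝟙₀ n)

  -- The indicator acts as a delta function at the class of `t`. Inserting it allows a sum of values
  -- `H (b u^k)` to be regrouped according to the argument of `H`.
  ∑ᵣ-𝟙-* : ∀ n .{{_ : NonZero n}} {H} → Periodic n H → ∀ t → ∑ᵣ n (λ x → 𝟙 n (x - t) * H x) ≡ H t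
  ∑ᵣ-𝟙-* n {H} per t = begin
    ∑ᵣ n (λ x → 𝟙 n (x - t) * H x)  ≡⟨ ∑-cong (resid n) (λ x → replace (pos x)) ⟩
    ∑ᵣ n (λ x → 𝟙 n (x - t) * H t)  ≡⟨ ∑-*ʳ (resid n) (H t) _ ⟩
    ∑ᵣ n (λ x → 𝟙 n (x - t)) * H t  ≡⟨ cong (_* H t) (∑ᵣ-𝟙 n t) ⟩
    1ℤ * H t                         ≡⟨ ℤ.*-identityˡ (H t) ⟩
    H t                              ∎
    where
    open ≡-Reasoning
    replace : ∀ x → 𝟙 n (x - t) * H x ≡ 𝟙 n (x - t) * H t
    replace x with pos n ∣? (x - t)
    ... | yes d = cong (𝟙 n (x - t) *_) (per x t d)
    ... | no ¬d = trans (cong (_* H x) (𝟙-no ¬d)) (cong (_* H t) (sym (𝟙-no ¬d)))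

  module _ {p : ℕ} (p-prime : Prime p) where

    private instance
      p≢0 : NonZero p
      p≢0 = prime⇒nonZero p-prime

    prime-∣-* : ∀ x y → pos p ∣ x * y → (pos p ∣ x) ⊎ (pos p ∣ y)
    prime-∣-* x y d with euclidsLemma ∣ x ∣ ∣ y ∣ p-prime (subst (p ℕ.∣_) (ℤ.abs-* x y) (∣⇒∣ᵤ d))
    ... | inj₁ d′ = inj₁ (∣ᵤ⇒∣ d′)
    ... | inj₂ d′ = inj₂ (∣ᵤ⇒∣ d′)

    prime-∤-^ : ∀ x n → ¬ pos p ∣ x → ¬ pos p ∣ x ^ n
    prime-∤-^ x zero    p∤x d = ℕ.>⇒∤ (ℕ.nonTrivial⇒n>1 p {{prime⇒nonTrivial p-prime}}) (∣⇒∣ᵤ d)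
    prime-∤-^ x (suc n) p∤x d = [ p∤x , prime-∤-^ x n p∤x ]′ (prime-∣-* x (x ^ n) d)

    inverse : ∀ d → ¬ pos p ∣ d → ∃ λ e → pos p ∣ d * e - 1ℤ
    inverse d p∤d = signed (coprime-Bézout coprime)
      where
      coprime : Coprime p ∣ d ∣
      coprime {i} (i∣p , i∣d) with prime⇒irreducible p-prime i∣p
      ... | inj₁ i≡1  = i≡1
      ... | inj₂ refl = contradiction (∣ᵤ⇒∣ i∣d) p∤d
      abs : ∃ λ u → pos ∣ d ∣ ≡ u * d
      abs with ℤ.+∣i∣≡i⊎+∣i∣≡-i d
      ... | inj₁ eq = 1ℤ , trans eq (sym (ℤ.*-identityˡ d))
      ... | inj₂ eq = - 1ℤ , trans eq (sym (ℤ.-1*i≡-i d))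
      signed : Bézout.Identity 1 p ∣ d ∣ → ∃ λ e → pos p ∣ d * e - 1ℤ
      signed (Bézout.+- x y eq) with abs
      ... | u , ∣d∣≡ud = - (pos y * u) , divides (- pos x) (begin
          d * - (pos y * u) - 1ℤ      ≡⟨ re d (pos y) u ⟩
          - (1ℤ + pos y * (u * d))    ≡⟨ cong (λ z → - (1ℤ + pos y * z)) (sym ∣d∣≡ud) ⟩
          - (1ℤ + pos y * pos ∣ d ∣)  ≡⟨ cong (λ z → - (1ℤ + z)) (sym (ℤ.pos-* y ∣ d ∣)) ⟩
          - pos (1 ℕ.+ y ℕ.* ∣ d ∣)   ≡⟨ cong (λ z → - pos z) eq ⟩
          - pos (x ℕ.* p)             ≡⟨ cong -_ (ℤ.pos-* x p) ⟩
          - (pos x * pos p)           ≡⟨ ℤ.neg-distribˡ-* (pos x) (pos p) ⟩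
          - pos x * pos p             ∎)
        where
        open ≡-Reasoning
        re : ∀ d y u → d * - (y * u) - 1ℤ ≡ - (1ℤ + y * (u * d))
        re = solve-∀
      signed (Bézout.-+ x y eq) with abs
      ... | u , ∣d∣≡ud = pos y * u , divides (pos x) (begin
          d * (pos y * u) - 1ℤ        ≡⟨ re d (pos y) u ⟩
          pos y * (u * d) - 1ℤ        ≡⟨ cong (λ z → pos y * z - 1ℤ) (sym ∣d∣≡ud) ⟩
          pos y * pos ∣ d ∣ - 1ℤ      ≡⟨ cong (_- 1ℤ) (sym (ℤ.pos-* y ∣ d ∣)) ⟩
          pos (y ℕ.* ∣ d ∣) - 1ℤ      ≡⟨ cong (λ z → pos z - 1ℤ) (sym eq) ⟩
          1ℤ + pos (x ℕ.* p) - 1ℤ     ≡⟨ re′ (pos (x ℕ.* p)) ⟩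
          pos (x ℕ.* p)               ≡⟨ ℤ.pos-* x p ⟩
          pos x * pos p               ∎)
        where
        open ≡-Reasoning
        re : ∀ d y u → d * (y * u) - 1ℤ ≡ y * (u * d) - 1ℤ
        re = solve-∀
        re′ : ∀ z → 1ℤ + z - 1ℤ ≡ z
        re′ = solve-∀

    -- As a function of c, the sum has both p and d as periods, so it is constant.
    ∑ᵣ-dilate : ∀ {F} → Periodic p F → ∀ {d} → ¬ pos p ∣ d → ∀ c → ∑ᵣ p (λ b → F (c + b * d)) ≡ ∑ᵣ p F
    ∑ᵣ-dilate {F} per {d} p∤d c with inverse d p∤d
    ... | e , p∣de-1 = trans (const c) (ℤ.*-cancelˡ-≡ (pos p) _ _ total)
      where
      open ≡-Reasoning
      H : ℤ → ℤ
      H c = ∑ᵣ p (λ b → F (c + b * d))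
      per-b : ∀ c → Periodic p (λ b → F (c + b * d))
      per-b c x y dv = per _ _ (subst (pos p ∣_) (re c x y d) (∣m⇒∣m*n d dv))
        where
        re : ∀ c x y d → (x - y) * d ≡ (c + x * d) - (c + y * d)
        re = solve-∀
      const : ∀ c → H c ≡ H 0ℤ
      const c = trans (sym (∑ᵣ-shift (per-b c) (- (c * e))))
        (∑-cong (resid p) λ b → per _ _ (subst (pos p ∣_) (re c (pos b) d e) (∣n⇒∣m*n (- c) p∣de-1)))
        where
        re : ∀ c b d e → - c * (d * e - 1ℤ) ≡ (c + (b + - (c * e)) * d) - (0ℤ + b * d)
        re = solve-∀
      -- The constant value is found by averaging over `c`: after the interchange every inner sum
      -- runs over a full translate of `F`.
      total : pos p * H 0ℤ ≡ pos p * ∑ᵣ p F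
      total = begin
        pos p * H 0ℤ                             ≡⟨ sym (∑ᵣ-const p (H 0ℤ)) ⟩
        ∑ᵣ p (λ _ → H 0ℤ)                        ≡⟨ ∑-cong (resid p) (λ c → sym (const (pos c))) ⟩
        ∑ᵣ p (λ c → ∑ᵣ p (λ b → F (c + b * d)))  ≡⟨ ∑-swap (resid p) (resid p) _ ⟩
        ∑ᵣ p (λ b → ∑ᵣ p (λ c → F (c + b * d)))  ≡⟨ ∑-cong (resid p) (λ b → ∑ᵣ-shift per (pos b * d)) ⟩
        ∑ᵣ p (λ _ → ∑ᵣ p F)                      ≡⟨ ∑ᵣ-const p _ ⟩
        pos p * ∑ᵣ p F                           ∎

-- Roots of polynomials modulo a prime

module RootCounting where

  open FiniteSums
  open Residues
  open import Data.Integer using (ℤ; 0ℤ; _+_; _*_; _-_; -_; _≤_; ∣_∣; _^_) renaming (+_ to pos)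
  open import Data.Integer.Divisibility.Signed
  open import Data.Integer.Tactic.RingSolver using (solve-∀)
  open import Data.List using (List; []; _∷_; length; replicate)
  open import Data.List.Properties using (map-upTo; length-replicate)
  import Data.List.Relation.Unary.All as List
  import Data.List.Relation.Unary.AllPairs.Properties as AllPairs

  -- The polynomial with leading coefficient ℓ and the other coefficients cs,
  -- constant term first.
  eval : ℤ → List ℤ → ℤ → ℤ
  eval ℓ []       x = ℓ
  eval ℓ (c ∷ cs) x = c + x * eval ℓ cs x

  -- Synthetic division by `x - r`: the coefficients of the quotient are the values at `r` of the
  -- successive tails of the polynomial, and the leading coefficient `ℓ` is kept.
  quotient-by : ℤ → ℤ → List ℤ → List ℤ
  quotient-by ℓ r []            = []
  quotient-by ℓ r (c ∷ [])      = []
  quotient-by ℓ r (c ∷ c′ ∷ cs) = eval ℓ (c′ ∷ cs) r ∷ quotient-by ℓ r (c′ ∷ cs)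

  factor : ∀ ℓ r c cs x →
    eval ℓ (c ∷ cs) x - eval ℓ (c ∷ cs) r ≡ (x - r) * eval ℓ (quotient-by ℓ r (c ∷ cs)) x
  factor ℓ r c []        x = lemma c x r ℓ
    where
    lemma : ∀ c x r ℓ → c + x * ℓ - (c + r * ℓ) ≡ (x - r) * ℓ
    lemma = solve-∀
  factor ℓ r c (c′ ∷ cs) x = begin
    c + x * hx - (c + r * hr)          ≡⟨ lemma c x r hx hr ⟩
    x * (hx - hr) + (x - r) * hr       ≡⟨ cong (λ z → x * z + (x - r) * hr) (factor ℓ r c′ cs x) ⟩
    x * ((x - r) * q) + (x - r) * hr   ≡⟨ lemma′ x (x - r) q hr ⟩
    (x - r) * (hr + x * q)             ∎
    where
    open ≡-Reasoning
    hx hr q : ℤ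
    hx = eval ℓ (c′ ∷ cs) x
    hr = eval ℓ (c′ ∷ cs) r
    q = eval ℓ (quotient-by ℓ r (c′ ∷ cs)) x
    lemma : ∀ c x r hx hr → c + x * hx - (c + r * hr) ≡ x * (hx - hr) + (x - r) * hr
    lemma = solve-∀
    lemma′ : ∀ x y q hr → x * (y * q) + y * hr ≡ y * (hr + x * q)
    lemma′ = solve-∀

  length-quotient : ∀ ℓ r c cs → length (quotient-by ℓ r (c ∷ cs)) ≡ length cs
  length-quotient ℓ r c []        = refl
  length-quotient ℓ r c (c′ ∷ cs) = cong suc (length-quotient ℓ r c′ cs)

  eval-monomial : ∀ ℓ n x → eval ℓ (replicate n 0ℤ) x ≡ ℓ * x ^ n
  eval-monomial ℓ zero    x = sym (ℤ.*-identityʳ ℓ)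
  eval-monomial ℓ (suc n) x = trans (ℤ.+-identityˡ _) (trans (cong (x *_) (eval-monomial ℓ n x)) (lemma x ℓ (x ^ n)))
    where
    lemma : ∀ x ℓ y → x * (ℓ * y) ≡ ℓ * (x * y)
    lemma = solve-∀

  module _ {p : ℕ} (p-prime : Prime p) where

    private instance
      p≢0 : NonZero p
      p≢0 = prime⇒nonZero p-prime

    -- Lagrange's induction. A root `u` is divided out; since `p` is prime, every other root in the
    -- list is a root of the quotient, which has degree one less and the same leading coefficient,
    -- prime to `p`.
    roots≤degree : ∀ {ℓ} → ¬ pos p ∣ ℓ → (us : List ℕ) → AllPairs (λ u v → ¬ pos p ∣ pos v - pos u) us →
      ∀ cs → ∑ us (λ u → 𝟙 p (eval ℓ cs (pos u))) ≤ pos (length cs)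
    roots≤degree         p∤ℓ []       _             cs = 0≤pos
    roots≤degree {ℓ} p∤ℓ (u ∷ us) (u≢us ∷ distinct) cs with pos p ∣? eval ℓ cs (pos u)
    ... | no ¬root = subst (_≤ pos (length cs))
      (sym (trans (cong (_+ ∑ us (λ u → 𝟙 p (eval ℓ cs (pos u)))) (𝟙-no ¬root)) (ℤ.+-identityˡ _)))
      (roots≤degree p∤ℓ us distinct cs)
    roots≤degree     p∤ℓ (u ∷ us) (u≢us ∷ distinct) []       | yes root = contradiction root p∤ℓ
    roots≤degree {ℓ} p∤ℓ (u ∷ us) (u≢us ∷ distinct) (c ∷ cs) | yes root =
      ℤ.+-mono-≤ (𝟙≤1 p _) (ℤ.≤-trans (∑-mono-∈ us λ v∈ → 𝟙-mono (root-of-quotient (List.lookup u≢us v∈)))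
        (subst (λ l → ∑ us (λ v → 𝟙 p (eval ℓ q (pos v))) ≤ pos l) (length-quotient ℓ (pos u) c cs) (roots≤degree p∤ℓ us distinct q)))
      where
      q : List ℤ
      q = quotient-by ℓ (pos u) (c ∷ cs)
      root-of-quotient : ∀ {v} → ¬ pos p ∣ pos v - pos u →
        pos p ∣ eval ℓ (c ∷ cs) (pos v) → pos p ∣ eval ℓ q (pos v)
      root-of-quotient {v} p∤v-u root′ =
        [ (λ d → contradiction d p∤v-u) , (λ d → d) ]′
          (prime-∣-* p-prime _ _ (subst (pos p ∣_) (factor ℓ (pos u) c cs (pos v)) (∣m∣n⇒∣m-n root′ root)))

    resid-distinct : AllPairs (λ u v → ¬ pos p ∣ pos v - pos u) (resid p)
    resid-distinct = subst (AllPairs _) (sym (map-upTo suc p)) (AllPairs.applyUpTo⁺₁ suc p distinct)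
      where
      distinct : ∀ {i j} → i ℕ.< j → j ℕ.< p → ¬ pos p ∣ pos (suc j) - pos (suc i)
      distinct {i} {j} i<j j<p d = ℕ.>⇒∤ {{ℕ.>-nonZero (ℕ.m<n⇒0<n∸m i<j)}} (ℕ.≤-<-trans (ℕ.m∸n≤m j i) j<p)
        (subst (p ℕ.∣_) (cong ∣_∣ (trans (ℤ.m-n≡m⊖n (suc j) (suc i)) (ℤ.⊖-≥ (s≤s (ℕ.<⇒≤ i<j))))) (∣⇒∣ᵤ d))

    -- The polynomial `c + b u^(k+1)` has degree `k + 1` and a unit as leading coefficient. This
    -- bound for the fibres of the power map takes the place of the structure of the unit group.
    k-th-power-fibre : ∀ k {b} → ¬ pos p ∣ b → ∀ c →
      ∑ᵣ p (λ u → 𝟙 p (c + b * u ^ suc k)) ≤ pos (suc k)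
    k-th-power-fibre k {b} p∤b c = subst₂ _≤_
      (∑-cong (resid p) λ u → cong (𝟙 p) (value (pos u)))
      (cong (λ l → pos (suc l)) (length-replicate k))
      (roots≤degree p∤b (resid p) resid-distinct (c ∷ replicate k 0ℤ))
      where
      lemma : ∀ c u b y → c + u * (b * y) ≡ c + b * (u * y)
      lemma = solve-∀
      value : ∀ u → eval b (c ∷ replicate k 0ℤ) u ≡ c + b * u ^ suc k
      value u = trans (cong (λ z → c + u * z) (eval-monomial b k u)) (lemma c u b (u ^ k))

-- Convolution with k-th powers in mean square

module PowerConvolution where

  open FiniteSums
  open Residues
  open RootCounting
  open import Data.Integer using (ℤ; 0ℤ; 1ℤ; _+_; _*_; _-_; -_; _≤_; ∣_∣; _^_) renaming (+_ to pos)
  open import Data.Integer.Divisibility.Signed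
  open import Data.Integer.Tactic.RingSolver using (solve-∀)

  ∣-^ : ∀ {m} x y n → m ∣ x - y → m ∣ x ^ n - y ^ n
  ∣-^ x y zero    d = divides 0ℤ refl
  ∣-^ {m} x y (suc n) d = subst (m ∣_) (lemma x y (x ^ n) (y ^ n))
    (∣m∣n⇒∣m+n (∣m⇒∣m*n (x ^ n) d) (∣n⇒∣m*n y (∣-^ x y n d)))
    where
    lemma : ∀ x y X Y → (x - y) * X + y * (X - Y) ≡ x * X - y * Y
    lemma = solve-∀

  difference-+ : ∀ {m} a x y → m ∣ x - y → m ∣ (a + x) - (a + y)
  difference-+ {m} a x y = subst (m ∣_) (lemma a x y)
    where
    lemma : ∀ a x y → x - y ≡ (a + x) - (a + y)
    lemma = solve-∀

  difference-* : ∀ {m} a x y → m ∣ x - y → m ∣ a * x - a * y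
  difference-* {m} a x y d = subst (m ∣_) (lemma a x y) (∣n⇒∣m*n a d)
    where
    lemma : ∀ a x y → a * (x - y) ≡ a * x - a * y
    lemma = solve-∀

  module PowerSums {p : ℕ} (p-prime : Prime p) (k′ : ℕ) where

    private
      instance
        p≢0 : NonZero p
        p≢0 = prime⇒nonZero p-prime
      k : ℕ
      k = suc k′

    norm² : (ℤ → ℤ) → ℤ
    norm² F = ∑ᵣ p (λ c → F c * F c)

    -- Adding a variable `x` with coefficient `b` to the form turns a function `F` of the offset
    -- into this convolution with the values of `b x^k`.
    spread : ℤ → (ℤ → ℤ) → ℤ → ℤ
    spread b F e = ∑ᵣ p (λ x → F (e + b * x ^ k))

    0≤norm² : ∀ F → 0ℤ ≤ norm² F
    0≤norm² F = ∑-nonneg (resid p) λ c → 0≤² (F (pos c))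

    spread-periodic : ∀ {F} → Periodic p F → ∀ b → Periodic p (spread b F)
    spread-periodic per b x y d = ∑-cong (resid p) λ z → per _ _ (subst (pos p ∣_) (lemma x y _) d)
      where
      lemma : ∀ x y z → x - y ≡ (x + z) - (y + z)
      lemma = solve-∀

    spread-mean : ∀ {F} → Periodic p F → ∑ᵣ p F ≡ 0ℤ → ∀ b → ∑ᵣ p (spread b F) ≡ 0ℤ
    spread-mean per mean0 b = trans (∑-swap (resid p) (resid p) _)
      (trans (∑-cong (resid p) λ x → trans (∑ᵣ-shift per (b * pos x ^ k)) mean0) (∑-0 (resid p)))

    module _ {F : ℤ → ℤ} (per : Periodic p F) (mean0 : ∑ᵣ p F ≡ 0ℤ) where

      private
        -- Translating `c` by `- b X` frees the first factor `F c` from `b`, so that the sum over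
        -- `b` can be carried out first and involves `X` and `Y` through `Y - X` alone.
        correlation : ∀ X Y →
          ∑ᵣ p (λ b → ∑ᵣ p (λ c → F (c + b * X) * F (c + b * Y))) ≡ ∑ᵣ p (λ c → F c * ∑ᵣ p (λ b → F (c + b * (Y - X))))
        correlation X Y = begin
          ∑ᵣ p (λ b → ∑ᵣ p (λ c → F (c + b * X) * F (c + b * Y)))
            ≡⟨ ∑-cong (resid p) (λ b → sym (∑ᵣ-shift (per′ (pos b)) (- (pos b * X)))) ⟩
          ∑ᵣ p (λ b → ∑ᵣ p (λ c → F (c + - (b * X) + b * X) * F (c + - (b * X) + b * Y)))
            ≡⟨ ∑-cong (resid p) (λ b → ∑-cong (resid p) (λ c →
                 cong₂ (λ u v → F u * F v) (cancel (pos c) (pos b * X)) (merge (pos c) (pos b) X Y))) ⟩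
          ∑ᵣ p (λ b → ∑ᵣ p (λ c → F c * F (c + b * (Y - X))))
            ≡⟨ ∑-swap (resid p) (resid p) _ ⟩
          ∑ᵣ p (λ c → ∑ᵣ p (λ b → F c * F (c + b * (Y - X))))
            ≡⟨ ∑-cong (resid p) (λ c → ∑-*ˡ (resid p) (F (pos c)) _) ⟩
          ∑ᵣ p (λ c → F c * ∑ᵣ p (λ b → F (c + b * (Y - X)))) ∎
          where
          open ≡-Reasoning
          cancel : ∀ c t → c + - t + t ≡ c
          cancel = solve-∀
          merge : ∀ c b X Y → c + - (b * X) + b * Y ≡ c + b * (Y - X)
          merge = solve-∀
          lemma : ∀ x y z → x - y ≡ (x + z) - (y + z)
          lemma = solve-∀
          per′ : ∀ b → Periodic p (λ c → F (c + b * X) * F (c + b * Y))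
          per′ b x y d = cong₂ _*_ (per _ _ (subst (pos p ∣_) (lemma x y (b * X)) d))
                                   (per _ _ (subst (pos p ∣_) (lemma x y (b * Y)) d))

        -- If `p` does not divide `Y - X`, then `c + b (Y - X)` runs over all residues with `b`, and
        -- the mean value 0 annihilates the sum. Otherwise `b` drops out and contributes a factor
        -- `p`.
        correlation≤ : ∀ X Y → ∑ᵣ p (λ c → F c * ∑ᵣ p (λ b → F (c + b * (Y - X)))) ≤ 𝟙 p (Y - X) * (pos p * norm² F)
        correlation≤ X Y with pos p ∣? (Y - X)
        ... | yes p∣Y-X = ℤ.≤-reflexive (begin
            ∑ᵣ p (λ c → F c * ∑ᵣ p (λ b → F (c + b * (Y - X))))
              ≡⟨ ∑-cong (resid p) (λ c → cong (F (pos c) *_) (∑-cong (resid p) λ b → per _ _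
                   (subst (pos p ∣_) (lemma (pos c) (pos b * (Y - X))) (∣n⇒∣m*n (pos b) p∣Y-X)))) ⟩
            ∑ᵣ p (λ c → F c * ∑ᵣ p (λ b → F c))
              ≡⟨ ∑-cong (resid p) (λ c → trans (cong (F (pos c) *_) (∑ᵣ-const p _)) (lemma′ (F (pos c)) (pos p))) ⟩
            ∑ᵣ p (λ c → pos p * (F c * F c))
              ≡⟨ ∑-*ˡ (resid p) (pos p) _ ⟩
            pos p * norm² F
              ≡⟨ sym (trans (cong (_* (pos p * norm² F)) (𝟙-yes p∣Y-X)) (ℤ.*-identityˡ _)) ⟩
            𝟙 p (Y - X) * (pos p * norm² F) ∎)
          where
          open ≡-Reasoning
          lemma : ∀ c t → t ≡ c + t - c
          lemma = solve-∀
          lemma′ : ∀ x p → x * (p * x) ≡ p * (x * x)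
          lemma′ = solve-∀
        ... | no p∤Y-X = ℤ.≤-reflexive (begin
            ∑ᵣ p (λ c → F c * ∑ᵣ p (λ b → F (c + b * (Y - X))))
              ≡⟨ ∑-cong (resid p) (λ c → trans (cong (F (pos c) *_)
                   (trans (∑ᵣ-dilate p-prime per p∤Y-X (pos c)) mean0)) (ℤ.*-zeroʳ (F (pos c)))) ⟩
            ∑ᵣ p (λ c → 0ℤ)
              ≡⟨ ∑-0 (resid p) ⟩
            0ℤ
              ≡⟨ sym (cong (_* (pos p * norm² F)) (𝟙-no p∤Y-X)) ⟩
            𝟙 p (Y - X) * (pos p * norm² F) ∎)
          where open ≡-Reasoning

      -- After the squares are expanded, only pairs with `x^k ≡ y^k` survive the sum over `b`, and
      -- there are at most `k p` of them.
      total-norm² : ∑ᵣ p (λ b → norm² (spread b F)) ≤ pos p * (pos k * (pos p * norm² F))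
      total-norm² = begin
        ∑ᵣ p (λ b → norm² (spread b F))
          ≡⟨ ∑-cong (resid p) (λ b → trans
               (∑-cong (resid p) λ c → ∑-*-∑ (resid p) (resid p) _ _)
               (trans (∑-swap (resid p) (resid p) _) (∑-cong (resid p) λ x → ∑-swap (resid p) (resid p) _))) ⟩
        ∑ᵣ p (λ b → ∑ᵣ p (λ x → ∑ᵣ p (λ y → ∑ᵣ p (λ c → F (c + b * x ^ k) * F (c + b * y ^ k)))))
          ≡⟨ trans (∑-swap (resid p) (resid p) _) (∑-cong (resid p) λ x → ∑-swap (resid p) (resid p) _) ⟩
        ∑ᵣ p (λ x → ∑ᵣ p (λ y → ∑ᵣ p (λ b → ∑ᵣ p (λ c → F (c + b * x ^ k) * F (c + b * y ^ k)))))
          ≡⟨ ∑-cong (resid p) (λ x → ∑-cong (resid p) λ y → correlation (pos x ^ k) (pos y ^ k)) ⟩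
        ∑ᵣ p (λ x → ∑ᵣ p (λ y → ∑ᵣ p (λ c → F c * ∑ᵣ p (λ b → F (c + b * (y ^ k - x ^ k))))))
          ≤⟨ ∑-mono (resid p) (λ x → ∑-mono (resid p) λ y → correlation≤ (pos x ^ k) (pos y ^ k)) ⟩
        ∑ᵣ p (λ x → ∑ᵣ p (λ y → 𝟙 p (y ^ k - x ^ k) * (pos p * norm² F)))
          ≡⟨ ∑-cong (resid p) (λ x → ∑-*ʳ (resid p) (pos p * norm² F) _) ⟩
        ∑ᵣ p (λ x → ∑ᵣ p (λ y → 𝟙 p (y ^ k - x ^ k)) * (pos p * norm² F))
          ≤⟨ ∑-mono (resid p) (λ x → *-monoʳ _ (0≤* {pos p} 0≤pos (0≤norm² F)) (fibre (pos x))) ⟩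
        ∑ᵣ p (λ _ → pos k * (pos p * norm² F))
          ≡⟨ ∑ᵣ-const p _ ⟩
        pos p * (pos k * (pos p * norm² F)) ∎
        where
        open ℤ.≤-Reasoning
        lemma : ∀ x y → - x + 1ℤ * y ≡ y - x
        lemma = solve-∀
        p∤1 : ¬ pos p ∣ 1ℤ
        p∤1 d = ℕ.>⇒∤ (ℕ.nonTrivial⇒n>1 p {{prime⇒nonTrivial p-prime}}) (∣⇒∣ᵤ d)
        fibre : ∀ x → ∑ᵣ p (λ y → 𝟙 p (y ^ k - x ^ k)) ≤ pos k
        fibre x = subst (_≤ pos k)
          (∑-cong (resid p) λ y → cong (𝟙 p) (lemma (x ^ k) (pos y ^ k)))
          (k-th-power-fibre p-prime k′ p∤1 (- (x ^ k)))

      private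
        -- Replacing `x` by `x u` permutes the residues and moves `u^k` from the coefficient into
        -- the variable.
        spread-power : ∀ b u → ¬ pos p ∣ u → ∀ e → spread (b * u ^ k) F e ≡ spread b F e
        spread-power b u p∤u e = begin
          ∑ᵣ p (λ x → F (e + b * u ^ k * x ^ k))       ≡⟨ ∑-cong (resid p) (λ x → cong F (rewriting (pos x))) ⟩
          ∑ᵣ p (λ x → F (e + b * (0ℤ + x * u) ^ k))    ≡⟨ ∑ᵣ-dilate p-prime per′ p∤u 0ℤ ⟩
          ∑ᵣ p (λ x → F (e + b * x ^ k))               ∎
          where
          open ≡-Reasoning
          lemma : ∀ e b u x → e + b * u * x ≡ e + b * (x * u)
          lemma = solve-∀
          rewriting : ∀ x → e + b * u ^ k * x ^ k ≡ e + b * (0ℤ + x * u) ^ k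
          rewriting x = trans (lemma e b (u ^ k) (x ^ k)) (cong (λ z → e + b * z)
            (sym (trans (cong (_^ k) (ℤ.+-identityˡ (x * u))) (^-distrib-* x u k))))
          per′ : Periodic p (λ x → F (e + b * x ^ k))
          per′ x y d = per _ _ (difference-+ e (b * x ^ k) (b * y ^ k) (difference-* b (x ^ k) (y ^ k) (∣-^ x y k d)))

        norm²-periodic : Periodic p (λ b → norm² (spread b F))
        norm²-periodic x y d = ∑-cong (resid p) λ c → cong (λ z → z * z)
          (∑-cong (resid p) λ z → per _ _ (difference-+ (pos c) (x * pos z ^ k) (y * pos z ^ k) (scale (pos z ^ k))))
          where
          lemma : ∀ x y z → (x - y) * z ≡ x * z - y * z
          lemma = solve-∀
          scale : ∀ z → pos p ∣ x * z - y * z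
          scale z = subst (pos p ∣_) (lemma x y z) (∣m⇒∣m*n z d)

        units≤∑ᵣ : ∀ {n} {H : ℤ → ℤ} {h} → (∀ x → 0ℤ ≤ H x) → (∀ x → ¬ pos (suc n) ∣ x → h ≤ H x) →
          pos n * h ≤ ∑ᵣ (suc n) H
        units≤∑ᵣ {n} {H} {h} 0≤H h≤H = begin
          pos n * h                  ≡⟨ sym (∑ᵣ-const n h) ⟩
          ∑ᵣ n (λ _ → h)             ≤⟨ ∑-mono-∈ (resid n) (λ x∈ → h≤H _ (unit (∈resid⇒bounds x∈))) ⟩
          ∑ᵣ n H                     ≡⟨ sym (ℤ.+-identityʳ _) ⟩
          ∑ᵣ n H + 0ℤ                ≤⟨ ℤ.+-monoʳ-≤ (∑ᵣ n H) (0≤H (pos (suc n))) ⟩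
          ∑ᵣ n H + H (pos (suc n))   ≡⟨ sym (∑ᵣ-suc n H) ⟩
          ∑ᵣ (suc n) H ∎
          where
          open ℤ.≤-Reasoning
          unit : ∀ {x} → (1 ℕ.≤ x) × (x ℕ.≤ n) → ¬ pos (suc n) ∣ pos x
          unit {suc x} (_ , x≤n) d = ℕ.>⇒∤ (s≤s x≤n) (∣⇒∣ᵤ d)

        p≡ : suc (ℕ.pred p) ≡ p
        p≡ = ℕ.suc-pred p

      -- The left-hand side depends only on the class of b modulo k-th powers.
      norm²-class : ∀ b → ¬ pos p ∣ b → pos (ℕ.pred p) * norm² (spread b F) ≤ pos k * ∑ᵣ p (λ b → norm² (spread b F))
      norm²-class b p∤b = begin
        pos (ℕ.pred p) * H b
          ≤⟨ units ⟩
        ∑ᵣ p (λ u → H (b * u ^ k))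
          -- The values `H (b u^k)` are regrouped by the residue of `b u^k`; each residue is
          -- attained at most `k` times.
          ≡⟨ ∑-cong (resid p) (λ u → sym (∑ᵣ-𝟙-* p norm²-periodic (b * pos u ^ k))) ⟩
        ∑ᵣ p (λ u → ∑ᵣ p (λ b′ → 𝟙 p (b′ - b * u ^ k) * H b′))
          ≡⟨ ∑-swap (resid p) (resid p) _ ⟩
        ∑ᵣ p (λ b′ → ∑ᵣ p (λ u → 𝟙 p (b′ - b * u ^ k) * H b′))
          ≡⟨ ∑-cong (resid p) (λ b′ → ∑-*ʳ (resid p) (H (pos b′)) _) ⟩
        ∑ᵣ p (λ b′ → ∑ᵣ p (λ u → 𝟙 p (b′ - b * u ^ k)) * H b′)
          ≤⟨ ∑-mono (resid p) (λ b′ → *-monoʳ (H (pos b′)) (0≤norm² (spread (pos b′) F)) (fibre (pos b′))) ⟩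
        ∑ᵣ p (λ b′ → pos k * H b′)
          ≡⟨ ∑-*ˡ (resid p) (pos k) _ ⟩
        pos k * ∑ᵣ p H ∎
        where
        open ℤ.≤-Reasoning
        H : ℤ → ℤ
        H b = norm² (spread b F)
        units : pos (ℕ.pred p) * H b ≤ ∑ᵣ p (λ u → H (b * u ^ k))
        units = subst (λ q → pos (ℕ.pred p) * H b ≤ ∑ᵣ q (λ u → H (b * u ^ k))) p≡
          (units≤∑ᵣ (λ u → 0≤norm² (spread (b * u ^ k) F)) λ u p∤u → ℤ.≤-reflexive (sym (∑-cong (resid p) λ c →
            cong (λ z → z * z) (spread-power b u (λ d → p∤u (subst (λ q → pos q ∣ u) (sym p≡) d)) (pos c)))))
        lemma : ∀ b c x → c + (- b) * x ≡ c - b * x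
        lemma = solve-∀
        p∤-b : ¬ pos p ∣ - b
        p∤-b d = p∤b (subst (pos p ∣_) (ℤ.neg-involutive b) (∣m⇒∣-m d))
        fibre : ∀ c → ∑ᵣ p (λ u → 𝟙 p (c - b * u ^ k)) ≤ pos k
        fibre c = subst (_≤ pos k) (∑-cong (resid p) λ u → cong (𝟙 p) (lemma b c (pos u ^ k)))
          (k-th-power-fibre p-prime k′ p∤-b c)

-- Counting zeros of a diagonal form modulo a prime

module CongruenceCounts where

  open FiniteSums
  open Residues
  open RootCounting
  open PowerConvolution
  open import Defs using (diagonalForm; box; solutionCount)
  open import Data.Integer using (ℤ; 0ℤ; 1ℤ; _+_; _*_; _-_; -_; _≤_; +≤+; +<+; ∣_∣; _^_; positive) renaming (+_ to pos)
  open import Data.Integer.Divisibility.Signed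
  open import Data.Integer.Tactic.RingSolver using (solve-∀)

  -- The offset `e` makes the count recursive in the number of variables.
  congruenceCount : ∀ {s} → ℕ → ℕ → ℕ → Vec ℤ s → ℤ → ℤ
  congruenceCount {s} k m n a e = ∑ (box s n) (λ x → 𝟙 m (e + diagonalForm k a x))

  congruenceCount-∷ : ∀ {s} k m n a (as : Vec ℤ s) e →
    congruenceCount k m n (a ∷ as) e ≡ ∑ᵣ n (λ x → congruenceCount k m n as (e + a * x ^ k))
  congruenceCount-∷ {s} k m n a as e = trans (∑-product _∷_ (resid n) (box s n) _)
    (∑-cong (resid n) λ x → ∑-cong (box s n) λ xs → cong (𝟙 m) (sym (ℤ.+-assoc e (a * pos x ^ k) _)))

  solutionCount≡ : ∀ {s} k (a : Vec ℤ s) q → pos (solutionCount k a q) ≡ congruenceCount k q q a 0ℤ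
  solutionCount≡ {s} k a q = trans (∑-filter-length (λ x → q ℕ.∣? ∣ diagonalForm k a x ∣) (box s q))
    (∑-cong (box s q) λ x → sym (trans (cong (𝟙 q) (ℤ.+-identityˡ _)) (𝟙-if q (diagonalForm k a x))))

  divisibleEntries : ∀ {s} → ℕ → Vec ℤ s → ℕ
  divisibleEntries p []       = 0
  divisibleEntries p (a ∷ as) = (if does (p ℕ.∣? ∣ a ∣) then 1 else 0) ℕ.+ divisibleEntries p as

  module MeanSquare {p : ℕ} (p-prime : Prime p) (k′ : ℕ) where

    open PowerSums p-prime k′

    private
      instance
        p≢0 : NonZero p
        p≢0 = prime⇒nonZero p-prime
      k : ℕ
      k = suc k′

    -- The growth of the squared L² norm per variable: one factor `k` from the fibres in the total
    -- over `b`, another from comparing one class with this total, and `p * p / (p - 1) ≤ 2 p`. The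
    -- trivial growth would be `p * p`.
    amplification : ℕ
    amplification = 2 ℕ.* (k ℕ.* k) ℕ.* p

    private
      1<p : 1 ℕ.< p
      1<p = ℕ.nonTrivial⇒n>1 p {{prime⇒nonTrivial p-prime}}

      p≤2[p-1] : p ℕ.≤ 2 ℕ.* ℕ.pred p
      p≤2[p-1] = subst (ℕ._≤ 2 ℕ.* ℕ.pred p) (ℕ.suc-pred p)
        (subst (suc q ℕ.≤_) (cong (q ℕ.+_) (sym (ℕ.+-identityʳ q))) (ℕ.+-monoˡ-≤ q 1≤q))
        where
        q : ℕ
        q = ℕ.pred p
        1≤q : 1 ℕ.≤ q
        1≤q = ℕ.≤-pred (subst (2 ℕ.≤_) (sym (ℕ.suc-pred p)) 1<p)

    module _ {F : ℤ → ℤ} (per : Periodic p F) (mean0 : ∑ᵣ p F ≡ 0ℤ) where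

      norm²-spread : ∀ b → ¬ pos p ∣ b → norm² (spread b F) ≤ pos amplification * norm² F
      norm²-spread b p∤b = ℤ.*-cancelˡ-≤-pos _ _ (pos q) {{positive (+<+ 0<q)}} (begin
        pos q * norm² (spread b F)
          ≤⟨ norm²-class per mean0 b p∤b ⟩
        pos k * ∑ᵣ p (λ b → norm² (spread b F))
          ≤⟨ *-monoˡ (pos k) 0≤pos (total-norm² per mean0) ⟩
        pos k * (pos p * (pos k * (pos p * norm² F)))
          ≡⟨ lemma (pos k) (pos p) (norm² F) ⟩
        pos p * (pos k * pos k * pos p * norm² F)
          ≤⟨ *-monoʳ _ (0≤* {pos k * pos k * pos p} (0≤* {pos k * pos k} (0≤* {pos k} {pos k} 0≤pos 0≤pos) 0≤pos) (0≤norm² F)) (+≤+ p≤2[p-1]) ⟩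
        pos (2 ℕ.* q) * (pos k * pos k * pos p * norm² F)
          ≡⟨ cong (_* (pos k * pos k * pos p * norm² F)) (ℤ.pos-* 2 q) ⟩
        pos 2 * pos q * (pos k * pos k * pos p * norm² F)
          ≡⟨ lemma′ (pos q) (pos 2) (pos k) (pos p) (norm² F) ⟩
        pos q * (pos 2 * (pos k * pos k) * pos p * norm² F)
          ≡⟨ cong (λ z → pos q * (z * norm² F)) (sym pos-amplification) ⟩
        pos q * (pos amplification * norm² F) ∎)
        where
        open ℤ.≤-Reasoning
        q : ℕ
        q = ℕ.pred p
        0<q : 0 ℕ.< q
        0<q = ℕ.≤-pred (subst (2 ℕ.≤_) (sym (ℕ.suc-pred p)) 1<p)
        pos-amplification : pos amplification ≡ pos 2 * (pos k * pos k) * pos p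
        pos-amplification = trans (ℤ.pos-* (2 ℕ.* (k ℕ.* k)) p)
          (cong (_* pos p) (trans (ℤ.pos-* 2 (k ℕ.* k)) (cong (pos 2 *_) (ℤ.pos-* k k))))
        lemma : ∀ k p n → k * (p * (k * (p * n))) ≡ p * (k * k * p * n)
        lemma = solve-∀
        lemma′ : ∀ q t k p n → t * q * (k * k * p * n) ≡ q * (t * (k * k) * p * n)
        lemma′ = solve-∀

      -- All terms `b x^k` vanish modulo `p`, so the convolution is multiplication by `p` and
      -- nothing is saved.
      norm²-spread-∣ : ∀ b → pos p ∣ b → norm² (spread b F) ≡ pos (p ℕ.* p) * norm² F
      norm²-spread-∣ b p∣b = trans
        (∑-cong (resid p) λ c → trans (cong (λ z → z * z) (collapse (pos c)))
          (trans (lemma (pos p) (F (pos c))) (cong (_* (F (pos c) * F (pos c))) (sym (ℤ.pos-* p p)))))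
        (∑-*ˡ (resid p) (pos (p ℕ.* p)) _)
        where
        lemma : ∀ p x → p * x * (p * x) ≡ p * p * (x * x)
        lemma = solve-∀
        lemma′ : ∀ c t → t ≡ c + t - c
        lemma′ = solve-∀
        collapse : ∀ c → spread b F c ≡ pos p * F c
        collapse c = trans (∑-cong (resid p) λ x → per _ _
          (subst (pos p ∣_) (lemma′ c (b * pos x ^ k)) (∣m⇒∣m*n (pos x ^ k) p∣b))) (∑ᵣ-const p (F c))

    -- `p` times the excess of the number of zeros over `p^(s-1)`, built up from the empty form one
    -- variable at a time. The factor `p` makes the starting function, of mean zero, integral.
    discrepancy : ∀ {s} → Vec ℤ s → ℤ → ℤ
    discrepancy []       = λ e → pos p * 𝟙 p e - 1ℤ
    discrepancy (a ∷ as) = spread a (discrepancy as)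

    discrepancy≡ : ∀ {s} (a : Vec ℤ s) e →
      discrepancy a e ≡ pos p * congruenceCount k p p a e - pos (p ℕ.^ s)
    discrepancy≡ []       e = cong (λ z → pos p * z - 1ℤ) (sym (trans (ℤ.+-identityʳ _) (cong (𝟙 p) (ℤ.+-identityʳ e))))
    discrepancy≡ {suc s} (a ∷ as) e = begin
      ∑ᵣ p (λ x → discrepancy as (e + a * x ^ k))
        ≡⟨ ∑-cong (resid p) (λ x → discrepancy≡ as (e + a * pos x ^ k)) ⟩
      ∑ᵣ p (λ x → pos p * congruenceCount k p p as (e + a * x ^ k) - pos (p ℕ.^ s))
        ≡⟨ ∑-- (resid p) _ _ ⟩
      ∑ᵣ p (λ x → pos p * congruenceCount k p p as (e + a * x ^ k)) - ∑ᵣ p (λ _ → pos (p ℕ.^ s))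
        ≡⟨ cong₂ _-_ (trans (∑-*ˡ (resid p) (pos p) _) (cong (pos p *_) (sym (congruenceCount-∷ k p p a as e))))
                     (trans (∑ᵣ-const p _) (sym (ℤ.pos-* p (p ℕ.^ s)))) ⟩
      pos p * congruenceCount k p p (a ∷ as) e - pos (p ℕ.^ suc s) ∎
      where open ≡-Reasoning

    discrepancy-periodic : ∀ {s} (a : Vec ℤ s) → Periodic p (discrepancy a)
    discrepancy-periodic []       x y d = cong (λ z → pos p * z - 1ℤ) (𝟙-periodic p x y d)
    discrepancy-periodic (a ∷ as) = spread-periodic (discrepancy-periodic as) a

    discrepancy-mean : ∀ {s} (a : Vec ℤ s) → ∑ᵣ p (discrepancy a) ≡ 0ℤ
    discrepancy-mean [] = begin
      ∑ᵣ p (λ e → pos p * 𝟙 p e - 1ℤ)                  ≡⟨ ∑-- (resid p) _ _ ⟩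
      ∑ᵣ p (λ e → pos p * 𝟙 p e) - ∑ᵣ p (λ _ → 1ℤ)     ≡⟨ cong₂ _-_ (∑-*ˡ (resid p) (pos p) _) (∑ᵣ-const p 1ℤ) ⟩
      pos p * ∑ᵣ p (𝟙 p) - pos p * 1ℤ                   ≡⟨ cong (λ z → pos p * z - pos p * 1ℤ) (∑ᵣ-𝟙₀ p) ⟩
      pos p * 1ℤ - pos p * 1ℤ                           ≡⟨ ℤ.+-inverseʳ (pos p * 1ℤ) ⟩
      0ℤ                                                ∎
      where open ≡-Reasoning
    discrepancy-mean (a ∷ as) = spread-mean (discrepancy-periodic as) (discrepancy-mean as) a

    -- A coefficient prime to `p` contributes `amplification`; one divisible by `p` contributes
    -- `p * p`, which is at most `amplification * p` and is paid for by the factor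
    -- `p ^ divisibleEntries p a`. The empty form accounts for the final `p * p`.
    norm²-discrepancy : ∀ {s} (a : Vec ℤ s) →
      norm² (discrepancy a) ≤ pos (amplification ℕ.^ s ℕ.* p ℕ.^ divisibleEntries p a ℕ.* (p ℕ.* p))
    norm²-discrepancy [] = begin
      ∑ᵣ p (λ e → (pos p * 𝟙 p e - 1ℤ) * (pos p * 𝟙 p e - 1ℤ))
        ≤⟨ ∑-mono (resid p) (λ e → pointwise (pos e)) ⟩
      ∑ᵣ p (λ e → (pos p * pos p - pos p) * 𝟙 p e + 1ℤ)
        ≡⟨ ∑-+ (resid p) _ _ ⟩
      ∑ᵣ p (λ e → (pos p * pos p - pos p) * 𝟙 p e) + ∑ᵣ p (λ _ → 1ℤ)
        ≡⟨ cong₂ _+_ (trans (∑-*ˡ (resid p) (pos p * pos p - pos p) _)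
             (cong ((pos p * pos p - pos p) *_) (∑ᵣ-𝟙₀ p))) (∑ᵣ-const p 1ℤ) ⟩
      (pos p * pos p - pos p) * 1ℤ + pos p * 1ℤ
        ≡⟨ lemma (pos p) ⟩
      pos p * pos p
        ≡⟨ sym (trans (cong pos (ℕ.+-identityʳ (p ℕ.* p))) (ℤ.pos-* p p)) ⟩
      pos (1 ℕ.* (p ℕ.* p)) ∎
      where
      open ℤ.≤-Reasoning
      lemma : ∀ p → (p * p - p) * 1ℤ + p * 1ℤ ≡ p * p
      lemma = solve-∀
      -- The majorant exceeds the square by exactly `p` where the indicator is 1, and equals it
      -- where the indicator is 0.
      at-one : ∀ p → p ≡ (p * p - p) * 1ℤ + 1ℤ - (p * 1ℤ - 1ℤ) * (p * 1ℤ - 1ℤ)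
      at-one = solve-∀
      at-zero : ∀ p → (p * 0ℤ - 1ℤ) * (p * 0ℤ - 1ℤ) ≡ (p * p - p) * 0ℤ + 1ℤ
      at-zero = solve-∀
      pointwise : ∀ e → (pos p * 𝟙 p e - 1ℤ) * (pos p * 𝟙 p e - 1ℤ) ≤ (pos p * pos p - pos p) * 𝟙 p e + 1ℤ
      pointwise e with pos p ∣? e
      ... | yes d = subst (λ t → (pos p * t - 1ℤ) * (pos p * t - 1ℤ) ≤ (pos p * pos p - pos p) * t + 1ℤ)
        (sym (𝟙-yes d)) (ℤ.0≤i-j⇒j≤i (subst (0ℤ ≤_) (at-one (pos p)) 0≤pos))
      ... | no ¬d = subst (λ t → (pos p * t - 1ℤ) * (pos p * t - 1ℤ) ≤ (pos p * pos p - pos p) * t + 1ℤ)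
        (sym (𝟙-no ¬d)) (ℤ.≤-reflexive (at-zero (pos p)))
    norm²-discrepancy {suc s} (a ∷ as) with p ℕ.∣? ∣ a ∣
    ... | yes p∣a = begin
      norm² (spread a (discrepancy as))
        ≡⟨ norm²-spread-∣ (discrepancy-periodic as) (discrepancy-mean as) a (∣ᵤ⇒∣ p∣a) ⟩
      pos (p ℕ.* p) * norm² (discrepancy as)
        ≤⟨ *-monoˡ (pos (p ℕ.* p)) 0≤pos (norm²-discrepancy as) ⟩
      pos (p ℕ.* p) * pos (amplification ℕ.^ s ℕ.* p ℕ.^ ν ℕ.* (p ℕ.* p))
        ≡⟨ sym (ℤ.pos-* (p ℕ.* p) _) ⟩
      pos (p ℕ.* p ℕ.* (amplification ℕ.^ s ℕ.* p ℕ.^ ν ℕ.* (p ℕ.* p)))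
        ≤⟨ +≤+ (ℕ.*-monoˡ-≤ (amplification ℕ.^ s ℕ.* p ℕ.^ ν ℕ.* (p ℕ.* p)) (ℕ.*-monoˡ-≤ p (ℕ.m≤n*m p (2 ℕ.* (k ℕ.* k))))) ⟩
      pos (amplification ℕ.* p ℕ.* (amplification ℕ.^ s ℕ.* p ℕ.^ ν ℕ.* (p ℕ.* p)))
        ≡⟨ cong pos (lemma amplification p (amplification ℕ.^ s) (p ℕ.^ ν)) ⟩
      pos (amplification ℕ.^ suc s ℕ.* p ℕ.^ suc ν ℕ.* (p ℕ.* p)) ∎
      where
      open ℤ.≤-Reasoning
      ν : ℕ
      ν = divisibleEntries p as
      lemma : ∀ A p X Y → A ℕ.* p ℕ.* (X ℕ.* Y ℕ.* (p ℕ.* p)) ≡ A ℕ.* X ℕ.* (p ℕ.* Y) ℕ.* (p ℕ.* p)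
      lemma = ℕ.solve-∀
    ... | no p∤a = begin
      norm² (spread a (discrepancy as))
        ≤⟨ norm²-spread (discrepancy-periodic as) (discrepancy-mean as) a (λ d → p∤a (∣⇒∣ᵤ d)) ⟩
      pos amplification * norm² (discrepancy as)
        ≤⟨ *-monoˡ (pos amplification) 0≤pos (norm²-discrepancy as) ⟩
      pos amplification * pos (amplification ℕ.^ s ℕ.* p ℕ.^ ν ℕ.* (p ℕ.* p))
        ≡⟨ sym (ℤ.pos-* amplification _) ⟩
      pos (amplification ℕ.* (amplification ℕ.^ s ℕ.* p ℕ.^ ν ℕ.* (p ℕ.* p)))
        ≡⟨ cong pos (lemma amplification p (amplification ℕ.^ s) (p ℕ.^ ν)) ⟩
      pos (amplification ℕ.^ suc s ℕ.* p ℕ.^ ν ℕ.* (p ℕ.* p)) ∎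
      where
      open ℤ.≤-Reasoning
      ν : ℕ
      ν = divisibleEntries p as
      lemma : ∀ A p X Y → A ℕ.* (X ℕ.* Y ℕ.* (p ℕ.* p)) ≡ A ℕ.* X ℕ.* Y ℕ.* (p ℕ.* p)
      lemma = ℕ.solve-∀

    -- A single value of a function is at most its L² norm; all offsets other than 0 are discarded
    -- here.
    congruenceCount-deviation : ∀ {s} (a : Vec ℤ s) →
      let d = pos p * congruenceCount k p p a 0ℤ - pos (p ℕ.^ s)
      in d * d ≤ pos (amplification ℕ.^ s ℕ.* p ℕ.^ divisibleEntries p a ℕ.* (p ℕ.* p))
    congruenceCount-deviation a = ℤ.≤-trans
      (subst (λ d → d * d ≤ norm² (discrepancy a)) (discrepancy≡ a 0ℤ)
        (≤∑ᵣ {F = λ e → discrepancy a e * discrepancy a e}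
          (λ x y d → cong (λ z → z * z) (discrepancy-periodic a x y d)) (λ e → 0≤² (discrepancy a e)) 0ℤ))
      (norm²-discrepancy a)

-- Hensel lifting and the number of lifts of a zero

module HenselLifting where

  open FiniteSums
  open Residues
  open PowerConvolution using (∣-^; difference-*)
  open CongruenceCounts
  open import Defs using (diagonalForm; box)
  open import Data.Integer using (ℤ; 0ℤ; 1ℤ; _+_; _*_; _-_; -_; _≤_; +≤+; ∣_∣; _^_) renaming (+_ to pos)
  open import Data.Integer.Divisibility.Signed
  open import Data.Integer.Tactic.RingSolver using (solve-∀)

  binomial-mod-square : ∀ y d n → ∃ λ e →
    (y + d) ^ suc n ≡ y ^ suc n + pos (suc n) * y ^ n * d + d * d * e
  binomial-mod-square y d zero = 0ℤ , lemma y d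
    where
    lemma : ∀ y d → (y + d) * 1ℤ ≡ y * 1ℤ + 1ℤ * 1ℤ * d + d * d * 0ℤ
    lemma = solve-∀
  binomial-mod-square y d (suc n) with binomial-mod-square y d n
  ... | e , eq = pos (suc n) * y ^ n + y * e + d * e ,
    trans (cong ((y + d) *_) eq) (lemma y d (y ^ n) (pos (suc n)) e)
    where
    lemma : ∀ y d Y m e → (y + d) * (y * Y + m * Y * d + d * d * e) ≡
      y * (y * Y) + (1ℤ + m) * (y * Y) * d + d * d * (m * Y + y * e + d * e)
    lemma = solve-∀

  module Hensel {p : ℕ} (p-prime : Prime p) (k′ w : ℕ) where

    private
      k : ℕ
      k = suc k′
      P W : ℤ
      P = pos p
      W = P ^ w

    -- Newton iteration where the derivative at `x` has exact exponent `w`. The root is known modulo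
    -- `p^(2w+1+t)` and is corrected by a multiple of `p^(w+1+t)`. The linear term is then divisible
    -- by `p^(2w+1+t)` and can be adjusted at the next digit because `u` is a unit, while the
    -- quadratic term is divisible by `p^(2w+2+t)`. As `y` stays congruent to `x` modulo `p^(w+1)`,
    -- the derivative keeps its leading digit.
    hensel : ∀ {a x u c} → pos k * a * x ^ k′ ≡ W * u → ¬ P ∣ u → W * W * P * 1ℤ ∣ c + a * x ^ k →
      ∀ t → ∃ λ y → (P * W ∣ y - x) × (W * W * P * P ^ t ∣ c + a * y ^ k)
    hensel {x = x} derivative p∤u root zero = x , divides 0ℤ (ℤ.+-inverseʳ x) , root
    hensel {a} {x} {u} {c} derivative p∤u root (suc t)
      with hensel {a} {x} {u} {c} derivative p∤u root t | inverse p-prime u p∤u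
    ... | y , near@(divides g₀ near≡) , divides q root≡ | e′ , divides m inverse≡
      with ∣-^ y x k′ near | binomial-mod-square y (P * W * P ^ t * - (q * e′)) k′
    ... | divides g slope≡ | e , expansion =
      y + d ,
      divides (g₀ + P ^ t * z) (trans (close y d x) (trans (cong (_+ d) near≡) (close′ g₀ P W (P ^ t) z))) ,
      divides (- (q * m) + a * pos k * g * z + a * P ^ t * (z * z) * e) (begin
        c + a * (y + d) ^ k
          ≡⟨ cong (λ s → c + a * s) expansion ⟩
        c + a * (y ^ k + pos k * y ^ k′ * d + d * d * e)
          ≡⟨ step₁ a c (y ^ k) (pos k) (y ^ k′) (x ^ k′) d e ⟩
        (c + a * y ^ k) + (pos k * a * x ^ k′ + pos k * a * (y ^ k′ - x ^ k′)) * d + a * (d * d * e)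
          ≡⟨ cong₂ (λ r s → r + s * d + a * (d * d * e)) root≡
               (cong₂ (λ r s → r + pos k * a * s) derivative slope≡) ⟩
        q * (W * W * P * P ^ t) + (W * u + pos k * a * (g * (P * W))) * d + a * (d * d * e)
          ≡⟨ step₂ q W P (P ^ t) u e′ (pos k) a g e ⟩
        W * W * P * P ^ t * (- q * (u * e′ - 1ℤ) + (pos k * a * (g * P)) * z + a * (P * P ^ t * (z * z) * e))
          ≡⟨ cong (λ r → W * W * P * P ^ t * (- q * r + (pos k * a * (g * P)) * z + a * (P * P ^ t * (z * z) * e))) inverse≡ ⟩
        W * W * P * P ^ t * (- q * (m * P) + (pos k * a * (g * P)) * z + a * (P * P ^ t * (z * z) * e))
          ≡⟨ step₃ q m W P (P ^ t) (pos k) a g z e ⟩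
        (- (q * m) + a * pos k * g * z + a * P ^ t * (z * z) * e) * (W * W * P * (P * P ^ t)) ∎)
      where
      open ≡-Reasoning
      z d : ℤ
      -- `e′` inverts `u` modulo `p`, so `u z ≡ - q` cancels the next digit `q` of the value.
      z = - (q * e′)
      d = P * W * P ^ t * z
      close : ∀ y d x → y + d - x ≡ (y - x) + d
      close = solve-∀
      close′ : ∀ g P W T z → g * (P * W) + P * W * T * z ≡ (g + T * z) * (P * W)
      close′ = solve-∀
      step₁ : ∀ a c Y k V X d e → c + a * (Y + k * V * d + d * d * e) ≡
        (c + a * Y) + (k * a * X + k * a * (V - X)) * d + a * (d * d * e)
      step₁ = solve-∀
      step₂ : ∀ q W P T u e′ k a g e → let z = - (q * e′) ; d = P * W * T * z in
        q * (W * W * P * T) + (W * u + k * a * (g * (P * W))) * d + a * (d * d * e) ≡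
        W * W * P * T * (- q * (u * e′ - 1ℤ) + (k * a * (g * P)) * z + a * (P * T * (z * z) * e))
      step₂ = solve-∀
      step₃ : ∀ q m W P T k a g z e →
        W * W * P * T * (- q * (m * P) + (k * a * (g * P)) * z + a * (P * T * (z * z) * e)) ≡
        (- (q * m) + a * k * g * z + a * T * (z * z) * e) * (W * W * P * (P * T))
      step₃ = solve-∀

  𝟙-translate-periodic : ∀ m t → Periodic m (λ y → 𝟙 m (y - t))
  𝟙-translate-periodic m t y z d = 𝟙-periodic m (y - t) (z - t) (subst (pos m ∣_) (lemma y z t) d)
    where
    lemma : ∀ y z t → y - z ≡ (y - t) - (z - t)
    lemma = solve-∀

  -- Coordinatewise congruence modulo `m` as a product of indicators, so that sums over a box
  -- factor.
  near : ∀ {s} → ℕ → Vec ℕ s → Vec ℕ s → ℤ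
  near m []       []       = 1ℤ
  near m (y ∷ ys) (x ∷ xs) = 𝟙 m (pos y - pos x) * near m ys xs

  0≤near : ∀ {s} m (y x : Vec ℕ s) → 0ℤ ≤ near m y x
  0≤near m []       []       = +≤+ z≤n
  0≤near m (y ∷ ys) (x ∷ xs) = 0≤* (0≤𝟙 m (pos y - pos x)) (0≤near m ys xs)

  near≤1 : ∀ {s} m (y x : Vec ℕ s) → near m y x ≤ 1ℤ
  near≤1 m []       []       = +≤+ (s≤s z≤n)
  near≤1 m (y ∷ ys) (x ∷ xs) = ℤ.≤-trans
    (*-monoʳ (near m ys xs) (0≤near m ys xs) (𝟙≤1 m (pos y - pos x)))
    (subst (_≤ 1ℤ) (sym (ℤ.*-identityˡ (near m ys xs))) (near≤1 m ys xs))

  near-mono : ∀ {s m n} → n ℕ.∣ m → (y x : Vec ℕ s) → near m y x ≤ near n y x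
  near-mono             n∣m []       []       = ℤ.≤-refl
  near-mono {m = m} {n} n∣m (y ∷ ys) (x ∷ xs) = ℤ.≤-trans
    (*-monoʳ (near m ys xs) (0≤near m ys xs) (𝟙-mono {m} {n} (∣-trans (∣ᵤ⇒∣ n∣m))))
    (*-monoˡ (𝟙 n (pos y - pos x)) (0≤𝟙 n (pos y - pos x)) (near-mono n∣m ys xs))

  ∣-coefficient : ∀ {m} a x y k → m ∣ x - y → m ∣ a * x ^ k - a * y ^ k
  ∣-coefficient a x y k d = difference-* a (x ^ k) (y ^ k) (∣-^ x y k d)

  near-cases : ∀ {s} m (y x : Vec ℕ s) → (near m y x ≡ 0ℤ) ⊎
    ((near m y x ≡ 1ℤ) × (∀ k a → pos m ∣ diagonalForm k a y - diagonalForm k a x))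
  near-cases m []       []       = inj₂ (refl , λ { k [] → divides 0ℤ refl })
  near-cases m (y ∷ ys) (x ∷ xs) with pos m ∣? (pos y - pos x) | near-cases m ys xs
  ... | no ¬d | _ = inj₁ (cong (_* near m ys xs) (𝟙-no ¬d))
  ... | yes _ | inj₁ eq = inj₁ (trans (cong (𝟙 m (pos y - pos x) *_) eq) (ℤ.*-zeroʳ (𝟙 m (pos y - pos x))))
  ... | yes d | inj₂ (eq , ds) = inj₂ (cong₂ _*_ (𝟙-yes d) eq , λ { k (a ∷ as) →
      subst (pos m ∣_) (lemma (a * pos y ^ k) (a * pos x ^ k) (diagonalForm k as ys) (diagonalForm k as xs))
        (∣m∣n⇒∣m+n (∣-coefficient a (pos y) (pos x) k d) (ds k as)) })
    where
    lemma : ∀ a b c d → (a - b) + (c - d) ≡ (a + c) - (b + d)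
    lemma = solve-∀

  ∑-near : ∀ {s} r m .{{_ : NonZero m}} (x : Vec ℕ s) →
    ∑ (box s (r ℕ.* m)) (λ y → near m y x) ≡ pos (r ℕ.^ s)
  ∑-near         r m []       = refl
  ∑-near {suc s} r m (x ∷ xs) = begin
    ∑ (box (suc s) (r ℕ.* m)) (λ y → near m y (x ∷ xs))
      ≡⟨ ∑-product _∷_ (resid (r ℕ.* m)) (box s (r ℕ.* m)) _ ⟩
    ∑ᵣ (r ℕ.* m) (λ y → ∑ (box s (r ℕ.* m)) (λ ys → 𝟙 m (y - pos x) * near m ys xs))
      ≡⟨ sym (∑-*-∑ (resid (r ℕ.* m)) (box s (r ℕ.* m)) _ _) ⟩
    ∑ᵣ (r ℕ.* m) (λ y → 𝟙 m (y - pos x)) * ∑ (box s (r ℕ.* m)) (λ ys → near m ys xs)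
      ≡⟨ cong₂ _*_ (trans (∑ᵣ-multiple {m} (𝟙-translate-periodic m (pos x)) r)
           (trans (cong (pos r *_) (∑ᵣ-𝟙 m (pos x))) (ℤ.*-identityʳ (pos r)))) (∑-near r m xs) ⟩
    pos r * pos (r ℕ.^ s)
      ≡⟨ sym (ℤ.pos-* r (r ℕ.^ s)) ⟩
    pos (r ℕ.^ suc s) ∎
    where open ≡-Reasoning

  -- Some coordinate xⱼ has ∂f/∂xⱼ of p-adic valuation exactly w.
  data Pivot (p k′ w : ℕ) : ∀ {s} → Vec ℤ (suc s) → Vec ℕ (suc s) → Set where
    here  : ∀ {s a x u} {as : Vec ℤ s} {xs} → pos (suc k′) * a * pos x ^ k′ ≡ pos p ^ w * u → ¬ pos p ∣ u →
            Pivot p k′ w (a ∷ as) (x ∷ xs)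
    there : ∀ {s a x} {as : Vec ℤ (suc s)} {xs} → Pivot p k′ w as xs → Pivot p k′ w (a ∷ as) (x ∷ xs)

  -- Three moduli: lifts stay in the class of `x` modulo `m₁ = p^(w+1)`, the point `x` is a zero
  -- modulo `m₂ = p^(2w+1)`, and zeros are wanted modulo `q = p^(2w+1+t)`.
  module Lifting {p : ℕ} (p-prime : Prime p) (k′ w t : ℕ) where

    private
      k m₁ m₂ q : ℕ
      k = suc k′
      m₁ = p ℕ.* p ℕ.^ w
      m₂ = p ℕ.^ w ℕ.* p ℕ.^ w ℕ.* p
      q = p ℕ.^ t ℕ.* m₂

      instance
        p≢0 : NonZero p
        p≢0 = prime⇒nonZero p-prime
        p^w≢0 : NonZero (p ℕ.^ w)
        p^w≢0 = ℕ.m^n≢0 p w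
        p^t≢0 : NonZero (p ℕ.^ t)
        p^t≢0 = ℕ.m^n≢0 p t
        p^w²≢0 : NonZero (p ℕ.^ w ℕ.* p ℕ.^ w)
        p^w²≢0 = ℕ.m*n≢0 (p ℕ.^ w) (p ℕ.^ w)
        m₂≢0 : NonZero m₂
        m₂≢0 = ℕ.m*n≢0 (p ℕ.^ w ℕ.* p ℕ.^ w) p
        q≢0 : NonZero q
        q≢0 = ℕ.m*n≢0 (p ℕ.^ t) m₂

      m₁∣m₂ : m₁ ℕ.∣ m₂
      m₁∣m₂ = subst (m₁ ℕ.∣_) (trans (cong (p ℕ.^ w ℕ.*_) (ℕ.*-comm p (p ℕ.^ w))) (sym (ℕ.*-assoc (p ℕ.^ w) _ p)))
        (ℕ.n∣m*n (p ℕ.^ w))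

      m₁∣q : m₁ ℕ.∣ q
      m₁∣q = ℕ.∣n⇒∣m*n (p ℕ.^ t) m₁∣m₂

      pos-m₁ : pos m₁ ≡ pos p * pos p ^ w
      pos-m₁ = trans (ℤ.pos-* p (p ℕ.^ w)) (cong (pos p *_) (pos-^ p w))

      pos-m₂ : pos m₂ ≡ pos p ^ w * pos p ^ w * pos p
      pos-m₂ = trans (ℤ.pos-* (p ℕ.^ w ℕ.* p ℕ.^ w) p) (cong (_* pos p)
        (trans (ℤ.pos-* (p ℕ.^ w) (p ℕ.^ w)) (cong₂ _*_ (pos-^ p w) (pos-^ p w))))

      pos-q : pos q ≡ pos p ^ w * pos p ^ w * pos p * pos p ^ t
      pos-q = trans (ℤ.pos-* (p ℕ.^ t) m₂) (trans (ℤ.*-comm (pos (p ℕ.^ t)) (pos m₂)) (cong₂ _*_ pos-m₂ (pos-^ p t)))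

      transfer : ∀ {m} e a b → m ∣ e + b → m ∣ a - b → m ∣ e + a
      transfer {m} e a b d d′ = subst (m ∣_) (lemma e a b) (∣m∣n⇒∣m+n d d′)
        where
        lemma : ∀ e a b → e + b + (a - b) ≡ e + a
        lemma = solve-∀

    lifts : ∀ {s} → Vec ℤ s → ℤ → Vec ℕ s → ℤ
    lifts {s} a e x = ∑ (box s q) (λ y → near m₁ y x * 𝟙 q (e + diagonalForm k a y))

    private
      summand : ∀ {s} → ℤ → Vec ℤ s → ℤ → ℕ → Vec ℕ s → ℤ → Vec ℕ s → ℤ
      summand a as e x xs y ys = 𝟙 m₁ (y - pos x) * near m₁ ys xs * 𝟙 q (e + (a * y ^ k + diagonalForm k as ys))

      lifts-∷ : ∀ {s} a (as : Vec ℤ s) e x xs → lifts (a ∷ as) e (x ∷ xs) ≡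
        ∑ᵣ q (λ y → ∑ (box s q) (λ ys → summand a as e x xs y ys))
      lifts-∷ {s} a as e x xs = ∑-product _∷_ (resid q) (box s q) _

      -- Moving the other coordinates within their classes modulo `m₂` keeps `x` an approximate root
      -- in the pivot coordinate, and `hensel` supplies a value of that coordinate which is a root
      -- modulo `q`.
      lifts-here : ∀ {s a x u} {as : Vec ℤ s} {xs} → pos k * a * pos x ^ k′ ≡ pos p ^ w * u → ¬ pos p ∣ u →
        ∀ e → pos m₂ ∣ e + (a * pos x ^ k + diagonalForm k as xs) →
        ∀ ys → near m₂ ys xs ≤
          ∑ᵣ q (λ y → summand a as e x xs y ys)
      lifts-here {s} {a} {x} {u} {as} {xs} derivative p∤u e root ys with near-cases m₂ ys xs
      ... | inj₁ eq = subst (_≤ ∑ᵣ q (λ y → summand a as e x xs y ys)) (sym eq) (∑-nonneg (resid q) λ y →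
        0≤* (0≤* (0≤𝟙 m₁ (pos y - pos x)) (0≤near m₁ ys xs)) (0≤𝟙 q _))
      ... | inj₂ (eq , ds) with Hensel.hensel p-prime k′ w {a} {pos x} {u} {e + diagonalForm k as ys} derivative p∤u root′ t
        where
        arrange : ∀ e a d → e + (a + d) ≡ e + d + a
        arrange = solve-∀
        arrange′ : ∀ e a d d′ → d - d′ ≡ (a + d) - (a + d′)
        arrange′ = solve-∀
        root′ : pos p ^ w * pos p ^ w * pos p * 1ℤ ∣ e + diagonalForm k as ys + a * pos x ^ k
        root′ = subst₂ _∣_ (trans pos-m₂ (sym (ℤ.*-identityʳ _))) (arrange e (a * pos x ^ k) (diagonalForm k as ys))
          (transfer e (a * pos x ^ k + diagonalForm k as ys) (a * pos x ^ k + diagonalForm k as xs) root (subst (pos m₂ ∣_) (arrange′ e (a * pos x ^ k) (diagonalForm k as ys) (diagonalForm k as xs)) (ds k as)))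
      ...   | y , close , root′ = subst (_≤ ∑ᵣ q G) (trans value (sym eq)) (≤∑ᵣ {F = G} periodic nonneg y)
        where
        G : ℤ → ℤ
        G y = summand a as e x xs y ys
        arrange : ∀ e a d → e + d + a ≡ e + (a + d)
        arrange = solve-∀
        value : G y ≡ 1ℤ
        value = cong₂ _*_
          (cong₂ _*_ (𝟙-yes (subst (_∣ y - pos x) (sym pos-m₁) close))
            (ℤ.≤-antisym (near≤1 m₁ ys xs) (subst (_≤ near m₁ ys xs) eq (near-mono m₁∣m₂ ys xs))))
          (𝟙-yes (subst₂ _∣_ (sym pos-q) (arrange e (a * y ^ k) (diagonalForm k as ys)) root′))
        nonneg : ∀ y → 0ℤ ≤ G y
        nonneg y = 0≤* (0≤* (0≤𝟙 m₁ (y - pos x)) (0≤near m₁ ys xs)) (0≤𝟙 q _)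
        difference′ : ∀ e a b d → a - b ≡ (e + (a + d)) - (e + (b + d))
        difference′ = solve-∀
        periodic : Periodic q G
        periodic y z d = cong₂ _*_
          (cong (_* near m₁ ys xs) (𝟙-translate-periodic m₁ (pos x) y z (∣-trans (∣ᵤ⇒∣ m₁∣q) d)))
          (𝟙-periodic q _ _ (subst (pos q ∣_) (difference′ e (a * y ^ k) (a * z ^ k) (diagonalForm k as ys)) (∣-coefficient a y z k d)))

    -- The `s` coordinates other than the pivot move freely in their classes modulo `m₂`, with `p^t`
    -- choices each modulo `q`. A coordinate before the pivot is absorbed into the offset `e`.
    lifts≥ : ∀ {s} {a : Vec ℤ (suc s)} {x} → Pivot p k′ w a x → ∀ e → pos m₂ ∣ e + diagonalForm k a x →
      pos ((p ℕ.^ t) ℕ.^ s) ≤ lifts a e x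
    lifts≥ {s} {a ∷ as} {x ∷ xs} (here derivative p∤u) e root = begin
      pos ((p ℕ.^ t) ℕ.^ s)
        ≡⟨ sym (∑-near (p ℕ.^ t) m₂ xs) ⟩
      ∑ (box s q) (λ ys → near m₂ ys xs)
        ≤⟨ ∑-mono (box s q) (lifts-here {a = a} {x} {as = as} derivative p∤u e root) ⟩
      ∑ (box s q) (λ ys → ∑ᵣ q (λ y → summand a as e x xs y ys))
        ≡⟨ sym (trans (lifts-∷ a as e x xs) (∑-swap (resid q) (box s q) _)) ⟩
      lifts (a ∷ as) e (x ∷ xs) ∎
      where open ℤ.≤-Reasoning
    lifts≥ {suc s} {a ∷ as} {x ∷ xs} (there pivot) e root = begin
      pos (p ℕ.^ t ℕ.* (p ℕ.^ t) ℕ.^ s)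
        ≡⟨ ℤ.pos-* (p ℕ.^ t) ((p ℕ.^ t) ℕ.^ s) ⟩
      pos (p ℕ.^ t) * pos ((p ℕ.^ t) ℕ.^ s)
        ≡⟨ cong (_* pos ((p ℕ.^ t) ℕ.^ s)) (sym (trans
             (∑ᵣ-multiple {m₂} (𝟙-translate-periodic m₂ (pos x)) (p ℕ.^ t))
             (trans (cong (pos (p ℕ.^ t) *_) (∑ᵣ-𝟙 m₂ (pos x))) (ℤ.*-identityʳ (pos (p ℕ.^ t)))))) ⟩
      ∑ᵣ q (λ y → 𝟙 m₂ (y - pos x)) * pos ((p ℕ.^ t) ℕ.^ s)
        ≡⟨ sym (∑-*ʳ (resid q) (pos ((p ℕ.^ t) ℕ.^ s)) (λ y → 𝟙 m₂ (pos y - pos x))) ⟩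
      ∑ᵣ q (λ y → 𝟙 m₂ (y - pos x) * pos ((p ℕ.^ t) ℕ.^ s))
        ≤⟨ ∑-mono (resid q) (λ y → pointwise (pos y)) ⟩
      ∑ᵣ q (λ y → ∑ (box (suc s) q) (λ ys → summand a as e x xs y ys))
        ≡⟨ sym (lifts-∷ a as e x xs) ⟩
      lifts (a ∷ as) e (x ∷ xs) ∎
      where
      open ℤ.≤-Reasoning
      difference′ : ∀ a b d → a - b ≡ (a + d) - (b + d)
      difference′ = solve-∀
      pointwise : ∀ y → 𝟙 m₂ (y - pos x) * pos ((p ℕ.^ t) ℕ.^ s) ≤
        ∑ (box (suc s) q) (λ ys → summand a as e x xs y ys)
      pointwise y with pos m₂ ∣? (y - pos x)
      ... | no ¬d = subst (_≤ ∑ (box (suc s) q) (λ ys → summand a as e x xs y ys))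
        (cong (_* pos ((p ℕ.^ t) ℕ.^ s)) (sym (𝟙-no ¬d)))
        (∑-nonneg (box (suc s) q) λ ys → 0≤* (0≤* (0≤𝟙 m₁ (y - pos x)) (0≤near m₁ ys xs)) (0≤𝟙 q _))
      ... | yes d = begin
        𝟙 m₂ (y - pos x) * pos ((p ℕ.^ t) ℕ.^ s)
          ≡⟨ trans (cong (_* pos ((p ℕ.^ t) ℕ.^ s)) (𝟙-yes d)) (ℤ.*-identityˡ _) ⟩
        pos ((p ℕ.^ t) ℕ.^ s)
          ≤⟨ lifts≥ pivot (e + a * y ^ k) (subst (pos m₂ ∣_) (sym (ℤ.+-assoc e (a * y ^ k) (diagonalForm k as xs))) (transfer e (a * y ^ k + diagonalForm k as xs) (a * pos x ^ k + diagonalForm k as xs) root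
               (subst (pos m₂ ∣_) (difference′ (a * y ^ k) (a * pos x ^ k) (diagonalForm k as xs)) (∣-coefficient a y (pos x) k d)))) ⟩
        lifts as (e + a * y ^ k) xs
          ≡⟨ ∑-cong (box (suc s) q) (λ ys → cong₂ _*_
               (sym (trans (cong (_* near m₁ ys xs) (𝟙-yes (∣-trans (∣ᵤ⇒∣ m₁∣m₂) d))) (ℤ.*-identityˡ _)))
               (cong (𝟙 q) (ℤ.+-assoc e (a * y ^ k) (diagonalForm k as ys)))) ⟩
        ∑ (box (suc s) q) (λ ys → summand a as e x xs y ys) ∎

-- Zeros modulo prime powers: the soluble, insoluble and nonsingular cases

module LocalSolutions where

  open FiniteSums
  open Residues
  open CongruenceCounts
  open HenselLifting
  open import Defs using (diagonalForm; box; solutionCount)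
  open import Data.Integer using (ℤ; 0ℤ; 1ℤ; _+_; _*_; _-_; -_; _≤_; ∣_∣; _^_) renaming (+_ to pos)
  open import Data.Integer.Divisibility.Signed
  open import Data.Integer.Tactic.RingSolver using (solve-∀)
  open import Data.Vec as Vec using (Vec; []; _∷_; replicate)

  private
    largestExponent : ℕ → ℕ → ℕ → ℕ
    largestExponent p n zero    = 0
    largestExponent p n (suc j) = if does (p ℕ.^ suc j ℕ.∣? n) then suc j else largestExponent p n j

    largestExponent-∣ : ∀ p n j → p ℕ.^ largestExponent p n j ℕ.∣ n
    largestExponent-∣ p n zero    = ℕ.1∣ n
    largestExponent-∣ p n (suc j) with p ℕ.^ suc j ℕ.∣? n
    ... | yes d = d
    ... | no _  = largestExponent-∣ p n j

    largestExponent-∤ : ∀ p n j i → largestExponent p n j ℕ.< i → i ℕ.≤ j → ¬ p ℕ.^ i ℕ.∣ n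
    largestExponent-∤ p n zero    i 0<i i≤0 = contradiction (ℕ.<-≤-trans 0<i i≤0) (ℕ.<-irrefl refl)
    largestExponent-∤ p n (suc j) i l<i i≤1+j with p ℕ.^ suc j ℕ.∣? n
    ... | yes _ = contradiction (ℕ.<-≤-trans l<i i≤1+j) (ℕ.<-irrefl refl)
    ... | no ¬d with ℕ.m≤n⇒m<n∨m≡n i≤1+j
    ...   | inj₁ i<1+j = largestExponent-∤ p n j i l<i (ℕ.≤-pred i<1+j)
    ...   | inj₂ refl  = ¬d

  opaque

    -- The exponent of p in n, for p > 1 and n > 0.
    valuation : ℕ → ℕ → ℕ
    valuation p n = largestExponent p n n

  -- Ensures that the downward search for the exponent of `p` in `n` may start at `n`; it also
  -- provides a rate at which `p^(-t)` tends to 0.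
  n<p^n : ∀ {p} → 1 ℕ.< p → ∀ n → n ℕ.< p ℕ.^ n
  n<p^n {p} 1<p zero    = s≤s z≤n
  n<p^n {p} 1<p (suc n) = begin-strict
    suc n              ≤⟨ n<p^n 1<p n ⟩
    p ℕ.^ n            <⟨ ℕ.m<m*n (p ℕ.^ n) p {{ℕ.m^n≢0 p n {{ℕ.>-nonZero (ℕ.<-trans (s≤s z≤n) 1<p)}}}} 1<p ⟩
    p ℕ.^ n ℕ.* p      ≡⟨ ℕ.*-comm (p ℕ.^ n) p ⟩
    p ℕ.^ suc n ∎
    where open ℕ.≤-Reasoning

  opaque
    unfolding valuation

    valuation-spec : ∀ {p} n → 1 ℕ.< p → n ≢ 0 → ∃ λ u → (n ≡ p ℕ.^ valuation p n ℕ.* u) × ¬ p ℕ.∣ u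
    valuation-spec {p} n 1<p n≢0 with largestExponent-∣ p n n
    ... | ℕ.divides u n≡ = u , trans n≡ (ℕ.*-comm u _) , λ p∣u →
      let p^∣n = subst (p ℕ.^ suc v ℕ.∣_) (sym n≡) (ℕ.*-monoˡ-∣ (p ℕ.^ v) p∣u)
      in largestExponent-∤ p n n (suc v) ℕ.≤-refl
        (ℕ.<⇒≤ (ℕ.<-≤-trans (n<p^n 1<p (suc v)) (ℕ.∣⇒≤ {{ℕ.≢-nonZero n≢0}} p^∣n))) p^∣n
      where
      v : ℕ
      v = valuation p n

  -- The exponents of `p` in `k` and in all coefficients are added up. The sum bounds the exponent
  -- of the partial derivative at any unit coordinate, whichever it is, and its contributions
  -- multiply well over the primes.
  weight : ∀ {s} → ℕ → ℕ → Vec ℤ s → ℕ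
  weight p k []       = valuation p k
  weight p k (a ∷ as) = valuation p ∣ a ∣ ℕ.+ weight p k as

  valuation≤weight : ∀ {s} p k (a : Vec ℤ s) → valuation p k ℕ.≤ weight p k a
  valuation≤weight p k []       = ℕ.≤-refl
  valuation≤weight p k (a ∷ as) = ℕ.≤-trans (valuation≤weight p k as) (ℕ.m≤n+m _ (valuation p ∣ a ∣))

  module _ {p : ℕ} (p-prime : Prime p) (k′ : ℕ) where

    private
      k : ℕ
      k = suc k′
      instance
        p≢0 : NonZero p
        p≢0 = prime⇒nonZero p-prime
      1<p : 1 ℕ.< p
      1<p = ℕ.nonTrivial⇒n>1 p {{prime⇒nonTrivial p-prime}}

    Primitive : ∀ {s} → Vec ℕ s → Set
    Primitive x = ¬ All (p ℕ.∣_) x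

    Soluble : ∀ {s} → ℕ → Vec ℤ s → Set
    Soluble m a = ∃ λ x → Primitive x × pos m ∣ diagonalForm k a x

    valuation-ℤ : ∀ a → a ≢ 0ℤ → ∃ λ u → (a ≡ pos p ^ valuation p ∣ a ∣ * u) × ¬ pos p ∣ u
    valuation-ℤ a a≢0 with valuation-spec ∣ a ∣ 1<p (λ eq → a≢0 (ℤ.∣i∣≡0⇒i≡0 eq)) | ℤ.+∣i∣≡i⊎+∣i∣≡-i a
    ... | u , eq , p∤u | inj₁ ∣a∣≡a = pos u ,
      trans (sym ∣a∣≡a) (trans (cong pos eq) (trans (ℤ.pos-* (p ℕ.^ valuation p ∣ a ∣) u) (cong (_* pos u) (pos-^ p (valuation p ∣ a ∣))))) ,
      λ d → p∤u (∣⇒∣ᵤ d)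
    ... | u , eq , p∤u | inj₂ ∣a∣≡-a = - pos u ,
      trans (sym (ℤ.neg-involutive a)) (trans (cong -_ (trans (sym ∣a∣≡-a)
        (trans (cong pos eq) (trans (ℤ.pos-* (p ℕ.^ valuation p ∣ a ∣) u) (cong (_* pos u) (pos-^ p (valuation p ∣ a ∣)))))))
        (ℤ.neg-distribʳ-* (pos p ^ valuation p ∣ a ∣) (pos u))) ,
      λ d → p∤u (subst (p ℕ.∣_) (ℤ.∣-i∣≡∣i∣ (pos u)) (∣⇒∣ᵤ d))

    pivot-at-unit : ∀ a x → a ≢ 0ℤ → ¬ p ℕ.∣ x → ∃ λ u →
      (pos k * a * pos x ^ k′ ≡ pos p ^ (valuation p ∣ a ∣ ℕ.+ valuation p k) * u) × ¬ pos p ∣ u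
    pivot-at-unit a x a≢0 p∤x with valuation-ℤ a a≢0 | valuation-ℤ (pos k) (λ ())
    ... | u , a≡ , p∤u | v , k≡ , p∤v = v * u * pos x ^ k′ ,
      trans (cong₂ (λ r s → r * s * pos x ^ k′) k≡ a≡) (trans (lemma (pos p ^ valuation p k) v (pos p ^ valuation p ∣ a ∣) u (pos x ^ k′))
        (cong (_* (v * u * pos x ^ k′)) (sym (ℤ.^-distribˡ-+-* (pos p) (valuation p ∣ a ∣) (valuation p k))))) ,
      λ d → [ (λ d′ → [ p∤v , p∤u ]′ (prime-∣-* p-prime v u d′))
            , prime-∤-^ p-prime (pos x) k′ (λ d′ → p∤x (∣⇒∣ᵤ d′)) ]′ (prime-∣-* p-prime (v * u) (pos x ^ k′) d)
      where
      lemma : ∀ K v A u X → K * v * (A * u) * X ≡ A * K * (v * u * X)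
      lemma = solve-∀

    -- At a coordinate prime to `p` the derivative `k a x^(k-1)` has the same exponent of `p` as
    -- `k a`.
    pivot : ∀ {s} (a : Vec ℤ (suc s)) x → All (_≢ 0ℤ) a → Primitive x →
      ∃ λ w → (w ℕ.≤ weight p k a) × Pivot p k′ w a x
    pivot (a ∷ as) (x ∷ xs) (a≢0 ∷ as≢0) x-prim with p ℕ.∣? x
    pivot (a ∷ as) (x ∷ xs) (a≢0 ∷ as≢0) x-prim | no p∤x with pivot-at-unit a x a≢0 p∤x
    ... | u , eq , p∤u = _ , ℕ.+-monoʳ-≤ (valuation p ∣ a ∣) (valuation≤weight p k as) , here eq p∤u
    pivot (a ∷ [])         (x ∷ [])  (a≢0 ∷ as≢0) x-prim | yes p∣x = contradiction (p∣x ∷ []) x-prim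
    pivot (a ∷ as@(_ ∷ _)) (x ∷ xs) (a≢0 ∷ as≢0) x-prim | yes p∣x
      with pivot as xs as≢0 (λ all → x-prim (p∣x ∷ all))
    ... | w , w≤ , piv = w , ℕ.≤-trans w≤ (ℕ.m≤n+m _ (valuation p ∣ a ∣)) , there piv

    lifts≤solutionCount : ∀ {s} (a : Vec ℤ s) x w t →
      Lifting.lifts p-prime k′ w t a 0ℤ x ≤ pos (solutionCount k a (p ℕ.^ t ℕ.* (p ℕ.^ w ℕ.* p ℕ.^ w ℕ.* p)))
    lifts≤solutionCount {s} a x w t = ℤ.≤-trans
      (∑-mono (box s q) λ y → ℤ.≤-trans
        (*-monoʳ (𝟙 q (0ℤ + diagonalForm k a y)) (0≤𝟙 q _) (near≤1 _ y x)) (ℤ.≤-reflexive (ℤ.*-identityˡ _)))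
      (ℤ.≤-reflexive (sym (solutionCount≡ k a q)))
      where
      q : ℕ
      q = p ℕ.^ t ℕ.* (p ℕ.^ w ℕ.* p ℕ.^ w ℕ.* p)

    -- The exponent `m` exceeds `2w + 1` for every possible pivot exponent `w`, so one modulus `p^m`
    -- serves whichever coordinate turns out to be the pivot.
    solutionCount-soluble : ∀ {s} (a : Vec ℤ (suc s)) → All (_≢ 0ℤ) a →
      let m = 2 ℕ.* suc (weight p k a)
      in Soluble (p ℕ.^ m) a → ∀ t → (p ℕ.^ t) ℕ.^ s ℕ.≤ solutionCount k a (p ℕ.^ (t ℕ.+ m))
    solutionCount-soluble {s} a a≢0 (x , x-prim , root) t with pivot a x a≢0 x-prim
    ... | w , w≤ , piv = begin
        (p ℕ.^ t) ℕ.^ s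
          ≤⟨ ℕ.^-monoˡ-≤ s (ℕ.^-monoʳ-≤ p (ℕ.m≤m+n t r)) ⟩
        (p ℕ.^ (t ℕ.+ r)) ℕ.^ s
          ≤⟨ ℤ.drop‿+≤+ (ℤ.≤-trans
               (Lifting.lifts≥ p-prime k′ w (t ℕ.+ r) piv 0ℤ (subst (pos m₂ ∣_) (sym (ℤ.+-identityˡ _))
                 (∣-trans (∣ᵤ⇒∣ m₂∣) root)))
               (lifts≤solutionCount a x w (t ℕ.+ r))) ⟩
        solutionCount k a (p ℕ.^ (t ℕ.+ r) ℕ.* m₂)
          ≡⟨ cong (solutionCount k a) modulus ⟩
        solutionCount k a (p ℕ.^ (t ℕ.+ m)) ∎
      where
      open ℕ.≤-Reasoning
      m m₂ r : ℕ
      m = 2 ℕ.* suc (weight p k a)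
      m₂ = p ℕ.^ w ℕ.* p ℕ.^ w ℕ.* p
      -- The surplus of `m` over `2w + 1`; lifting by `t + r` steps makes the final modulus
      -- `p^(t+m)`.
      r = m ℕ.∸ suc (w ℕ.+ w)
      m₂≡ : m₂ ≡ p ℕ.^ suc (w ℕ.+ w)
      m₂≡ = trans (ℕ.*-comm _ p) (cong (p ℕ.*_) (sym (ℕ.^-distribˡ-+-* p w w)))
      1+2w≤m : suc (w ℕ.+ w) ℕ.≤ m
      1+2w≤m = s≤s (ℕ.+-mono-≤ w≤ (subst (w ℕ.≤_) (sym (ℕ.+-identityʳ _)) (ℕ.m≤n⇒m≤1+n w≤)))
      m₂∣ : m₂ ℕ.∣ p ℕ.^ m
      m₂∣ = subst₂ ℕ._∣_ (sym m₂≡) (trans (sym (ℕ.^-distribˡ-+-* p (suc (w ℕ.+ w)) r)) (cong (p ℕ.^_) (ℕ.m+[n∸m]≡n 1+2w≤m)))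
        (ℕ.m∣m*n (p ℕ.^ r))
      modulus : p ℕ.^ (t ℕ.+ r) ℕ.* m₂ ≡ p ℕ.^ (t ℕ.+ m)
      modulus = trans (cong (p ℕ.^ (t ℕ.+ r) ℕ.*_) m₂≡) (trans (sym (ℕ.^-distribˡ-+-* p (t ℕ.+ r) _))
        (cong (p ℕ.^_) (trans (ℕ.+-assoc t r _) (cong (t ℕ.+_) (ℕ.m∸n+n≡m 1+2w≤m)))))

    private
      divide-out : ∀ {s} (x : Vec ℕ s) → All (p ℕ.∣_) x → ∃ λ y → x ≡ Vec.map (p ℕ.*_) y
      divide-out []       []                         = [] , refl
      divide-out (x ∷ xs) (ℕ.divides y x≡yp ∷ p∣xs) with divide-out xs p∣xs
      ... | ys , xs≡ = y ∷ ys , cong₂ _∷_ (trans x≡yp (ℕ.*-comm y p)) xs≡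

      diagonalForm-scale : ∀ {s} (a : Vec ℤ s) y →
        diagonalForm k a (Vec.map (p ℕ.*_) y) ≡ pos (p ℕ.^ k) * diagonalForm k a y
      diagonalForm-scale []       []       = sym (ℤ.*-zeroʳ (pos (p ℕ.^ k)))
      diagonalForm-scale (a ∷ as) (y ∷ ys) = trans
        (cong₂ _+_ (trans (cong (a *_) (trans (cong (_^ k) (ℤ.pos-* p y)) (trans (^-distrib-* (pos p) (pos y) k)
          (cong (_* pos y ^ k) (sym (pos-^ p k)))))) (lemma a (pos (p ℕ.^ k)) (pos y ^ k))) (diagonalForm-scale as ys))
        (sym (ℤ.*-distribˡ-+ (pos (p ℕ.^ k)) (a * pos y ^ k) _))
        where
        lemma : ∀ a P y → a * (P * y) ≡ P * (a * y)
        lemma = solve-∀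

      scale-All : ∀ {s} m (y : Vec ℕ s) → All (m ℕ.∣_) y → All (p ℕ.* m ℕ.∣_) (Vec.map (p ℕ.*_) y)
      scale-All m []       []       = []
      scale-All m (y ∷ ys) (d ∷ ds) = ℕ.*-monoʳ-∣ p d ∷ scale-All m ys ds

    -- Descent: for positive `t` such a zero is not primitive, and dividing it by `p` lowers the
    -- exponent of the modulus by `k`.
    insoluble⇒divisible : ∀ {s} m (a : Vec ℤ s) → ¬ Soluble (p ℕ.^ m) a →
      ∀ t x → pos (p ℕ.^ (t ℕ.* k ℕ.+ m)) ∣ diagonalForm k a x → All (p ℕ.^ t ℕ.∣_) x
    insoluble⇒divisible m a insoluble zero    x d = All.universal (λ y → ℕ.1∣ y) x
    insoluble⇒divisible m a insoluble (suc t) x d with All.all? (p ℕ.∣?_) x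
    ... | no x-prim = contradiction (x , x-prim , ∣-trans (∣ᵤ⇒∣ p^m∣) d) insoluble
      where
      p^m∣ : p ℕ.^ m ℕ.∣ p ℕ.^ (suc t ℕ.* k ℕ.+ m)
      p^m∣ = subst (p ℕ.^ m ℕ.∣_) (sym (ℕ.^-distribˡ-+-* p (suc t ℕ.* k) m)) (ℕ.n∣m*n (p ℕ.^ (suc t ℕ.* k)))
    ... | yes p∣x with divide-out x p∣x
    ...   | y , refl = scale-All (p ℕ.^ t) y (insoluble⇒divisible m a insoluble t y
      (*-cancelˡ-∣ (pos (p ℕ.^ k)) {{ℕ.m^n≢0 p k}} (subst₂ _∣_ modulus (diagonalForm-scale a y) d)))
      where
      modulus : pos (p ℕ.^ (suc t ℕ.* k ℕ.+ m)) ≡ pos (p ℕ.^ k) * pos (p ℕ.^ (t ℕ.* k ℕ.+ m))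
      modulus = trans (cong (λ e → pos (p ℕ.^ e)) (ℕ.+-assoc k (t ℕ.* k) m))
        (trans (cong pos (ℕ.^-distribˡ-+-* p k (t ℕ.* k ℕ.+ m))) (ℤ.pos-* (p ℕ.^ k) _))

    near-zero : ∀ {s} m (y : Vec ℕ s) → All (m ℕ.∣_) y → near m y (replicate s 0) ≡ 1ℤ
    near-zero m []       []       = refl
    near-zero m (y ∷ ys) (d ∷ ds) =
      cong₂ _*_ (𝟙-yes (subst (pos m ∣_) (sym (ℤ.+-identityʳ (pos y))) (∣ᵤ⇒∣ d))) (near-zero m ys ds)

    -- All zeros are multiples of `p^t`, and it suffices to count these multiples: with `k < s`
    -- their number is of lower order than the `(s-1)`-th power of the modulus, which makes the
    -- density vanish.
    solutionCount-insoluble : ∀ {s} m (a : Vec ℤ s) → ¬ Soluble (p ℕ.^ m) a → ∀ t →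
      solutionCount k a (p ℕ.^ (t ℕ.* k ℕ.+ m)) ℕ.≤ (p ℕ.^ (t ℕ.* k′ ℕ.+ m)) ℕ.^ s
    solutionCount-insoluble {s} m a insoluble t = ℤ.drop‿+≤+ (begin
      pos (solutionCount k a q)
        ≡⟨ solutionCount≡ k a q ⟩
      ∑ (box s q) (λ y → 𝟙 q (0ℤ + diagonalForm k a y))
        ≤⟨ ∑-mono (box s q) pointwise ⟩
      ∑ (box s q) (λ y → near (p ℕ.^ t) y (replicate s 0))
        ≡⟨ cong (λ n → ∑ (box s n) (λ y → near (p ℕ.^ t) y (replicate s 0))) q≡ ⟩
      ∑ (box s (p ℕ.^ (t ℕ.* k′ ℕ.+ m) ℕ.* p ℕ.^ t)) (λ y → near (p ℕ.^ t) y (replicate s 0))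
        ≡⟨ ∑-near (p ℕ.^ (t ℕ.* k′ ℕ.+ m)) (p ℕ.^ t) {{ℕ.m^n≢0 p t}} (replicate s 0) ⟩
      pos ((p ℕ.^ (t ℕ.* k′ ℕ.+ m)) ℕ.^ s) ∎)
      where
      open ℤ.≤-Reasoning
      q : ℕ
      q = p ℕ.^ (t ℕ.* k ℕ.+ m)
      exponent : ∀ t k′ m → t ℕ.* (1 ℕ.+ k′) ℕ.+ m ≡ t ℕ.* k′ ℕ.+ m ℕ.+ t
      exponent = ℕ.solve-∀
      q≡ : q ≡ p ℕ.^ (t ℕ.* k′ ℕ.+ m) ℕ.* p ℕ.^ t
      q≡ = trans (cong (p ℕ.^_) (exponent t k′ m)) (ℕ.^-distribˡ-+-* p (t ℕ.* k′ ℕ.+ m) t)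
      pointwise : ∀ y → 𝟙 q (0ℤ + diagonalForm k a y) ≤ near (p ℕ.^ t) y (replicate s 0)
      pointwise y with pos q ∣? diagonalForm k a y
      ... | yes d = ℤ.≤-trans (𝟙≤1 q _)
        (ℤ.≤-reflexive (sym (near-zero (p ℕ.^ t) y (insoluble⇒divisible m a insoluble t y d))))
      ... | no ¬d = subst (_≤ near (p ℕ.^ t) y (replicate s 0))
        (sym (𝟙-no λ d → ¬d (subst (pos q ∣_) (ℤ.+-identityˡ _) d))) (0≤near (p ℕ.^ t) y (replicate s 0))

    -- Indicates the points with `p` dividing every `a_j x_j`. For `p` not dividing `k`, every other
    -- point has a partial derivative prime to `p`.
    singular : ∀ {s} → Vec ℤ s → Vec ℕ s → ℤ
    singular []       []       = 1ℤ
    singular (a ∷ as) (x ∷ xs) = 𝟙 p (a * pos x) * singular as xs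

    ∑-singular : ∀ {s} (a : Vec ℤ s) → ∑ (box s p) (singular a) ≤ pos (p ℕ.^ divisibleEntries p a)
    ∑-singular []       = ℤ.≤-refl
    ∑-singular {suc s} (a ∷ as) = begin
      ∑ (box (suc s) p) (singular (a ∷ as))
        ≡⟨ trans (∑-product _∷_ (resid p) (box s p) _) (sym (∑-*-∑ (resid p) (box s p) _ _)) ⟩
      ∑ᵣ p (λ x → 𝟙 p (a * x)) * ∑ (box s p) (singular as)
        ≤⟨ *-monoˡ (∑ᵣ p (λ x → 𝟙 p (a * x))) (∑-nonneg (resid p) λ x → 0≤𝟙 p _) (∑-singular as) ⟩
      ∑ᵣ p (λ x → 𝟙 p (a * x)) * pos (p ℕ.^ divisibleEntries p as)
        ≤⟨ head ⟩
      pos (p ℕ.^ divisibleEntries p (a ∷ as)) ∎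
      where
      open ℤ.≤-Reasoning
      head : ∑ᵣ p (λ x → 𝟙 p (a * x)) * pos (p ℕ.^ divisibleEntries p as) ≤ pos (p ℕ.^ divisibleEntries p (a ∷ as))
      head with p ℕ.∣? ∣ a ∣
      ... | yes _ = ℤ.≤-trans (*-monoʳ (pos (p ℕ.^ divisibleEntries p as)) 0≤pos
        (ℤ.≤-trans (∑-mono (resid p) λ x → 𝟙≤1 p _) (ℤ.≤-reflexive (trans (∑ᵣ-const p 1ℤ) (ℤ.*-identityʳ (pos p))))))
        (ℤ.≤-reflexive (sym (ℤ.pos-* p (p ℕ.^ divisibleEntries p as))))
      ... | no p∤a = ℤ.≤-trans (*-monoʳ (pos (p ℕ.^ divisibleEntries p as)) 0≤pos
        (ℤ.≤-trans (∑-mono (resid p) λ x → 𝟙-mono λ d → [ (λ p∣a → contradiction (∣⇒∣ᵤ p∣a) p∤a) , (λ d′ → d′) ]′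
          (prime-∣-* p-prime a (pos x) d)) (ℤ.≤-reflexive (∑ᵣ-𝟙₀ p)))) (ℤ.≤-reflexive (ℤ.*-identityˡ _))

    module _ (p∤k : ¬ p ℕ.∣ k) where

      private
        pivot₀ : ∀ a x → ¬ pos p ∣ a * pos x → ¬ pos p ∣ pos k * a * pos x ^ k′
        pivot₀ a x p∤ax d = [ (λ d′ → [ (λ d″ → p∤k (∣⇒∣ᵤ d″)) , (λ d″ → p∤ax (∣m⇒∣m*n (pos x) d″)) ]′ (prime-∣-* p-prime (pos k) a d′))
                            , prime-∤-^ p-prime (pos x) k′ (λ d′ → p∤ax (∣n⇒∣m*n a d′)) ]′
                            (prime-∣-* p-prime (pos k * a) (pos x ^ k′) d)

      singular-cases : ∀ {s} (a : Vec ℤ (suc s)) x → (singular a x ≡ 1ℤ) ⊎ ((singular a x ≡ 0ℤ) × Pivot p k′ 0 a x)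
      singular-cases (a ∷ as) (x ∷ xs) with pos p ∣? a * pos x
      ... | no p∤ax = inj₂ (cong (_* singular as xs) (𝟙-no p∤ax) , here (sym (ℤ.*-identityˡ _)) (pivot₀ a x p∤ax))
      singular-cases (a ∷ [])           (x ∷ []) | yes d = inj₁ (cong (_* 1ℤ) (𝟙-yes d))
      singular-cases (a ∷ as@(_ ∷ _)) (x ∷ xs) | yes d with singular-cases as xs
      ... | inj₁ eq         = inj₁ (cong₂ _*_ (𝟙-yes d) eq)
      ... | inj₂ (eq , piv) = inj₂ (cong₂ _*_ (𝟙-yes d) eq , there piv)

      -- Lifts of distinct residue vectors modulo `p` are disjoint. The modulus `p ℕ.* 1` is `m₁` of
      -- `Lifting` for `w = 0`.
      ∑-near-fibre : ∀ {s} (y : Vec ℕ s) → ∑ (box s p) (near (p ℕ.* 1) y) ≡ 1ℤ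
      ∑-near-fibre []       = refl
      ∑-near-fibre {suc s} (y ∷ ys) = trans (trans (∑-product _∷_ (resid p) (box s p) _) (sym (∑-*-∑ (resid p) (box s p) _ _)))
        (cong₂ _*_ (trans (∑-cong (resid p) λ x → 𝟙-cong
            (λ d → subst (λ n → pos n ∣ pos x - pos y) (ℕ.*-identityʳ p) (∣-flip (pos y) (pos x) d))
            (λ d → subst (λ n → pos n ∣ pos y - pos x) (sym (ℕ.*-identityʳ p)) (∣-flip (pos x) (pos y) d)))
          (∑ᵣ-𝟙 p (pos y))) (∑-near-fibre ys))

      -- Subtracting all singular points, zeros or not, leaves at most the nonsingular zeros, and
      -- each of these lifts with `w = 0` to at least `p^(ts)` zeros in its own class modulo `p`.
      solutionCount-nonsingular : ∀ {s} (a : Vec ℤ (suc s)) t →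
        (pos (solutionCount k a p) - pos (p ℕ.^ divisibleEntries p a)) * pos ((p ℕ.^ t) ℕ.^ s) ≤
        pos (solutionCount k a (p ℕ.^ suc t))
      solutionCount-nonsingular {s} a t = begin
        (pos (solutionCount k a p) - pos (p ℕ.^ divisibleEntries p a)) * L
          ≤⟨ *-monoʳ L 0≤pos (ℤ.+-mono-≤ (ℤ.≤-reflexive (solutionCount≡ k a p)) (ℤ.neg-mono-≤ (∑-singular a))) ⟩
        (congruenceCount k p p a 0ℤ - ∑ (box (suc s) p) (singular a)) * L
          ≡⟨ trans (cong (_* L) (sym (∑-- (box (suc s) p) _ _))) (sym (∑-*ʳ (box (suc s) p) L _)) ⟩
        ∑ (box (suc s) p) (λ x → (𝟙 p (0ℤ + diagonalForm k a x) - singular a x) * L)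
          ≤⟨ ∑-mono (box (suc s) p) pointwise ⟩
        ∑ (box (suc s) p) (λ x → ∑ (box (suc s) q) (λ y → near (p ℕ.* 1) y x * 𝟙 q (0ℤ + diagonalForm k a y)))
          ≡⟨ ∑-swap (box (suc s) p) (box (suc s) q) _ ⟩
        ∑ (box (suc s) q) (λ y → ∑ (box (suc s) p) (λ x → near (p ℕ.* 1) y x * 𝟙 q (0ℤ + diagonalForm k a y)))
          ≡⟨ ∑-cong (box (suc s) q) (λ y → trans (∑-*ʳ (box (suc s) p) _ (near (p ℕ.* 1) y))
               (trans (cong (_* 𝟙 q (0ℤ + diagonalForm k a y)) (∑-near-fibre y)) (ℤ.*-identityˡ _))) ⟩
        congruenceCount k q q a 0ℤ
          ≡⟨ trans (sym (solutionCount≡ k a q)) (cong (λ n → pos (solutionCount k a n)) q≡) ⟩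
        pos (solutionCount k a (p ℕ.^ suc t)) ∎
        where
        open ℤ.≤-Reasoning
        L : ℤ
        L = pos ((p ℕ.^ t) ℕ.^ s)
        q : ℕ
        q = p ℕ.^ t ℕ.* (1 ℕ.* 1 ℕ.* p)
        q≡ : q ≡ p ℕ.^ suc t
        q≡ = trans (cong (p ℕ.^ t ℕ.*_) (ℕ.+-identityʳ p)) (ℕ.*-comm (p ℕ.^ t) p)
        0≤lifts : ∀ x → 0ℤ ≤ Lifting.lifts p-prime k′ 0 t a 0ℤ x
        0≤lifts x = ∑-nonneg (box (suc s) q) λ y → 0≤* (0≤near (p ℕ.* 1) y x) (0≤𝟙 q _)
        pointwise : ∀ x → (𝟙 p (0ℤ + diagonalForm k a x) - singular a x) * L ≤ Lifting.lifts p-prime k′ 0 t a 0ℤ x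
        pointwise x with singular-cases a x | pos p ∣? (0ℤ + diagonalForm k a x)
        ... | inj₁ eq | _ = ℤ.≤-trans (*-monoʳ L 0≤pos
          (subst (λ z → 𝟙 p (0ℤ + diagonalForm k a x) - z ≤ 0ℤ) (sym eq) (ℤ.i≤j⇒i-j≤0 (𝟙≤1 p (0ℤ + diagonalForm k a x))))) (0≤lifts x)
        ... | inj₂ (eq , piv) | no ¬d = subst (_≤ Lifting.lifts p-prime k′ 0 t a 0ℤ x)
          (cong (_* L) (sym (cong₂ _-_ (𝟙-no ¬d) eq))) (0≤lifts x)
        ... | inj₂ (eq , piv) | yes d = subst (_≤ Lifting.lifts p-prime k′ 0 t a 0ℤ x)
          (trans (sym (ℤ.*-identityˡ L)) (cong (_* L) (sym (cong₂ _-_ (𝟙-yes d) eq))))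
          (Lifting.lifts≥ p-prime k′ 0 t piv 0ℤ (subst (λ n → pos n ∣ 0ℤ + diagonalForm k a x) (sym (ℕ.+-identityʳ p)) d))

-- Zero counts at primes dividing at most one coefficient

module GoodPrimes where

  open FiniteSums
  open Residues
  open CongruenceCounts
  open LocalSolutions
  open import Defs using (solutionCount)
  open import Data.Integer using (ℤ; 0ℤ; 1ℤ; _+_; _*_; _-_; -_; _≤_; +≤+; +<+; ∣_∣; _^_; positive) renaming (+_ to pos)
  open import Data.Integer.Tactic.RingSolver using (solve-∀)

  ^ℕ-distrib-* : ∀ m n o → (m ℕ.* n) ℕ.^ o ≡ m ℕ.^ o ℕ.* n ℕ.^ o
  ^ℕ-distrib-* m n zero    = refl
  ^ℕ-distrib-* m n (suc o) = trans (cong (m ℕ.* n ℕ.*_) (^ℕ-distrib-* m n o)) (lemma m n (m ℕ.^ o) (n ℕ.^ o))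
    where
    lemma : ∀ a b c d → a ℕ.* b ℕ.* (c ℕ.* d) ≡ a ℕ.* c ℕ.* (b ℕ.* d)
    lemma = ℕ.solve-∀

  square-cancel-≤ : ∀ x {b} → x * x ≤ pos b * pos b → x ≤ pos b
  square-cancel-≤ x {b} x²≤b² = ℤ.≮⇒≥ λ b<x → ℤ.<⇒≱ (ℤ.≤-<-trans
    (ℤ.*-monoˡ-≤-nonNeg (pos b) (ℤ.<⇒≤ b<x)) (ℤ.*-monoʳ-<-pos x {{positive (ℤ.≤-<-trans 0≤pos b<x)}} b<x)) x²≤b²

  -- With `u` the integer square root of `p` in the application, `u³` stands for `p^(3/2)` and the
  -- estimates stay in the integers.
  module GoodPrime {p : ℕ} (p-prime : Prime p) (k′ : ℕ) (p∤k : ¬ p ℕ.∣ suc k′)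
    {s′ : ℕ} (5≤s′ : 5 ℕ.≤ s′) (a : Vec ℤ (suc s′)) (ν≤1 : divisibleEntries p a ℕ.≤ 1)
    {u : ℕ} (u²≤p : u ℕ.* u ℕ.≤ p) where

    private
      k s : ℕ
      k = suc k′
      s = suc s′
      instance
        p≢0 : NonZero p
        p≢0 = prime⇒nonZero p-prime

    -- Enlarging `2k²` to `(2k)²` makes the constant of the mean square bound a perfect square; this
    -- is its root.
    deviationConstant : ℕ
    deviationConstant = (2 ℕ.* k) ℕ.^ s

    private
      C N U P^s : ℤ
      C = pos deviationConstant
      N = pos (solutionCount k a p)
      U = pos (u ℕ.* u ℕ.* u)
      P^s = pos (p ℕ.^ s)

      -- This is where s ≥ 6 is needed.
      powers : (2 ℕ.* (k ℕ.* k) ℕ.* p) ℕ.^ s ℕ.* p ℕ.^ divisibleEntries p a ℕ.* (p ℕ.* p) ℕ.* (u ℕ.* u ℕ.* u ℕ.* (u ℕ.* u ℕ.* u)) ℕ.≤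
        deviationConstant ℕ.* p ℕ.^ s ℕ.* (deviationConstant ℕ.* p ℕ.^ s)
      powers = begin
        (2 ℕ.* (k ℕ.* k) ℕ.* p) ℕ.^ s ℕ.* p ℕ.^ divisibleEntries p a ℕ.* (p ℕ.* p) ℕ.* (u ℕ.* u ℕ.* u ℕ.* (u ℕ.* u ℕ.* u))
          ≤⟨ ℕ.*-mono-≤ (ℕ.*-monoˡ-≤ (p ℕ.* p) (ℕ.*-mono-≤ (ℕ.^-monoˡ-≤ s base) (ℕ.^-monoʳ-≤ p ν≤1)))
               (subst (ℕ._≤ p ℕ.* p ℕ.* p) (regroup u) (ℕ.*-mono-≤ (ℕ.*-mono-≤ u²≤p u²≤p) u²≤p)) ⟩
        (2 ℕ.* k ℕ.* (2 ℕ.* k) ℕ.* p) ℕ.^ s ℕ.* p ℕ.^ 1 ℕ.* (p ℕ.* p) ℕ.* (p ℕ.* p ℕ.* p)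
          ≡⟨ cong (λ z → z ℕ.* p ℕ.^ 1 ℕ.* (p ℕ.* p) ℕ.* (p ℕ.* p ℕ.* p))
               (trans (^ℕ-distrib-* (2 ℕ.* k ℕ.* (2 ℕ.* k)) p s) (cong (ℕ._* p ℕ.^ s) (^ℕ-distrib-* (2 ℕ.* k) (2 ℕ.* k) s))) ⟩
        deviationConstant ℕ.* deviationConstant ℕ.* p ℕ.^ s ℕ.* p ℕ.^ 1 ℕ.* (p ℕ.* p) ℕ.* (p ℕ.* p ℕ.* p)
          ≡⟨ collect deviationConstant (p ℕ.^ s) p ⟩
        deviationConstant ℕ.* deviationConstant ℕ.* p ℕ.^ s ℕ.* p ℕ.^ 6
          ≤⟨ ℕ.*-monoʳ-≤ (deviationConstant ℕ.* deviationConstant ℕ.* p ℕ.^ s) (ℕ.^-monoʳ-≤ p (s≤s 5≤s′)) ⟩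
        deviationConstant ℕ.* deviationConstant ℕ.* p ℕ.^ s ℕ.* p ℕ.^ s
          ≡⟨ collect′ deviationConstant (p ℕ.^ s) ⟩
        deviationConstant ℕ.* p ℕ.^ s ℕ.* (deviationConstant ℕ.* p ℕ.^ s) ∎
        where
        open ℕ.≤-Reasoning
        regroup : ∀ u → u ℕ.* u ℕ.* (u ℕ.* u) ℕ.* (u ℕ.* u) ≡ u ℕ.* u ℕ.* u ℕ.* (u ℕ.* u ℕ.* u)
        regroup = ℕ.solve-∀
        expand : ∀ k → 2 ℕ.* (k ℕ.* k) ℕ.+ 2 ℕ.* (k ℕ.* k) ≡ 2 ℕ.* k ℕ.* (2 ℕ.* k)
        expand = ℕ.solve-∀
        base : 2 ℕ.* (k ℕ.* k) ℕ.* p ℕ.≤ 2 ℕ.* k ℕ.* (2 ℕ.* k) ℕ.* p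
        base = ℕ.*-monoˡ-≤ p (subst (2 ℕ.* (k ℕ.* k) ℕ.≤_) (expand k) (ℕ.m≤m+n (2 ℕ.* (k ℕ.* k)) (2 ℕ.* (k ℕ.* k))))
        collect : ∀ c P p → c ℕ.* c ℕ.* P ℕ.* (p ℕ.* 1) ℕ.* (p ℕ.* p) ℕ.* (p ℕ.* p ℕ.* p) ≡
          c ℕ.* c ℕ.* P ℕ.* (p ℕ.* (p ℕ.* (p ℕ.* (p ℕ.* (p ℕ.* (p ℕ.* 1))))))
        collect = ℕ.solve-∀
        collect′ : ∀ c P → c ℕ.* c ℕ.* P ℕ.* P ≡ c ℕ.* P ℕ.* (c ℕ.* P)
        collect′ = ℕ.solve-∀

      deviation : U * (P^s - pos p * N) ≤ C * P^s
      deviation = subst (U * (P^s - pos p * N) ≤_) (ℤ.pos-* deviationConstant (p ℕ.^ s))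
        (square-cancel-≤ _ (begin
          U * (P^s - pos p * N) * (U * (P^s - pos p * N))
            ≡⟨ rearrange U P^s (pos p * N) ⟩
          (pos p * N - P^s) * (pos p * N - P^s) * (U * U)
            ≤⟨ *-monoʳ (U * U) (0≤² U) (subst (λ z → (pos p * z - P^s) * (pos p * z - P^s) ≤ pos B)
                 (sym (solutionCount≡ k a p)) (MeanSquare.congruenceCount-deviation p-prime k′ a)) ⟩
          pos B * (U * U)
            ≡⟨ cong (pos B *_) (sym (ℤ.pos-* (u ℕ.* u ℕ.* u) (u ℕ.* u ℕ.* u))) ⟩
          pos B * pos (u ℕ.* u ℕ.* u ℕ.* (u ℕ.* u ℕ.* u))
            ≡⟨ sym (ℤ.pos-* B _) ⟩
          pos (B ℕ.* (u ℕ.* u ℕ.* u ℕ.* (u ℕ.* u ℕ.* u)))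
            ≤⟨ +≤+ powers ⟩
          pos (deviationConstant ℕ.* p ℕ.^ s ℕ.* (deviationConstant ℕ.* p ℕ.^ s))
            ≡⟨ ℤ.pos-* (deviationConstant ℕ.* p ℕ.^ s) _ ⟩
          pos (deviationConstant ℕ.* p ℕ.^ s) * pos (deviationConstant ℕ.* p ℕ.^ s) ∎))
        where
        open ℤ.≤-Reasoning
        B : ℕ
        B = (2 ℕ.* (k ℕ.* k) ℕ.* p) ℕ.^ s ℕ.* p ℕ.^ divisibleEntries p a ℕ.* (p ℕ.* p)
        rearrange : ∀ U P M → U * (P - M) * (U * (P - M)) ≡ (M - P) * (M - P) * (U * U)
        rearrange = solve-∀

      singular-small : U * (pos p * pos (p ℕ.^ divisibleEntries p a)) ≤ P^s
      singular-small = begin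
        U * (pos p * pos (p ℕ.^ divisibleEntries p a))
          ≡⟨ trans (cong (U *_) (sym (ℤ.pos-* p _))) (sym (ℤ.pos-* (u ℕ.* u ℕ.* u) _)) ⟩
        pos (u ℕ.* u ℕ.* u ℕ.* (p ℕ.* p ℕ.^ divisibleEntries p a))
          ≤⟨ +≤+ (ℕ.*-mono-≤ (ℕ.*-mono-≤ u²≤p (ℕ.≤-trans (u≤u² u) u²≤p)) (ℕ.*-monoʳ-≤ p (ℕ.^-monoʳ-≤ p ν≤1))) ⟩
        pos (p ℕ.* p ℕ.* (p ℕ.* p ℕ.^ 1))
          ≡⟨ cong pos (collect p) ⟩
        pos (p ℕ.^ 4)
          ≤⟨ +≤+ (ℕ.^-monoʳ-≤ p (ℕ.≤-trans (ℕ.m≤n+m 4 2) (s≤s 5≤s′))) ⟩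
        P^s ∎
        where
        open ℤ.≤-Reasoning
        u≤u² : ∀ u → u ℕ.≤ u ℕ.* u
        u≤u² zero    = z≤n
        u≤u² (suc u) = ℕ.m≤m*n (suc u) (suc u)
        collect : ∀ p → p ℕ.* p ℕ.* (p ℕ.* (p ℕ.* 1)) ≡ p ℕ.* (p ℕ.* (p ℕ.* (p ℕ.* 1)))
        collect = ℕ.solve-∀

    -- After multiplication by `u³`, the deviation of `N` from `p^(s-1)` costs at most
    -- `deviationConstant` and the singular points at most 1, in units of `p^(s-1)`.
    nonsingular-many : (U - pos (suc deviationConstant)) * pos (p ℕ.^ s′) ≤
      U * (N - pos (p ℕ.^ divisibleEntries p a))
    nonsingular-many = ℤ.*-cancelˡ-≤-pos _ _ (pos p) {{positive (+<+ (ℕ.>-nonZero⁻¹ p))}} (begin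
      pos p * ((U - pos (suc deviationConstant)) * pos (p ℕ.^ s′))
        ≡⟨ trans (rearrange (pos p) (U - pos (suc deviationConstant)) (pos (p ℕ.^ s′)))
             (cong ((U - (1ℤ + C)) *_) (sym (ℤ.pos-* p (p ℕ.^ s′)))) ⟩
      (U - (1ℤ + C)) * P^s
        ≡⟨ rearrange′ U C P^s (pos p * N) ⟩
      U * (pos p * N) + (U * (P^s - pos p * N) - C * P^s) - P^s
        ≤⟨ ℤ.+-mono-≤ (ℤ.+-monoʳ-≤ (U * (pos p * N)) (ℤ.i≤j⇒i-j≤0 deviation)) (ℤ.neg-mono-≤ singular-small) ⟩
      U * (pos p * N) + 0ℤ - U * (pos p * V)
        ≡⟨ rearrange″ U (pos p) N V ⟩
      pos p * (U * (N - V)) ∎)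
      where
      open ℤ.≤-Reasoning
      V : ℤ
      V = pos (p ℕ.^ divisibleEntries p a)
      rearrange : ∀ p A B → p * (A * B) ≡ A * (p * B)
      rearrange = solve-∀
      rearrange′ : ∀ U C P M → (U - (1ℤ + C)) * P ≡ U * M + (U * (P - M) - C * P) - P
      rearrange′ = solve-∀
      rearrange″ : ∀ U p N V → U * (p * N) + 0ℤ - U * (p * V) ≡ p * (U * (N - V))
      rearrange″ = solve-∀

    solutionCount-good : ∀ t → (U - pos (suc deviationConstant)) * pos (p ℕ.^ s′ ℕ.* (p ℕ.^ t) ℕ.^ s′) ≤
      U * pos (solutionCount k a (p ℕ.^ suc t))
    solutionCount-good t = begin
      (U - pos (suc deviationConstant)) * pos (p ℕ.^ s′ ℕ.* (p ℕ.^ t) ℕ.^ s′)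
        ≡⟨ trans (cong ((U - pos (suc deviationConstant)) *_) (ℤ.pos-* (p ℕ.^ s′) _))
             (sym (ℤ.*-assoc (U - pos (suc deviationConstant)) (pos (p ℕ.^ s′)) L)) ⟩
      (U - pos (suc deviationConstant)) * pos (p ℕ.^ s′) * L
        ≤⟨ *-monoʳ L 0≤pos nonsingular-many ⟩
      U * (N - pos (p ℕ.^ divisibleEntries p a)) * L
        ≡⟨ ℤ.*-assoc U _ L ⟩
      U * ((N - pos (p ℕ.^ divisibleEntries p a)) * L)
        ≤⟨ *-monoˡ U 0≤pos (solutionCount-nonsingular p-prime k′ p∤k a t) ⟩
      U * pos (solutionCount k a (p ℕ.^ suc t)) ∎
      where
      open ℤ.≤-Reasoning
      L : ℤ
      L = pos ((p ℕ.^ t) ℕ.^ s′)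

-- Bad primes and the product of their contributions

module BadPrimes where

  open CongruenceCounts using (divisibleEntries)
  open LocalSolutions using (valuation; valuation-spec; weight)
  open GoodPrimes using (^ℕ-distrib-*)
  open import Data.Integer using (ℤ; 0ℤ; ∣_∣)
  open import Data.List.Relation.Unary.All as List using ([]; _∷_)
  open import Data.Nat
  open import Data.Nat.Divisibility
  open import Data.Nat.GCD using (gcd; gcd[m,n]≢0; gcd-greatest)
  open import Data.Nat.Properties
  open import Data.Nat.Tactic.RingSolver using (solve-∀)
  open import Data.Unit using (⊤)

  ∏ : List ℕ → (ℕ → ℕ) → ℕ
  ∏ []       f = 1
  ∏ (p ∷ ps) f = f p * ∏ ps f

  ∏-cong : ∀ ps {f g : ℕ → ℕ} → (∀ p → f p ≡ g p) → ∏ ps f ≡ ∏ ps g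
  ∏-cong []       eq = refl
  ∏-cong (p ∷ ps) eq = cong₂ _*_ (eq p) (∏-cong ps eq)

  ∏-mono : ∀ ps {f g : ℕ → ℕ} → (∀ {p} → p ∈ ps → f p ≤ g p) → ∏ ps f ≤ ∏ ps g
  ∏-mono []       le = ≤-refl
  ∏-mono (p ∷ ps) le = *-mono-≤ (le (here refl)) (∏-mono ps λ p∈ → le (there p∈))

  private
    interchange : ∀ a b c d → a * b * (c * d) ≡ a * c * (b * d)
    interchange = solve-∀

  ∏-* : ∀ ps (f g : ℕ → ℕ) → ∏ ps (λ p → f p * g p) ≡ ∏ ps f * ∏ ps g
  ∏-* []       f g = refl
  ∏-* (p ∷ ps) f g = trans (cong (f p * g p *_) (∏-* ps f g)) (interchange (f p) (g p) (∏ ps f) (∏ ps g))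

  ∏-^ : ∀ ps (f : ℕ → ℕ) n → ∏ ps (λ p → f p ^ n) ≡ ∏ ps f ^ n
  ∏-^ []       f n = sym (^-zeroˡ n)
  ∏-^ (p ∷ ps) f n = trans (cong (f p ^ n *_) (∏-^ ps f n)) (sym (^ℕ-distrib-* (f p) (∏ ps f) n))

  prime-∣-^ : ∀ {p} → Prime p → ∀ m n → p ∣ m ^ n → p ∣ m
  prime-∣-^ p-prime m zero    p∣1 = contradiction (∣⇒≤ p∣1) (<⇒≱ (nonTrivial⇒n>1 _ {{prime⇒nonTrivial p-prime}}))
  prime-∣-^ p-prime m (suc n) p∣m^n = [ (λ d → d) , prime-∣-^ p-prime m n ]′ (euclidsLemma m (m ^ n) p-prime p∣m^n)

  prime-power-∣ : ∀ {p} → Prime p → ∀ e m r → ¬ p ∣ r → p ^ e ∣ m * r → p ^ e ∣ m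
  prime-power-∣         p-prime zero    m r p∤r d = 1∣ m
  prime-power-∣ {p} p-prime (suc e) m r p∤r d with euclidsLemma m r p-prime (∣-trans (m∣m*n (p ^ e)) d)
  ... | inj₂ p∣r = contradiction p∣r p∤r
  ... | inj₁ (divides m′ refl) = subst (p ^ suc e ∣_) (*-comm p m′) (*-monoʳ-∣ p (prime-power-∣ p-prime e m′ r p∤r
    (*-cancelˡ-∣ p {{prime⇒nonZero p-prime}} (subst (p ^ suc e ∣_) (lemma m′ p r) d))))
    where
    lemma : ∀ m p r → m * p * r ≡ p * (m * r)
    lemma = solve-∀

  prime-∣-∏ : ∀ {p} → Prime p → ∀ {ps} → List.All Prime ps → ∀ (f : ℕ → ℕ) → p ∣ ∏ ps (λ q → q ^ f q) → p ∈ ps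
  prime-∣-∏         p-prime {[]}     _                f d = contradiction (∣⇒≤ d) (<⇒≱ (nonTrivial⇒n>1 _ {{prime⇒nonTrivial p-prime}}))
  prime-∣-∏ {p} p-prime {q ∷ ps} (q-prime ∷ prs) f d with euclidsLemma (q ^ f q) _ p-prime d
  ... | inj₂ d′ = there (prime-∣-∏ p-prime prs f d′)
  ... | inj₁ d′ with prime⇒irreducible q-prime (prime-∣-^ p-prime q (f q) d′)
  ...   | inj₁ refl = contradiction (nonTrivial⇒n>1 1 {{prime⇒nonTrivial p-prime}}) (<-irrefl refl)
  ...   | inj₂ refl = here refl

  -- The product over the remaining primes is prime to `p`, so the power of `p` must divide the
  -- cofactor.
  ∏-prime-powers-∣ : ∀ {ps} → Unique ps → List.All Prime ps → ∀ n (f : ℕ → ℕ) → (∀ {p} → p ∈ ps → p ^ f p ∣ n) →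
    ∏ ps (λ p → p ^ f p) ∣ n
  ∏-prime-powers-∣ []                _                  n f d = 1∣ n
  ∏-prime-powers-∣ {p ∷ ps} (p∉ ∷ unique) (p-prime ∷ primes) n f d
    with ∏-prime-powers-∣ unique primes n f (λ p∈ → d (there p∈))
  ... | divides m refl = *-monoˡ-∣ (∏ ps (λ q → q ^ f q)) (prime-power-∣ p-prime (f p) m _
    (λ p∣rest → List.lookup p∉ (prime-∣-∏ p-prime primes f p∣rest) refl) (d (here refl)))

  module _ {ps : List ℕ} (unique : Unique ps) (primes : List.All Prime ps) where

    private
      1<p : ∀ {p} → p ∈ ps → 1 < p
      1<p p∈ = nonTrivial⇒n>1 _ {{prime⇒nonTrivial (List.lookup primes p∈)}}

    ∏-valuations≤ : ∀ n → n ≢ 0 → ∏ ps (λ p → p ^ valuation p n) ≤ n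
    ∏-valuations≤ n n≢0 = ∣⇒≤ {{≢-nonZero n≢0}} (∏-prime-powers-∣ unique primes n (λ p → valuation p n) power-∣)
      where
      power-∣ : ∀ {p} → p ∈ ps → p ^ valuation p n ∣ n
      power-∣ {p} p∈ with valuation-spec n (1<p p∈) n≢0
      ... | u , eq , _ = divides u (trans eq (*-comm (p ^ valuation p n) u))

    -- t is the product of the p^⌊v/2⌋, v the exponent of p in n.
    ∏-valuations≤square : ∀ n → n ≢ 0 → ∃ λ t → (t * t ∣ n) × (∏ ps (λ p → p ^ valuation p n) ≤ t * t * ∏ ps (λ p → p))
    ∏-valuations≤square n n≢0 = t , subst (_∣ n) (sym t²≡) (∏-prime-powers-∣ unique primes n (λ p → h p + h p) power-∣) ,
      ≤-trans (∏-mono ps power≤) (≤-reflexive (trans (∏-* ps (λ p → p ^ (h p + h p)) (λ p → p)) (cong (_* ∏ ps (λ p → p)) (sym t²≡))))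
      where
      h : ℕ → ℕ
      h p = ⌊ valuation p n /2⌋
      t : ℕ
      t = ∏ ps (λ p → p ^ h p)
      t²≡ : t * t ≡ ∏ ps (λ p → p ^ (h p + h p))
      t²≡ = trans (sym (∏-* ps (λ p → p ^ h p) (λ p → p ^ h p))) (∏-cong ps λ p → sym (^-distribˡ-+-* p (h p) (h p)))
      ⌊/2⌋-twice : ∀ v → ⌊ v /2⌋ + ⌊ v /2⌋ ≤ v
      ⌊/2⌋-twice v = subst (⌊ v /2⌋ + ⌊ v /2⌋ ≤_) (⌊n/2⌋+⌈n/2⌉≡n v) (+-monoʳ-≤ ⌊ v /2⌋ (⌊n/2⌋≤⌈n/2⌉ v))
      ⌊/2⌋-twice+1 : ∀ v → v ≤ suc (⌊ v /2⌋ + ⌊ v /2⌋)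
      ⌊/2⌋-twice+1 zero          = z≤n
      ⌊/2⌋-twice+1 (suc zero)    = s≤s z≤n
      ⌊/2⌋-twice+1 (suc (suc v)) = s≤s (s≤s (subst (v ≤_) (sym (+-suc ⌊ v /2⌋ ⌊ v /2⌋)) (⌊/2⌋-twice+1 v)))
      power-∣ : ∀ {p} → p ∈ ps → p ^ (h p + h p) ∣ n
      power-∣ {p} p∈ with valuation-spec n (1<p p∈) n≢0
      ... | u , eq , _ = ∣-trans (∣-trans (m∣m*n (p ^ (valuation p n ∸ (h p + h p))))
        (∣-reflexive (trans (sym (^-distribˡ-+-* p (h p + h p) _)) (cong (p ^_) (m+[n∸m]≡n (⌊/2⌋-twice (valuation p n)))))))
        (divides u (trans eq (*-comm (p ^ valuation p n) u)))
      power≤ : ∀ {p} → p ∈ ps → p ^ valuation p n ≤ p ^ (h p + h p) * p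
      power≤ {p} p∈ = ≤-trans (^-monoʳ-≤ p {{>-nonZero (<-trans z<s (1<p p∈))}} (⌊/2⌋-twice+1 (valuation p n))) (≤-reflexive (*-comm p _))

  gcdsWith : ∀ {s} → ℤ → Vec ℤ s → ℕ
  gcdsWith a []       = 1
  gcdsWith a (b ∷ bs) = gcd ∣ a ∣ ∣ b ∣ * gcdsWith a bs

  pairGcds : ∀ {s} → Vec ℤ s → ℕ
  pairGcds []       = 1
  pairGcds (a ∷ as) = gcdsWith a as * pairGcds as

  pairs : ℕ → ℕ
  pairs zero    = 0
  pairs (suc n) = n + pairs n

  Balanced : ℕ → ∀ {s} → Vec ℤ s → Set
  Balanced T []       = ⊤
  Balanced T (a ∷ as) = (∀ t → t * t ∣ ∣ a ∣ → t ≤ T) × All (λ b → gcd ∣ a ∣ ∣ b ∣ ≤ T) as × Balanced T as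

  pairGcds≤ : ∀ T {s} (a : Vec ℤ s) → Balanced T a → pairGcds a ≤ T ^ pairs s
  pairGcds≤ T         []       _                 = ≤-refl
  pairGcds≤ T {suc s} (a ∷ as) (_ , gcds , rest) = ≤-trans (*-mono-≤ (with≤ as gcds) (pairGcds≤ T as rest))
    (≤-reflexive (sym (^-distribˡ-+-* T s (pairs s))))
    where
    with≤ : ∀ {s} (bs : Vec ℤ s) → All (λ b → gcd ∣ a ∣ ∣ b ∣ ≤ T) bs → gcdsWith a bs ≤ T ^ s
    with≤ []       []           = ≤-refl
    with≤ (b ∷ bs) (le ∷ les) = *-mono-≤ le (with≤ bs les)

  -- A prime dividing two entries divides their gcd.
  divisibleEntries≤1 : ∀ p {s} (a : Vec ℤ s) → ¬ p ∣ pairGcds a → divisibleEntries p a ≤ 1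
  divisibleEntries≤1 p []       p∤ = z≤n
  divisibleEntries≤1 p (a ∷ as) p∤ with p ∣? ∣ a ∣
  ... | no _    = divisibleEntries≤1 p as λ d → p∤ (∣n⇒∣m*n (gcdsWith a as) d)
  ... | yes p∣a = s≤s (≤-reflexive (others as λ d → p∤ (∣m⇒∣m*n (pairGcds as) d)))
    where
    others : ∀ {s} (bs : Vec ℤ s) → ¬ p ∣ gcdsWith a bs → divisibleEntries p bs ≡ 0
    others []       p∤ = refl
    others (b ∷ bs) p∤ with p ∣? ∣ b ∣
    ... | yes p∣b = contradiction (∣m⇒∣m*n (gcdsWith a bs) (gcd-greatest p∣a p∣b)) p∤
    ... | no _    = others bs λ d → p∤ (∣n⇒∣m*n (gcd ∣ a ∣ ∣ b ∣) d)

  pairGcds≢0 : ∀ {s} (a : Vec ℤ s) → All (_≢ 0ℤ) a → NonZero (pairGcds a)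
  pairGcds≢0 []       []           = _
  pairGcds≢0 (a ∷ as) (a≢0 ∷ as≢0) = m*n≢0 (gcdsWith a as) (pairGcds as) {{with≢0 as}} {{pairGcds≢0 as as≢0}}
    where
    with≢0 : ∀ {s} (bs : Vec ℤ s) → NonZero (gcdsWith a bs)
    with≢0 []       = _
    with≢0 (b ∷ bs) = m*n≢0 (gcd ∣ a ∣ ∣ b ∣) (gcdsWith a bs)
      {{≢-nonZero (gcd[m,n]≢0 ∣ a ∣ ∣ b ∣ (inj₁ λ eq → a≢0 (ℤ.∣i∣≡0⇒i≡0 eq)))}} {{with≢0 bs}}

  -- Every bad prime, whether at most `B` or a divisor of two coefficients, divides this single
  -- number. For a balanced vector the product of the distinct bad primes is therefore at most
  -- `B ! * T ^ pairs s`.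
  badNumber : ∀ {s} → ℕ → Vec ℤ s → ℕ
  badNumber B a = B ! * pairGcds a

  good-prime : ∀ {p} → Prime p → ∀ B {s} (a : Vec ℤ s) → ¬ p ∣ badNumber B a → (B < p) × (divisibleEntries p a ≤ 1)
  good-prime {p} p-prime B a p∤ =
    ≰⇒> (λ p≤B → p∤ (∣m⇒∣m*n (pairGcds a) (∣-trans (p∣p! p {{prime⇒nonZero p-prime}}) (m≤n⇒m!∣n! p≤B)))) ,
    divisibleEntries≤1 p a λ d → p∤ (∣n⇒∣m*n (B !) d)
    where
    p∣p! : ∀ p .{{_ : NonZero p}} → p ∣ p !
    p∣p! (suc p) = m∣m*n (p !)

  -- The count at a soluble prime gives density at least `p^(-m(s-1))` with `m = 2 (weight + 1)`;
  -- the exponent `s` in place of `s - 1` leaves room for a strict inequality.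
  badFactor : ∀ {s} → ℕ → Vec ℤ s → ℕ → ℕ
  badFactor {s} k a p = (p ^ (2 * suc (weight p k a))) ^ s

  opaque

    badConstant badExponent : ℕ → ℕ → ℕ → ℕ
    badConstant k B s = (k * (B !) ^ suc s) ^ (2 * s)
    badExponent k B s = (2 + pairs s) * suc s * (2 * s)

  opaque
    unfolding badConstant

    badConstant≢0 : ∀ k B s .{{_ : NonZero k}} → NonZero (badConstant k B s)
    badConstant≢0 k B s {{k≢0}} = m^n≢0 (k * (B !) ^ suc s) (2 * s) {{m*n≢0 k ((B !) ^ suc s) {{k≢0}} {{m^n≢0 (B !) (suc s) {{B !≢0}}}}}}

    -- The even parts of the exponents of bad primes in a coefficient multiply to a square dividing
    -- it, at most `T²`; what remains is at most the product `Π` of the bad primes. So each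
    -- coefficient contributes at most `M`, as does the additional 1 in each exponent, and `k`
    -- contributes at most itself.
    ∏-badFactor≤ : ∀ {ps} → Unique ps → List.All Prime ps → ∀ k B T {s} (a : Vec ℤ s) → .{{NonZero k}} → .{{NonZero T}} →
      All (_≢ 0ℤ) a → Balanced T a → List.All (_∣ badNumber B a) ps →
      ∏ ps (badFactor k a) ≤ badConstant k B s * T ^ badExponent k B s
    ∏-badFactor≤ {ps} unique primes k B T {s} a a≢0 balanced bad = begin
      ∏ ps (badFactor k a)
        ≡⟨ ∏-cong ps (λ p → trans (^-*-assoc p (2 * suc (weight p k a)) s)
             (trans (cong (p ^_) (exponents (weight p k a) s)) (sym (^-*-assoc p (suc (weight p k a)) (2 * s))))) ⟩
      ∏ ps (λ p → (p ^ suc (weight p k a)) ^ (2 * s))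
        ≡⟨ ∏-^ ps _ (2 * s) ⟩
      ∏ ps (λ p → p ^ suc (weight p k a)) ^ (2 * s)
        ≤⟨ ^-monoˡ-≤ (2 * s) total ⟩
      (k * (B ! * T ^ e) ^ suc s) ^ (2 * s)
        ≡⟨ cong (_^ (2 * s)) (trans (cong (k *_) (^ℕ-distrib-* (B !) (T ^ e) (suc s)))
             (sym (*-assoc k ((B !) ^ suc s) ((T ^ e) ^ suc s)))) ⟩
      (k * (B !) ^ suc s * (T ^ e) ^ suc s) ^ (2 * s)
        ≡⟨ ^ℕ-distrib-* (k * (B !) ^ suc s) ((T ^ e) ^ suc s) (2 * s) ⟩
      badConstant k B s * ((T ^ e) ^ suc s) ^ (2 * s)
        ≡⟨ cong (badConstant k B s *_) (trans (cong (_^ (2 * s)) (^-*-assoc T e (suc s))) (^-*-assoc T (e * suc s) (2 * s))) ⟩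
      badConstant k B s * T ^ badExponent k B s ∎
      where
      open ≤-Reasoning
      e M Π : ℕ
      e = 2 + pairs s
      M = B ! * T ^ e
      Π = ∏ ps (λ p → p)
      exponents : ∀ w r → 2 * (1 + w) * r ≡ (1 + w) * (2 * r)
      exponents = solve-∀
      badNumber≢0 : NonZero (badNumber B a)
      badNumber≢0 = m*n≢0 (B !) (pairGcds a) {{B !≢0}} {{pairGcds≢0 a a≢0}}
      Π≤ : Π ≤ B ! * T ^ pairs s
      Π≤ = begin
        Π                        ≡⟨ ∏-cong ps (λ p → sym (*-identityʳ p)) ⟩
        ∏ ps (λ p → p ^ 1)       ≤⟨ ∣⇒≤ {{badNumber≢0}} (∏-prime-powers-∣ unique primes (badNumber B a) (λ _ → 1)
                                      λ {p} p∈ → subst (_∣ badNumber B a) (sym (*-identityʳ p)) (List.lookup bad p∈)) ⟩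
        badNumber B a            ≤⟨ *-monoʳ-≤ (B !) (pairGcds≤ T a balanced) ⟩
        B ! * T ^ pairs s        ∎
      T²Π≤M : T * T * Π ≤ M
      T²Π≤M = begin
        T * T * Π                      ≤⟨ *-monoʳ-≤ (T * T) Π≤ ⟩
        T * T * (B ! * T ^ pairs s)    ≡⟨ lemma T (B !) (T ^ pairs s) ⟩
        M                              ∎
        where
        lemma : ∀ T F X → T * T * (F * X) ≡ F * (T * (T * X))
        lemma = solve-∀
      Π≤M : Π ≤ M
      Π≤M = ≤-trans (m≤n*m Π (T * T) {{m*n≢0 T T}}) T²Π≤M
      weights : ∀ {s} (a : Vec ℤ s) → All (_≢ 0ℤ) a → Balanced T a → ∏ ps (λ p → p ^ weight p k a) ≤ k * M ^ s
      weights []       _            _                     = ≤-trans (∏-valuations≤ unique primes k (≢-nonZero⁻¹ k)) (≤-reflexive (sym (*-identityʳ k)))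
      weights {suc s} (a ∷ as) (a≢0 ∷ as≢0) (square , _ , balanced)
        with ∏-valuations≤square unique primes ∣ a ∣ (λ eq → a≢0 (ℤ.∣i∣≡0⇒i≡0 eq))
      ... | t , t²∣a , le = begin
        ∏ ps (λ p → p ^ weight p k (a ∷ as))
          ≡⟨ trans (∏-cong ps λ p → ^-distribˡ-+-* p (valuation p ∣ a ∣) (weight p k as)) (∏-* ps _ _) ⟩
        ∏ ps (λ p → p ^ valuation p ∣ a ∣) * ∏ ps (λ p → p ^ weight p k as)
          ≤⟨ *-mono-≤ (≤-trans le (≤-trans (*-monoˡ-≤ Π (*-mono-≤ (square t t²∣a) (square t t²∣a))) T²Π≤M)) (weights as as≢0 balanced) ⟩
        M * (k * M ^ s)
          ≡⟨ lemma M k (M ^ s) ⟩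
        k * M ^ suc s ∎
        where
        lemma : ∀ M k X → M * (k * X) ≡ k * (M * X)
        lemma = solve-∀
      total : ∏ ps (λ p → p ^ suc (weight p k a)) ≤ k * M ^ suc s
      total = begin
        ∏ ps (λ p → p ^ suc (weight p k a))          ≡⟨ ∏-* ps (λ p → p) (λ p → p ^ weight p k a) ⟩
        Π * ∏ ps (λ p → p ^ weight p k a)            ≤⟨ *-mono-≤ Π≤M (weights a a≢0 balanced) ⟩
        M * (k * M ^ s)                              ≡⟨ lemma M k (M ^ s) ⟩
        k * M ^ suc s                                ∎
        where
        lemma : ∀ M k X → M * (k * X) ≡ k * (M * X)
        lemma = solve-∀

-- Counting unbalanced vectors by a first moment

module UnbalancedVectors where

  open FiniteSums
  open Residues
  open BadPrimes using (Balanced)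
  open import Defs using (maxNorm)
  open import Data.Integer using (ℤ; 0ℤ; 1ℤ; _+_; _*_; _-_; -_; _≤_; _<_; +≤+; +<+; ∣_∣; -[1+_]; positive) renaming (+_ to pos)
  open import Data.Integer.Divisibility.Signed
  open import Data.Integer.Tactic.RingSolver using (solve-∀)
  open import Data.List.Membership.Propositional.Properties using (∈-map⁺; ∈-++⁺ˡ; ∈-++⁺ʳ; ∈-++⁻; ∈-∃++; ∈-cartesianProductWith⁺)
  open import Data.List.Relation.Unary.All as List using ([]; _∷_)
  open import Data.Nat.DivMod using (_/_; _%_; m≡m%n+[m/n]*n; m%n<n)
  open import Data.Nat.GCD using (gcd; gcd[m,n]∣m; gcd[m,n]∣n)
  open import Data.Unit using (tt)

  ∑-unique-⊆ : {X : Set} {xs ys : List X} {f : X → ℤ} → (∀ x → 0ℤ ≤ f x) → Unique xs →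
    (∀ {x} → x ∈ xs → x ∈ ys) → ∑ xs f ≤ ∑ ys f
  ∑-unique-⊆ {xs = []}     {ys} 0≤f _ _ = ∑-nonneg ys 0≤f
  ∑-unique-⊆ {xs = x ∷ xs} {ys} {f} 0≤f (x∉ ∷ unique) sub with ∈-∃++ (sub (here refl))
  ... | ys₁ , ys₂ , refl = begin
      f x + ∑ xs f                 ≤⟨ ℤ.+-monoʳ-≤ (f x) (∑-unique-⊆ 0≤f unique rest) ⟩
      f x + ∑ (ys₁ ++ ys₂) f       ≡⟨ cong (f x +_) (∑-++ ys₁ ys₂ f) ⟩
      f x + (∑ ys₁ f + ∑ ys₂ f)    ≡⟨ lemma (f x) (∑ ys₁ f) (∑ ys₂ f) ⟩
      ∑ ys₁ f + (f x + ∑ ys₂ f)    ≡⟨ sym (∑-++ ys₁ (x ∷ ys₂) f) ⟩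
      ∑ (ys₁ ++ x ∷ ys₂) f         ∎
    where
    open ℤ.≤-Reasoning
    lemma : ∀ a b c → a + (b + c) ≡ b + (a + c)
    lemma = solve-∀
    rest : ∀ {y} → y ∈ xs → y ∈ ys₁ ++ ys₂
    rest y∈ with ∈-++⁻ ys₁ (sub (there y∈))
    ... | inj₁ y∈₁         = ∈-++⁺ˡ y∈₁
    ... | inj₂ (here refl) = contradiction refl (List.lookup x∉ y∈)
    ... | inj₂ (there y∈₂) = ∈-++⁺ʳ ys₁ y∈₂

  multiples≤ : ∀ m .{{_ : NonZero m}} n → pos m * ∑ᵣ n (𝟙 m) ≤ pos n
  multiples≤ m n = begin
    pos m * ∑ᵣ n (𝟙 m)                             ≡⟨ cong (λ l → pos m * ∑ᵣ l (𝟙 m)) n≡ ⟩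
    pos m * ∑ᵣ (r ℕ.+ q ℕ.* m) (𝟙 m)               ≡⟨ cong (pos m *_) (∑ᵣ-split (q ℕ.* m) r (𝟙 m)) ⟩
    pos m * (∑ᵣ (q ℕ.* m) (𝟙 m) + ∑ᵣ r (λ x → 𝟙 m (x + pos (q ℕ.* m))))
      ≡⟨ cong (pos m *_) (cong₂ _+_ (trans (∑ᵣ-multiple (𝟙-periodic m) q) (trans (cong (pos q *_) (∑ᵣ-𝟙₀ m)) (ℤ.*-identityʳ (pos q)))) remainder) ⟩
    pos m * (pos q + 0ℤ)                            ≡⟨ trans (cong (pos m *_) (ℤ.+-identityʳ (pos q))) (trans (ℤ.*-comm (pos m) (pos q)) (sym (ℤ.pos-* q m))) ⟩
    pos (q ℕ.* m)                                   ≤⟨ +≤+ (ℕ.m≤n+m (q ℕ.* m) r) ⟩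
    pos (r ℕ.+ q ℕ.* m)                             ≡⟨ cong pos (sym n≡) ⟩
    pos n ∎
    where
    open ℤ.≤-Reasoning
    r q : ℕ
    r = n % m
    q = n / m
    n≡ : n ≡ r ℕ.+ q ℕ.* m
    n≡ = m≡m%n+[m/n]*n n m
    small : ∀ x → (1 ℕ.≤ x) × (x ℕ.≤ r) → ¬ pos m ∣ pos x + pos (q ℕ.* m)
    small (suc x) (_ , x≤r) d = ℕ.>⇒∤ (ℕ.≤-<-trans x≤r (m%n<n n m))
      (∣⇒∣ᵤ (∣m+n∣n⇒∣m {m = pos (suc x)} {pos (q ℕ.* m)} d (∣ᵤ⇒∣ (ℕ.n∣m*n q))))
    remainder : ∑ᵣ r (λ x → 𝟙 m (x + pos (q ℕ.* m))) ≡ 0ℤ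
    remainder = ℤ.≤-antisym
      (ℤ.≤-trans (∑-mono-∈ (resid r) λ x∈ → ℤ.≤-reflexive (𝟙-no (small _ (∈resid⇒bounds x∈)))) (ℤ.≤-reflexive (∑-0 (resid r))))
      (∑-nonneg (resid r) λ x → 0≤𝟙 m _)

  nonzeroUpTo : ℕ → List ℤ
  nonzeroUpTo N = map pos (resid N) ++ map (-_ ∘ pos) (resid N)

  vectorsUpTo : ∀ s → ℕ → List (Vec ℤ s)
  vectorsUpTo zero    N = [] ∷ []
  vectorsUpTo (suc s) N = cartesianProductWith _∷_ (nonzeroUpTo N) (vectorsUpTo s N)

  ∈-nonzeroUpTo : ∀ {N} a → a ≢ 0ℤ → ∣ a ∣ ℕ.≤ N → a ∈ nonzeroUpTo N
  ∈-nonzeroUpTo         (pos zero)    a≢0 _   = contradiction refl a≢0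
  ∈-nonzeroUpTo         (pos (suc n)) a≢0 n<N = ∈-++⁺ˡ (∈-map⁺ pos (suc∈resid n<N))
  ∈-nonzeroUpTo {N} -[1+ n ]      a≢0 n<N = ∈-++⁺ʳ (map pos (resid N)) (∈-map⁺ (-_ ∘ pos) (suc∈resid n<N))

  ∈-vectorsUpTo : ∀ {s N} (a : Vec ℤ s) → All (_≢ 0ℤ) a → maxNorm a ℕ.≤ N → a ∈ vectorsUpTo s N
  ∈-vectorsUpTo []       []           _  = here refl
  ∈-vectorsUpTo (a ∷ as) (a≢0 ∷ as≢0) le = ∈-cartesianProductWith⁺ _∷_
    (∈-nonzeroUpTo a a≢0 (ℕ.m⊔n≤o⇒m≤o ∣ a ∣ (maxNorm as) le)) (∈-vectorsUpTo as as≢0 (ℕ.m⊔n≤o⇒n≤o ∣ a ∣ (maxNorm as) le))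

  -- With 0 excluded there is no additive error term, so the bound remains strong for moduli beyond
  -- `N`, such as `t * t`.
  nonzero-multiples≤ : ∀ m .{{_ : NonZero m}} N → pos m * ∑ (nonzeroUpTo N) (𝟙 m) ≤ pos (2 ℕ.* N)
  nonzero-multiples≤ m N = begin
    pos m * ∑ (nonzeroUpTo N) (𝟙 m)
      ≡⟨ cong (pos m *_) (trans (∑-++ (map pos (resid N)) _ (𝟙 m)) (cong₂ _+_ (∑-map pos (resid N) (𝟙 m))
           (trans (∑-map (-_ ∘ pos) (resid N) (𝟙 m)) (∑-cong (resid N) λ x → 𝟙-cong
             (λ d → subst (pos m ∣_) (ℤ.neg-involutive (pos x)) (∣m⇒∣-m d)) ∣m⇒∣-m)))) ⟩
    pos m * (∑ᵣ N (𝟙 m) + ∑ᵣ N (𝟙 m))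
      ≡⟨ ℤ.*-distribˡ-+ (pos m) (∑ᵣ N (𝟙 m)) (∑ᵣ N (𝟙 m)) ⟩
    pos m * ∑ᵣ N (𝟙 m) + pos m * ∑ᵣ N (𝟙 m)
      ≤⟨ ℤ.+-mono-≤ (multiples≤ m N) (multiples≤ m N) ⟩
    pos (N ℕ.+ N)
      ≡⟨ cong (λ n → pos (N ℕ.+ n)) (sym (ℕ.+-identityʳ N)) ⟩
    pos (2 ℕ.* N) ∎
    where open ℤ.≤-Reasoning

  hits : ∀ {s} → ℕ → Vec ℤ s → ℤ
  hits t []       = 0ℤ
  hits t (a ∷ as) = 𝟙 t a + hits t as

  -- The number of entries divisible by `t²` plus the number of pairs of entries both divisible by
  -- `t`. Each of these events has density at most `1/t²` among the vectors.
  imbalance : ∀ {s} → ℕ → Vec ℤ s → ℤ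
  imbalance t []       = 0ℤ
  imbalance t (a ∷ as) = (𝟙 (t ℕ.* t) a + 𝟙 t a * hits t as) + imbalance t as

  0≤+ : ∀ {a b} → 0ℤ ≤ a → 0ℤ ≤ b → 0ℤ ≤ a + b
  0≤+ = ℤ.+-mono-≤

  0≤hits : ∀ {s} t (a : Vec ℤ s) → 0ℤ ≤ hits t a
  0≤hits t []       = ℤ.≤-refl
  0≤hits t (a ∷ as) = 0≤+ (0≤𝟙 t a) (0≤hits t as)

  0≤imbalance : ∀ {s} t (a : Vec ℤ s) → 0ℤ ≤ imbalance t a
  0≤imbalance t []       = ℤ.≤-refl
  0≤imbalance t (a ∷ as) = 0≤+ (0≤+ (0≤𝟙 (t ℕ.* t) a) (0≤* (0≤𝟙 t a) (0≤hits t as))) (0≤imbalance t as)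

  private
    ≤-left : ∀ {a b c} → 0ℤ ≤ b → a + b ≤ c → a ≤ c
    ≤-left {a} {b} 0≤b le = ℤ.≤-trans (subst (_≤ a + b) (ℤ.+-identityʳ a) (ℤ.+-monoʳ-≤ a 0≤b)) le

    ≤-right : ∀ {a b c} → 0ℤ ≤ a → a + b ≤ c → b ≤ c
    ≤-right {a} {b} 0≤a le = ℤ.≤-trans (subst (_≤ a + b) (ℤ.+-identityˡ b) (ℤ.+-monoˡ-≤ b 0≤a)) le

    1≰0 : ¬ 1ℤ ≤ 0ℤ
    1≰0 (+≤+ ())

  -- A violation is witnessed by some `t > T` dividing a non-zero entry, hence with `t ≤ N`: a
  -- number whose square divides the entry, or the gcd itself.
  balanced : ∀ {s N T} (a : Vec ℤ s) → All (_≢ 0ℤ) a → maxNorm a ℕ.≤ N →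
    (∀ t → T ℕ.< t → t ℕ.≤ N → imbalance t a ≤ 0ℤ) → Balanced T a
  balanced []       _            _  _  = tt
  balanced {N = N} {T} (a ∷ as) (a≢0 ∷ as≢0) le no-imbalance =
    square , others as (λ t T<t t≤N d → ≤-right (0≤𝟙 (t ℕ.* t) a)
        (≤-left {b = imbalance t as} (0≤imbalance t as) (no-imbalance t T<t t≤N))) ,
    balanced as as≢0 (ℕ.m⊔n≤o⇒n≤o ∣ a ∣ (maxNorm as) le)
      λ t T<t t≤N → ≤-right (0≤+ (0≤𝟙 (t ℕ.* t) a) (0≤* (0≤𝟙 t a) (0≤hits t as))) (no-imbalance t T<t t≤N)
    where
    instance
      ∣a∣≢0 : NonZero ∣ a ∣
      ∣a∣≢0 = ℕ.≢-nonZero λ eq → a≢0 (ℤ.∣i∣≡0⇒i≡0 eq)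
    ∣a∣≤N : ∣ a ∣ ℕ.≤ N
    ∣a∣≤N = ℕ.m⊔n≤o⇒m≤o ∣ a ∣ (maxNorm as) le
    square : ∀ t → t ℕ.* t ℕ.∣ ∣ a ∣ → t ℕ.≤ T
    square t d = ℕ.≮⇒≥ λ T<t → 1≰0 (subst (_≤ 0ℤ) (𝟙-yes (∣ᵤ⇒∣ d))
      (≤-left (0≤* (0≤𝟙 t a) (0≤hits t as)) (≤-left {b = imbalance t as} (0≤imbalance t as)
        (no-imbalance t T<t (ℕ.≤-trans (ℕ.∣⇒≤ (ℕ.∣-trans (ℕ.m∣m*n t) d)) ∣a∣≤N)))))
    others : ∀ {s} (bs : Vec ℤ s) →
      (∀ t → T ℕ.< t → t ℕ.≤ N → t ℕ.∣ ∣ a ∣ → 𝟙 t a * hits t bs ≤ 0ℤ) → All (λ b → gcd ∣ a ∣ ∣ b ∣ ℕ.≤ T) bs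
    others []       _ = []
    others (b ∷ bs) no-hits = ℕ.≮⇒≥ (λ T<g → 1≰0 (subst (_≤ 0ℤ)
        (𝟙-yes (∣ᵤ⇒∣ (gcd[m,n]∣n ∣ a ∣ ∣ b ∣)))
        (≤-left (0≤hits g bs) (subst (_≤ 0ℤ) (trans (cong (_* hits g (b ∷ bs)) (𝟙-yes (∣ᵤ⇒∣ (gcd[m,n]∣m ∣ a ∣ ∣ b ∣)))) (ℤ.*-identityˡ _))
          (no-hits g T<g (ℕ.≤-trans (ℕ.∣⇒≤ (gcd[m,n]∣m ∣ a ∣ ∣ b ∣)) ∣a∣≤N) (gcd[m,n]∣m ∣ a ∣ ∣ b ∣))))))
      ∷ others bs (λ t T<t t≤N d → ≤-right (0≤* (0≤𝟙 t a) (0≤𝟙 t b))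
          (subst (_≤ 0ℤ) (ℤ.*-distribˡ-+ (𝟙 t a) (𝟙 t b) (hits t bs)) (no-hits t T<t t≤N d)))
      where
      g : ℕ
      g = gcd ∣ a ∣ ∣ b ∣

  -- Equal to `s (s + 1) / 2`: the `s` entries and the `s (s - 1) / 2` pairs.
  imbalanceConstant : ℕ → ℕ
  imbalanceConstant zero    = 0
  imbalanceConstant (suc s) = suc s ℕ.+ imbalanceConstant s

  module _ (N : ℕ) where

    private
      A : ℤ
      A = pos (2 ℕ.* N)

      ∑-1 : ∑ (nonzeroUpTo N) (λ _ → 1ℤ) ≡ A
      ∑-1 = trans (∑-++ (map pos (resid N)) _ (λ _ → 1ℤ)) (trans (cong₂ _+_
        (trans (∑-map pos (resid N) (λ _ → 1ℤ)) (trans (∑ᵣ-const N 1ℤ) (ℤ.*-identityʳ (pos N))))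
        (trans (∑-map (-_ ∘ pos) (resid N) (λ _ → 1ℤ)) (trans (∑ᵣ-const N 1ℤ) (ℤ.*-identityʳ (pos N)))))
        (cong (λ n → pos (N ℕ.+ n)) (sym (ℕ.+-identityʳ N))))

      decompose : ∀ {s} (f : ℤ → ℤ) (g : Vec ℤ s → ℤ) → ∑ (nonzeroUpTo N) (λ a → ∑ (vectorsUpTo s N) (λ as → f a * g as)) ≡
        ∑ (nonzeroUpTo N) f * ∑ (vectorsUpTo s N) g
      decompose {s} f g = sym (∑-*-∑ (nonzeroUpTo N) (vectorsUpTo s N) f g)

      size : ℕ → ℤ
      size s = pos ((2 ℕ.* N) ℕ.^ s)

      size-suc : ∀ s → A * size s ≡ size (suc s)
      size-suc s = sym (ℤ.pos-* (2 ℕ.* N) ((2 ℕ.* N) ℕ.^ s))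

    ∑-vectors-1 : ∀ s → ∑ (vectorsUpTo s N) (λ _ → 1ℤ) ≡ size s
    ∑-vectors-1 zero    = refl
    ∑-vectors-1 (suc s) = trans (∑-product _∷_ (nonzeroUpTo N) (vectorsUpTo s N) _)
      (trans (decompose {s} (λ _ → 1ℤ) (λ _ → 1ℤ)) (trans (cong₂ _*_ ∑-1 (∑-vectors-1 s)) (size-suc s)))

    module _ (t : ℕ) .{{_ : NonZero t}} where

      private
        ∑-hits : ∀ s → pos t * ∑ (vectorsUpTo s N) (hits t) ≤ pos s * size s
        ∑-hits zero    = ℤ.≤-reflexive (ℤ.*-zeroʳ (pos t))
        ∑-hits (suc s) = begin
          pos t * ∑ (vectorsUpTo (suc s) N) (hits t)
            ≡⟨ cong (pos t *_) (trans (∑-product _∷_ (nonzeroUpTo N) (vectorsUpTo s N) (hits t))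
                 (trans (∑-cong (nonzeroUpTo N) λ a → trans (∑-cong (vectorsUpTo s N) λ as →
                     cong₂ _+_ (sym (ℤ.*-identityʳ (𝟙 t a))) (sym (ℤ.*-identityˡ (hits t as))))
                   (∑-+ (vectorsUpTo s N) _ _))
                 (trans (∑-+ (nonzeroUpTo N) _ _) (cong₂ _+_ (decompose {s} (𝟙 t) (λ _ → 1ℤ)) (decompose {s} (λ _ → 1ℤ) (hits t)))))) ⟩
          pos t * (I * ∑ (vectorsUpTo s N) (λ _ → 1ℤ) + ∑ (nonzeroUpTo N) (λ _ → 1ℤ) * H)
            ≡⟨ cong₂ (λ x y → pos t * (I * x + y * H)) (∑-vectors-1 s) ∑-1 ⟩
          pos t * (I * size s + A * H)
            ≡⟨ rearrange (pos t) I (size s) A H ⟩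
          pos t * I * size s + A * (pos t * H)
            ≤⟨ ℤ.+-mono-≤ (*-monoʳ (size s) 0≤pos (nonzero-multiples≤ t N)) (*-monoˡ A 0≤pos (∑-hits s)) ⟩
          A * size s + A * (pos s * size s)
            ≡⟨ rearrange′ A (pos s) (size s) ⟩
          pos (suc s) * (A * size s)
            ≡⟨ cong (pos (suc s) *_) (size-suc s) ⟩
          pos (suc s) * size (suc s) ∎
          where
          open ℤ.≤-Reasoning
          I H : ℤ
          I = ∑ (nonzeroUpTo N) (𝟙 t)
          H = ∑ (vectorsUpTo s N) (hits t)
          rearrange : ∀ t I S A H → t * (I * S + A * H) ≡ t * I * S + A * (t * H)
          rearrange = solve-∀
          rearrange′ : ∀ A s S → A * S + A * (s * S) ≡ (1ℤ + s) * (A * S)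
          rearrange′ = solve-∀

      ∑-imbalance : ∀ s → pos (t ℕ.* t) * ∑ (vectorsUpTo s N) (imbalance t) ≤ pos (imbalanceConstant s) * size s
      ∑-imbalance zero    = ℤ.≤-reflexive (ℤ.*-zeroʳ (pos (t ℕ.* t)))
      ∑-imbalance (suc s) = begin
        pos (t ℕ.* t) * ∑ (vectorsUpTo (suc s) N) (imbalance t)
          ≡⟨ cong (pos (t ℕ.* t) *_) (trans (∑-product _∷_ (nonzeroUpTo N) (vectorsUpTo s N) (imbalance t))
               (trans (∑-cong (nonzeroUpTo N) λ a → trans (∑-cong (vectorsUpTo s N) λ as →
                   cong₂ (λ x y → (x + 𝟙 t a * hits t as) + y) (sym (ℤ.*-identityʳ (𝟙 (t ℕ.* t) a))) (sym (ℤ.*-identityˡ (imbalance t as))))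
                 (trans (∑-+ (vectorsUpTo s N) _ _) (cong (_+ ∑ (vectorsUpTo s N) (λ as → 1ℤ * imbalance t as)) (∑-+ (vectorsUpTo s N) _ _))))
               (trans (∑-+ (nonzeroUpTo N) _ _) (cong₂ _+_
                 (trans (∑-+ (nonzeroUpTo N) _ _) (cong₂ _+_ (decompose {s} (𝟙 (t ℕ.* t)) (λ _ → 1ℤ)) (decompose {s} (𝟙 t) (hits t))))
                 (decompose {s} (λ _ → 1ℤ) (imbalance t)))))) ⟩
        pos (t ℕ.* t) * (J * ∑ (vectorsUpTo s N) (λ _ → 1ℤ) + I * H + ∑ (nonzeroUpTo N) (λ _ → 1ℤ) * W)
          ≡⟨ cong₂ (λ x y → pos (t ℕ.* t) * (J * x + I * H + y * W)) (∑-vectors-1 s) ∑-1 ⟩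
        pos (t ℕ.* t) * (J * size s + I * H + A * W)
          ≡⟨ rearrange (pos (t ℕ.* t)) J (size s) I H A W ⟩
        pos (t ℕ.* t) * J * size s + pos (t ℕ.* t) * (I * H) + A * (pos (t ℕ.* t) * W)
          ≡⟨ cong (λ x → pos (t ℕ.* t) * J * size s + x + A * (pos (t ℕ.* t) * W))
               (trans (cong (_* (I * H)) (ℤ.pos-* t t)) (rearrange″ (pos t) I H)) ⟩
        pos (t ℕ.* t) * J * size s + pos t * I * (pos t * H) + A * (pos (t ℕ.* t) * W)
          ≤⟨ ℤ.+-mono-≤ (ℤ.+-mono-≤ (*-monoʳ (size s) 0≤pos (nonzero-multiples≤ (t ℕ.* t) {{ℕ.m*n≢0 t t}} N))
               (ℤ.≤-trans (*-monoʳ (pos t * H) (0≤* {pos t} 0≤pos (∑-nonneg (vectorsUpTo s N) (0≤hits t))) (nonzero-multiples≤ t N))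
                          (*-monoˡ A 0≤pos (∑-hits s))))
               (*-monoˡ A 0≤pos (∑-imbalance s)) ⟩
        A * size s + A * (pos s * size s) + A * (pos c * size s)
          ≡⟨ rearrange′ A (pos s) (pos c) (size s) ⟩
        pos (imbalanceConstant (suc s)) * (A * size s)
          ≡⟨ cong (pos (imbalanceConstant (suc s)) *_) (size-suc s) ⟩
        pos (imbalanceConstant (suc s)) * size (suc s) ∎
        where
        open ℤ.≤-Reasoning
        c : ℕ
        c = imbalanceConstant s
        I J H W : ℤ
        I = ∑ (nonzeroUpTo N) (𝟙 t)
        J = ∑ (nonzeroUpTo N) (𝟙 (t ℕ.* t))
        H = ∑ (vectorsUpTo s N) (hits t)
        W = ∑ (vectorsUpTo s N) (imbalance t)
        rearrange : ∀ T J S I H A W → T * (J * S + I * H + A * W) ≡ T * J * S + T * (I * H) + A * (T * W)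
        rearrange = solve-∀
        rearrange″ : ∀ t I H → t * t * (I * H) ≡ t * I * (t * H)
        rearrange″ = solve-∀
        rearrange′ : ∀ A s c S → A * S + A * (s * S) + A * (c * S) ≡ ((1ℤ + s) + c) * (A * S)
        rearrange′ = solve-∀

  private
    -- The sum of `1/t²` over `T < t ≤ T + n` is at most `1/T - 1/(T+n) = n / (T (T+n))`, with
    -- denominators cleared.
    telescoping : ∀ T .{{_ : NonZero T}} (M : ℕ) (Z : ℕ → ℤ) → (∀ t .{{_ : NonZero t}} → pos (t ℕ.* t) * Z t ≤ pos M) →
      ∀ n → pos (T ℕ.* (T ℕ.+ n)) * ∑ (resid n) (λ i → Z (T ℕ.+ i)) ≤ pos (n ℕ.* M)
    telescoping T M Z Z≤ zero    = ℤ.≤-reflexive (ℤ.*-zeroʳ (pos (T ℕ.* (T ℕ.+ 0))))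
    telescoping T M Z Z≤ (suc n) = ℤ.*-cancelˡ-≤-pos _ _ (pos m) {{positive (+<+ 0<m)}} (begin
      pos m * (pos (T ℕ.* (T ℕ.+ suc n)) * ∑ (resid (suc n)) (λ i → Z (T ℕ.+ i)))
        ≡⟨ cong₂ (λ x y → pos m * (x * y)) (trans (cong (λ l → pos (T ℕ.* l)) (ℕ.+-suc T n)) (ℤ.pos-* T (suc m)))
             (trans (∑ᵣ-suc n (λ x → Z (T ℕ.+ ∣ x ∣))) (cong (λ l → Σn + Z l) (ℕ.+-suc T n))) ⟩
      pos m * (pos T * (1ℤ + pos m) * (Σn + Z (suc m)))
        ≡⟨ rearrange (pos T) (pos m) Σn (Z (suc m)) ⟩
      (1ℤ + pos m) * (pos T * pos m * Σn) + pos T * (pos m * (1ℤ + pos m) * Z (suc m))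
        ≤⟨ ℤ.+-mono-≤
             (*-monoˡ (pos (suc m)) 0≤pos (subst (λ x → x * Σn ≤ pos (n ℕ.* M)) (ℤ.pos-* T m) (telescoping T M Z Z≤ n)))
             (*-monoˡ (pos T) 0≤pos last) ⟩
      pos (suc m) * pos (n ℕ.* M) + pos T * pos M
        ≡⟨ cong₂ (λ x y → x * y + pos T * pos M) (cong (1ℤ +_) (ℤ.pos-+ T n)) (ℤ.pos-* n M) ⟩
      (1ℤ + (pos T + pos n)) * (pos n * pos M) + pos T * pos M
        ≡⟨ rearrange′ (pos T) (pos n) (pos M) ⟩
      (pos T + pos n) * ((1ℤ + pos n) * pos M)
        ≡⟨ cong₂ _*_ (sym (ℤ.pos-+ T n)) (sym (ℤ.pos-* (suc n) M)) ⟩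
      pos m * pos (suc n ℕ.* M) ∎)
      where
      open ℤ.≤-Reasoning
      m : ℕ
      m = T ℕ.+ n
      Σn : ℤ
      Σn = ∑ (resid n) (λ i → Z (T ℕ.+ i))
      0<m : 0 ℕ.< m
      0<m = ℕ.<-≤-trans (ℕ.>-nonZero⁻¹ T) (ℕ.m≤m+n T n)
      -- `m (m + 1)` is at most `(m + 1)²`; a negative `Z (suc m)` would reverse this comparison and
      -- is treated separately.
      last : pos m * (1ℤ + pos m) * Z (suc m) ≤ pos M
      last with ℤ.≤-total 0ℤ (Z (suc m))
      ... | inj₁ 0≤Z = ℤ.≤-trans
        (*-monoʳ (Z (suc m)) 0≤Z (ℤ.≤-trans (ℤ.≤-reflexive (sym (ℤ.pos-* m (suc m)))) (+≤+ (ℕ.*-monoˡ-≤ (suc m) (ℕ.n≤1+n m)))))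
        (Z≤ (suc m))
      ... | inj₂ Z≤0 = ℤ.≤-trans (subst (pos m * (1ℤ + pos m) * Z (suc m) ≤_) (ℤ.*-zeroʳ (pos m * (1ℤ + pos m)))
        (*-monoˡ (pos m * (1ℤ + pos m)) (0≤* {pos m} {pos (suc m)} 0≤pos 0≤pos) Z≤0)) 0≤pos
      rearrange : ∀ T m S Z → m * (T * (1ℤ + m) * (S + Z)) ≡ (1ℤ + m) * (T * m * S) + T * (m * (1ℤ + m) * Z)
      rearrange = solve-∀
      rearrange′ : ∀ T n M → (1ℤ + (T + n)) * (n * M) + T * M ≡ (T + n) * ((1ℤ + n) * M)
      rearrange′ = solve-∀

  -- A first moment bound: each unbalanced vector has total imbalance at least 1 over `T < t ≤ N`,
  -- and the tail of the sum of `1/t²` gives the factor `1/T`.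
  unbalanced-few : ∀ s N T .{{_ : NonZero T}} (as : List (Vec ℤ s)) → Unique as →
    (∀ {a} → a ∈ as → All (_≢ 0ℤ) a × (maxNorm a ℕ.≤ N) × ¬ Balanced T a) →
    T ℕ.* length as ℕ.≤ imbalanceConstant s ℕ.* (2 ℕ.* N) ℕ.^ s
  unbalanced-few s N T as unique unbalanced = ℤ.drop‿+≤+ (begin
    pos (T ℕ.* length as)
      ≡⟨ trans (ℤ.pos-* T (length as)) (cong (pos T *_) (sym (trans (∑-const as 1ℤ) (ℤ.*-identityʳ _)))) ⟩
    pos T * ∑ as (λ _ → 1ℤ)
      ≤⟨ *-monoˡ (pos T) 0≤pos (ℤ.≤-trans (∑-mono-∈ as heavy) (∑-unique-⊆ 0≤total unique member)) ⟩
    pos T * ∑ (vectorsUpTo s N) total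
      ≡⟨ cong (pos T *_) (∑-swap (vectorsUpTo s N) (resid n) _) ⟩
    pos T * ∑ (resid n) (λ i → Z (T ℕ.+ i))
      ≤⟨ ℤ.*-cancelˡ-≤-pos _ _ (pos (T ℕ.+ n)) {{positive (+<+ (ℕ.<-≤-trans (ℕ.>-nonZero⁻¹ T) (ℕ.m≤m+n T n)))}} scaled ⟩
    pos M ∎)
    where
    open ℤ.≤-Reasoning
    n M : ℕ
    n = N ℕ.∸ T
    M = imbalanceConstant s ℕ.* (2 ℕ.* N) ℕ.^ s
    Z : ℕ → ℤ
    Z t = ∑ (vectorsUpTo s N) (imbalance t)
    total : Vec ℤ s → ℤ
    total a = ∑ (resid n) (λ i → imbalance (T ℕ.+ i) a)
    0≤total : ∀ a → 0ℤ ≤ total a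
    0≤total a = ∑-nonneg (resid n) λ i → 0≤imbalance (T ℕ.+ i) a
    member : ∀ {a} → a ∈ as → a ∈ vectorsUpTo s N
    member {a} a∈ with unbalanced a∈
    ... | a≢0 , le , _ = ∈-vectorsUpTo a a≢0 le
    heavy : ∀ {a} → a ∈ as → 1ℤ ≤ total a
    heavy {a} a∈ with unbalanced a∈
    ... | a≢0 , le , ¬bal = ℤ.i<j⇒suc[i]≤j (ℤ.≰⇒> λ total≤0 → ¬bal (balanced a a≢0 le λ t T<t t≤N → subst (λ t → imbalance t a ≤ 0ℤ)
        (ℕ.m+[n∸m]≡n (ℕ.<⇒≤ T<t)) (ℤ.≤-trans (∈⇒≤∑ (λ i → 0≤imbalance (T ℕ.+ i) a) (in-range T<t t≤N)) total≤0)))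
      where
      in-range : ∀ {t} → T ℕ.< t → t ℕ.≤ N → t ℕ.∸ T ∈ resid n
      in-range {t} T<t t≤N = subst (_∈ resid n) (ℕ.suc-pred (t ℕ.∸ T) {{ℕ.>-nonZero (ℕ.m<n⇒0<n∸m T<t)}})
        (suc∈resid (subst (ℕ._≤ n) (sym (ℕ.suc-pred (t ℕ.∸ T) {{ℕ.>-nonZero (ℕ.m<n⇒0<n∸m T<t)}})) (ℕ.∸-monoˡ-≤ T t≤N)))
    scaled : pos (T ℕ.+ n) * (pos T * ∑ (resid n) (λ i → Z (T ℕ.+ i))) ≤ pos (T ℕ.+ n) * pos M
    scaled = begin
      pos (T ℕ.+ n) * (pos T * ∑ (resid n) (λ i → Z (T ℕ.+ i)))
        ≡⟨ trans (sym (ℤ.*-assoc (pos (T ℕ.+ n)) (pos T) _)) (cong (_* ∑ (resid n) (λ i → Z (T ℕ.+ i)))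
             (trans (ℤ.*-comm (pos (T ℕ.+ n)) (pos T)) (sym (ℤ.pos-* T (T ℕ.+ n))))) ⟩
      pos (T ℕ.* (T ℕ.+ n)) * ∑ (resid n) (λ i → Z (T ℕ.+ i))
        ≤⟨ telescoping T M Z (λ t → ℤ.≤-trans (∑-imbalance N t s) (ℤ.≤-reflexive (sym (ℤ.pos-* (imbalanceConstant s) ((2 ℕ.* N) ℕ.^ s))))) n ⟩
      pos (n ℕ.* M)
        ≤⟨ +≤+ (ℕ.*-monoˡ-≤ M (ℕ.m≤n+m n T)) ⟩
      pos ((T ℕ.+ n) ℕ.* M)
        ≡⟨ ℤ.pos-* (T ℕ.+ n) M ⟩
      pos (T ℕ.+ n) * pos M ∎

  vectors-few : ∀ s N (as : List (Vec ℤ s)) → Unique as → (∀ {a} → a ∈ as → All (_≢ 0ℤ) a × (maxNorm a ℕ.≤ N)) →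
    length as ℕ.≤ (2 ℕ.* N) ℕ.^ s
  vectors-few s N as unique bounded = ℤ.drop‿+≤+ (subst₂ _≤_ (trans (∑-const as 1ℤ) (ℤ.*-identityʳ _)) (∑-vectors-1 N s)
    (∑-unique-⊆ (λ _ → +≤+ z≤n) unique member))
    where
    member : ∀ {a} → a ∈ as → a ∈ vectorsUpTo s N
    member {a} a∈ with bounded a∈
    ... | a≢0 , le = ∈-vectorsUpTo a a≢0 le

-- Rational arithmetic and bounds for normalised counts

module Rationals where

  open GoodPrimes using (^ℕ-distrib-*)
  open import Defs using (solutionCount; normalisedCount)
  open import Data.Integer as ℤ using (ℤ) renaming (+_ to pos)
  open import Data.Rational using (ℚ; 0ℚ; 1ℚ; _+_; _*_; _-_; -_; _≤_; _<_; _/_; toℚᵘ; positive; nonNegative)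
  open import Data.Rational.Properties
  import Data.Rational.Unnormalised as ℚᵘ
  import Data.Rational.Unnormalised.Properties as ℚᵘ
  open import Tactic.RingSolver using (solve-∀)
  open import Tactic.RingSolver.Core.AlmostCommutativeRing using (AlmostCommutativeRing; fromCommutativeRing)

  ℚ-ring : AlmostCommutativeRing 0ℓ 0ℓ
  ℚ-ring = fromCommutativeRing +-*-commutativeRing λ x → dec⇒maybe (0ℚ ≟ x)

  *-monoˡ : ∀ {a b} c → 0ℚ ≤ c → a ≤ b → c * a ≤ c * b
  *-monoˡ c 0≤c = *-monoˡ-≤-nonNeg c {{nonNegative 0≤c}}

  *-monoʳ : ∀ {a b} c → 0ℚ ≤ c → a ≤ b → a * c ≤ b * c
  *-monoʳ c 0≤c = *-monoʳ-≤-nonNeg c {{nonNegative 0≤c}}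

  *-mono : ∀ {a b c d} → 0ℚ ≤ a → 0ℚ ≤ d → a ≤ b → c ≤ d → a * c ≤ b * d
  *-mono {a} {d = d} 0≤a 0≤d a≤b c≤d = ≤-trans (*-monoˡ a 0≤a c≤d) (*-monoʳ d 0≤d a≤b)

  0≤* : ∀ {a b} → 0ℚ ≤ a → 0ℚ ≤ b → 0ℚ ≤ a * b
  0≤* {a} {b} 0≤a 0≤b = subst (_≤ a * b) (*-zeroʳ a) (*-monoˡ a 0≤a 0≤b)

  0<* : ∀ {a b} → 0ℚ < a → 0ℚ < b → 0ℚ < a * b
  0<* {a} {b} 0<a 0<b = subst (_< a * b) (*-zeroʳ a) (*-monoʳ-<-pos a {{positive 0<a}} 0<b)

  0≤1 : 0ℚ ≤ 1ℚ
  0≤1 = nonNegative⁻¹ 1ℚ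

  ≤-from-0≤ : ∀ {a b} → 0ℚ ≤ b - a → a ≤ b
  ≤-from-0≤ {a} {b} 0≤ = subst₂ _≤_ (+-identityˡ a) (lemma a b) (+-monoˡ-≤ a 0≤)
    where
    lemma : ∀ a b → b - a + a ≡ b
    lemma = solve-∀ ℚ-ring

  0≤-from-≤ : ∀ {a b} → a ≤ b → 0ℚ ≤ b - a
  0≤-from-≤ {a} {b} a≤b = subst (_≤ b - a) (+-inverseʳ a) (+-monoˡ-≤ (- a) a≤b)

  opaque

    ι : ℤ → ℚ
    ι i = i / 1

  private
    toℚᵘ-/ : ∀ i d .{{_ : NonZero d}} → toℚᵘ (i / d) ℚᵘ.≃ i ℚᵘ./ d
    toℚᵘ-/ i (suc d) = toℚᵘ-fromℚᵘ (ℚᵘ.mkℚᵘ i d)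

  opaque
    unfolding ι

    ι-def : ∀ i → ι i ≡ i / 1
    ι-def i = refl

    ι-+ : ∀ i j → ι (i ℤ.+ j) ≡ ι i + ι j
    ι-+ i j = toℚᵘ-injective (ℚᵘ.≃-trans (toℚᵘ-/ (i ℤ.+ j) 1) (ℚᵘ.≃-trans
      (ℚᵘ.*≡* (cong (ℤ._* pos 1) (cong₂ ℤ._+_ (sym (ℤ.*-identityʳ i)) (sym (ℤ.*-identityʳ j)))))
      (ℚᵘ.≃-sym (ℚᵘ.≃-trans (toℚᵘ-homo-+ (i / 1) (j / 1)) (ℚᵘ.+-cong (toℚᵘ-/ i 1) (toℚᵘ-/ j 1))))))

    ι-* : ∀ i j → ι (i ℤ.* j) ≡ ι i * ι j
    ι-* i j = toℚᵘ-injective (ℚᵘ.≃-trans (toℚᵘ-/ (i ℤ.* j) 1)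
      (ℚᵘ.≃-sym (ℚᵘ.≃-trans (toℚᵘ-homo-* (i / 1) (j / 1)) (ℚᵘ.*-cong (toℚᵘ-/ i 1) (toℚᵘ-/ j 1)))))

    ι-mono : ∀ {i j} → i ℤ.≤ j → ι i ≤ ι j
    ι-mono {i} {j} i≤j = toℚᵘ-cancel-≤ (ℚᵘ.≤-respˡ-≃ (ℚᵘ.≃-sym (toℚᵘ-/ i 1)) (ℚᵘ.≤-respʳ-≃ (ℚᵘ.≃-sym (toℚᵘ-/ j 1))
      (ℚᵘ.*≤* (ℤ.*-monoʳ-≤-nonNeg (pos 1) i≤j))))

    ι-cancel : ∀ {i j} → ι i ≤ ι j → i ℤ.≤ j
    ι-cancel {i} {j} le = subst₂ ℤ._≤_ (ℤ.*-identityʳ i) (ℤ.*-identityʳ j)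
      (ℚᵘ.drop-*≤* (ℚᵘ.≤-respˡ-≃ (toℚᵘ-/ i 1) (ℚᵘ.≤-respʳ-≃ (toℚᵘ-/ j 1) (toℚᵘ-mono-≤ le))))

    ι-1 : ι (pos 1) ≡ 1ℚ
    ι-1 = refl

    ι-0 : ι (pos 0) ≡ 0ℚ
    ι-0 = refl

    /-ι : ∀ i d .{{_ : NonZero d}} → (i / d) * ι (pos d) ≡ ι i
    /-ι i d@(suc _) = toℚᵘ-injective (ℚᵘ.≃-trans (ℚᵘ.≃-trans (toℚᵘ-homo-* (i / d) (pos d / 1)) (ℚᵘ.*-cong (toℚᵘ-/ i d) (toℚᵘ-/ (pos d) 1)))
      (ℚᵘ.≃-trans (ℚᵘ.*≡* (trans (ℤ.*-identityʳ (i ℤ.* pos d)) (cong (λ n → i ℤ.* pos n) (sym (ℕ.*-identityʳ d)))))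
        (ℚᵘ.≃-sym (toℚᵘ-/ i 1))))

  ι-neg : ∀ i → ι (ℤ.- i) ≡ - ι i
  ι-neg i = trans (lemma (ι (ℤ.- i)) (ι i)) (trans (cong (_- ι i) (trans (sym (ι-+ (ℤ.- i) i)) (trans (cong ι (ℤ.+-inverseˡ i)) ι-0)))
    (+-identityˡ (- ι i)))
    where
    lemma : ∀ a b → a ≡ a + b - b
    lemma = solve-∀ ℚ-ring

  0≤ι : ∀ n → 0ℚ ≤ ι (pos n)
  0≤ι n = subst (_≤ ι (pos n)) ι-0 (ι-mono (ℤ.+≤+ z≤n))

  0<ι : ∀ n .{{_ : NonZero n}} → 0ℚ < ι (pos n)
  0<ι n@(suc _) = ≰⇒> λ le → ℕ.n≮0 (ℤ.drop‿+≤+ (ι-cancel {pos n} {pos 0} (subst (ι (pos n) ≤_) (sym ι-0) le)))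

  ≤-/ : ∀ {q i} d .{{_ : NonZero d}} → q * ι (pos d) ≤ ι i → q ≤ i / d
  ≤-/ {q} {i} d le = *-cancelʳ-≤-pos (ι (pos d)) {{positive (0<ι d)}} (subst (q * ι (pos d) ≤_) (sym (/-ι i d)) le)

  /-≤ : ∀ {q i} d .{{_ : NonZero d}} → ι i ≤ q * ι (pos d) → i / d ≤ q
  /-≤ {q} {i} d le = *-cancelʳ-≤-pos (ι (pos d)) {{positive (0<ι d)}} (subst (_≤ q * ι (pos d)) (sym (/-ι i d)) le)

  opaque

    inv : (n : ℕ) .{{_ : NonZero n}} → ℚ
    inv n = pos 1 / n

  opaque
    unfolding inv

    inv-def : ∀ n .{{_ : NonZero n}} → inv n ≡ pos 1 / n
    inv-def n = refl

    inv-ι : ∀ n .{{_ : NonZero n}} → inv n * ι (pos n) ≡ 1ℚ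
    inv-ι n = trans (/-ι (pos 1) n) ι-1

    inv≤ : ∀ {q} n .{{_ : NonZero n}} → 1ℚ ≤ q * ι (pos n) → inv n ≤ q
    inv≤ {q} n le = /-≤ n (subst (_≤ q * ι (pos n)) (sym ι-1) le)

  0<inv : ∀ n .{{_ : NonZero n}} → 0ℚ < inv n
  0<inv n = *-cancelʳ-<-nonNeg (ι (pos n)) {{nonNegative (0≤ι n)}}
    (subst₂ _<_ (sym (*-zeroˡ (ι (pos n)))) (sym (inv-ι n)) (positive⁻¹ 1ℚ))

  ι-inv-cancel : ∀ n .{{_ : NonZero n}} x → inv n * (ι (pos n) * x) ≡ x
  ι-inv-cancel n x = trans (sym (*-assoc (inv n) (ι (pos n)) x)) (trans (cong (_* x) (inv-ι n)) (*-identityˡ x))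

  inv-antimono : ∀ m n .{{_ : NonZero m}} .{{_ : NonZero n}} → m ℕ.≤ n → inv n ≤ inv m
  inv-antimono m n m≤n = inv≤ n (subst (_≤ inv m * ι (pos n)) (inv-ι m)
    (*-monoˡ (inv m) (<⇒≤ (0<inv m)) (ι-mono (ℤ.+≤+ m≤n))))

  module _ {s : ℕ} (k : ℕ) (a : Vec ℤ (suc s)) (p : ℕ) .{{_ : NonZero p}} where

    private
      count : ℕ → ℕ
      count h = solutionCount k a (p ℕ.^ h)

      denominator : ∀ h → p ℕ.^ (h ℕ.* suc s) ≡ p ℕ.^ h ℕ.* (p ℕ.^ h) ℕ.^ s
      denominator h = trans (cong (p ℕ.^_) (ℕ.*-suc h s))
        (trans (ℕ.^-distribˡ-+-* p h (h ℕ.* s)) (cong (p ℕ.^ h ℕ.*_) (sym (ℕ.^-*-assoc p h s))))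

    -- One factor `p^h` of the denominator cancels against the numerator, which leaves the count
    -- divided by `(p^h)^s` for `s + 1` variables.
    normalisedCount≥ : ∀ q h → q * ι (pos ((p ℕ.^ h) ℕ.^ s)) ≤ ι (pos (count h)) → q ≤ normalisedCount k a p h
    normalisedCount≥ q h le = ≤-/ (p ℕ.^ (h ℕ.* suc s)) {{ℕ.m^n≢0 p (h ℕ.* suc s)}} (subst₂ _≤_
      (trans (lemma (ι (pos (p ℕ.^ h))) q (ι (pos ((p ℕ.^ h) ℕ.^ s))))
        (cong (q *_) (trans (sym (ι-* (pos (p ℕ.^ h)) (pos ((p ℕ.^ h) ℕ.^ s))))
          (cong ι (trans (sym (ℤ.pos-* (p ℕ.^ h) _)) (cong pos (sym (denominator h))))))))
      (trans (sym (ι-* (pos (p ℕ.^ h)) (pos (count h)))) (cong ι (sym (ℤ.pos-* (p ℕ.^ h) (count h)))))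
      (*-monoˡ (ι (pos (p ℕ.^ h))) (0≤ι (p ℕ.^ h)) le))
      where
      lemma : ∀ P q E → P * (q * E) ≡ q * (P * E)
      lemma = solve-∀ ℚ-ring

    normalisedCount≤ : ∀ q h → ι (pos (count h)) ≤ q * ι (pos ((p ℕ.^ h) ℕ.^ s)) → normalisedCount k a p h ≤ q
    normalisedCount≤ q h le = /-≤ (p ℕ.^ (h ℕ.* suc s)) {{ℕ.m^n≢0 p (h ℕ.* suc s)}} (subst₂ _≤_
      (trans (sym (ι-* (pos (p ℕ.^ h)) (pos (count h)))) (cong ι (sym (ℤ.pos-* (p ℕ.^ h) (count h)))))
      (trans (lemma (ι (pos (p ℕ.^ h))) q (ι (pos ((p ℕ.^ h) ℕ.^ s))))
        (cong (q *_) (trans (sym (ι-* (pos (p ℕ.^ h)) (pos ((p ℕ.^ h) ℕ.^ s))))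
          (cong ι (trans (sym (ℤ.pos-* (p ℕ.^ h) _)) (cong pos (sym (denominator h))))))))
      (*-monoˡ (ι (pos (p ℕ.^ h))) (0≤ι (p ℕ.^ h)) le))
      where
      lemma : ∀ P q E → P * (q * E) ≡ q * (P * E)
      lemma = solve-∀ ℚ-ring

    0≤normalisedCount : ∀ h → 0ℚ ≤ normalisedCount k a p h
    0≤normalisedCount h = normalisedCount≥ 0ℚ h (subst (_≤ ι (pos (count h))) (sym (*-zeroˡ (ι (pos ((p ℕ.^ h) ℕ.^ s))))) (0≤ι (count h)))

    normalisedCount-good : ∀ u .{{_ : NonZero u}} c t →
      (pos u ℤ.- pos c) ℤ.* pos (p ℕ.^ s ℕ.* (p ℕ.^ t) ℕ.^ s) ℤ.≤ pos u ℤ.* pos (count (suc t)) →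
      1ℚ - ι (pos c) * inv u ≤ normalisedCount k a p (suc t)
    normalisedCount-good u c t le = normalisedCount≥ q (suc t) (*-cancelˡ-≤-pos (ι (pos u)) {{positive (0<ι u)}} (subst₂ _≤_
      (trans (ι-* (pos u ℤ.- pos c) (pos (p ℕ.^ s ℕ.* (p ℕ.^ t) ℕ.^ s))) (trans (cong₂ _*_
          (trans (ι-+ (pos u) (ℤ.- pos c)) (cong (ι (pos u) +_) (ι-neg (pos c))))
          (cong (λ n → ι (pos n)) (sym (^ℕ-distrib-* p (p ℕ.^ t) s))))
        (sym (trans (sym (*-assoc (ι (pos u)) q E)) (cong (_* E)
          (trans (expand (ι (pos u)) (ι (pos c)) (inv u)) (trans (cong (λ z → ι (pos u) - ι (pos c) * z) (inv-ι u))
            (cong (λ z → ι (pos u) - z) (*-identityʳ (ι (pos c)))))))))))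
      (ι-* (pos u) (pos (count (suc t)))) (ι-mono le)))
      where
      q E : ℚ
      q = 1ℚ - ι (pos c) * inv u
      E = ι (pos ((p ℕ.^ suc t) ℕ.^ s))
      expand : ∀ U c i → U * (1ℚ - c * i) ≡ U - c * (i * U)
      expand = solve-∀ ℚ-ring

    normalisedCount-soluble : ∀ m t → (p ℕ.^ t) ℕ.^ s ℕ.≤ count (t ℕ.+ m) →
      inv ((p ℕ.^ m) ℕ.^ s) {{ℕ.m^n≢0 (p ℕ.^ m) s {{ℕ.m^n≢0 p m}}}} ≤ normalisedCount k a p (t ℕ.+ m)
    normalisedCount-soluble m t le = normalisedCount≥ (inv Y) (t ℕ.+ m) (subst (_≤ ι (pos (count (t ℕ.+ m))))
      (sym (trans (cong (λ n → inv Y * ι (pos n)) modulus) (trans (cong (inv Y *_) (trans (cong ι (ℤ.pos-* Y _)) (ι-* (pos Y) _))) (ι-inv-cancel Y _))))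
      (ι-mono (ℤ.+≤+ le)))
      where
      Y : ℕ
      Y = (p ℕ.^ m) ℕ.^ s
      instance
        Y≢0 : NonZero Y
        Y≢0 = ℕ.m^n≢0 (p ℕ.^ m) s {{ℕ.m^n≢0 p m}}
      modulus : (p ℕ.^ (t ℕ.+ m)) ℕ.^ s ≡ Y ℕ.* (p ℕ.^ t) ℕ.^ s
      modulus = trans (cong (ℕ._^ s) (trans (ℕ.^-distribˡ-+-* p t m) (ℕ.*-comm (p ℕ.^ t) (p ℕ.^ m)))) (^ℕ-distrib-* (p ℕ.^ m) (p ℕ.^ t) s)

    -- The exponent of p in the count is at most (tk′ + m)(s + 1), against
    -- (t(k′ + 1) + m) s in the normalisation, and k′ < s.
    normalisedCount-insoluble : ∀ k′ m t → k′ ℕ.< s → count (t ℕ.* suc k′ ℕ.+ m) ℕ.≤ (p ℕ.^ (t ℕ.* k′ ℕ.+ m)) ℕ.^ suc s →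
      normalisedCount k a p (t ℕ.* suc k′ ℕ.+ m) ≤ ι (pos (p ℕ.^ m)) * inv (p ℕ.^ t) {{ℕ.m^n≢0 p t}}
    normalisedCount-insoluble k′ m t k′<s le = normalisedCount≤ q h (begin
      ι (pos (count h))
        ≤⟨ ι-mono (ℤ.+≤+ (ℕ.≤-trans le exponents)) ⟩
      ι (pos (p ℕ.^ (m ℕ.+ r)))
        ≡⟨ cong ι (trans (cong pos (ℕ.^-distribˡ-+-* p m r)) (ℤ.pos-* (p ℕ.^ m) (p ℕ.^ r))) ⟩
      ι (pos (p ℕ.^ m) ℤ.* pos (p ℕ.^ r))
        ≡⟨ ι-* (pos (p ℕ.^ m)) (pos (p ℕ.^ r)) ⟩
      ι (pos (p ℕ.^ m)) * ι (pos (p ℕ.^ r))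
        ≡⟨ cong (ι (pos (p ℕ.^ m)) *_) (sym (ι-inv-cancel (p ℕ.^ t) (ι (pos (p ℕ.^ r))))) ⟩
      ι (pos (p ℕ.^ m)) * (inv (p ℕ.^ t) * (ι (pos (p ℕ.^ t)) * ι (pos (p ℕ.^ r))))
        ≡⟨ sym (*-assoc (ι (pos (p ℕ.^ m))) (inv (p ℕ.^ t)) _) ⟩
      q * (ι (pos (p ℕ.^ t)) * ι (pos (p ℕ.^ r)))
        ≡⟨ cong (q *_) (trans (sym (ι-* (pos (p ℕ.^ t)) (pos (p ℕ.^ r)))) (cong ι (trans (sym (ℤ.pos-* (p ℕ.^ t) (p ℕ.^ r)))
             (cong pos (trans (sym (ℕ.^-distribˡ-+-* p t r)) (trans (cong (p ℕ.^_) (ℕ.m+[n∸m]≡n t≤hs)) (sym (ℕ.^-*-assoc p h s)))))))) ⟩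
      q * ι (pos ((p ℕ.^ h) ℕ.^ s)) ∎)
      where
      open ≤-Reasoning
      h r : ℕ
      h = t ℕ.* suc k′ ℕ.+ m
      r = h ℕ.* s ℕ.∸ t
      instance
        p^t≢0 : NonZero (p ℕ.^ t)
        p^t≢0 = ℕ.m^n≢0 p t
      q : ℚ
      q = ι (pos (p ℕ.^ m)) * inv (p ℕ.^ t)
      rearrange : ∀ t k′ m s → t ℕ.* (1 ℕ.+ k′) ℕ.* s ≡ t ℕ.* s ℕ.+ t ℕ.* k′ ℕ.* s
      rearrange = ℕ.solve-∀
      rearrange′ : ∀ t k′ m s → (t ℕ.* k′ ℕ.+ m) ℕ.* (1 ℕ.+ s) ℕ.+ t ≡ t ℕ.* (1 ℕ.+ k′) ℕ.+ (t ℕ.* k′ ℕ.* s ℕ.+ m ℕ.* s ℕ.+ m)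
      rearrange′ = ℕ.solve-∀
      rearrange″ : ∀ t k′ m s → t ℕ.* s ℕ.+ (t ℕ.* k′ ℕ.* s ℕ.+ m ℕ.* s ℕ.+ m) ≡ m ℕ.+ (t ℕ.* (1 ℕ.+ k′) ℕ.+ m) ℕ.* s
      rearrange″ = ℕ.solve-∀
      1≤s : 1 ℕ.≤ s
      1≤s = ℕ.≤-trans (s≤s z≤n) k′<s
      t≤hs : t ℕ.≤ h ℕ.* s
      t≤hs = ℕ.≤-trans (ℕ.≤-trans (ℕ.m≤m*n t (suc k′)) (ℕ.m≤m+n (t ℕ.* suc k′) m)) (ℕ.m≤m*n h s {{ℕ.>-nonZero 1≤s}})
      total : (t ℕ.* k′ ℕ.+ m) ℕ.* suc s ℕ.+ t ℕ.≤ m ℕ.+ h ℕ.* s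
      total = subst₂ ℕ._≤_ (sym (rearrange′ t k′ m s)) (rearrange″ t k′ m s)
        (ℕ.+-monoˡ-≤ (t ℕ.* k′ ℕ.* s ℕ.+ m ℕ.* s ℕ.+ m) (ℕ.*-monoʳ-≤ t k′<s))
      exponents : (p ℕ.^ (t ℕ.* k′ ℕ.+ m)) ℕ.^ suc s ℕ.≤ p ℕ.^ (m ℕ.+ r)
      exponents = subst (ℕ._≤ p ℕ.^ (m ℕ.+ r)) (sym (ℕ.^-*-assoc p (t ℕ.* k′ ℕ.+ m) (suc s)))
        (ℕ.^-monoʳ-≤ p (subst ((t ℕ.* k′ ℕ.+ m) ℕ.* suc s ℕ.≤_) (ℕ.+-∸-assoc m t≤hs) (ℕ.m+n≤o⇒m≤o∸n _ total)))

-- Tails of the sum of ⌊√n⌋^(-3)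

module InverseCubes where

  open Rationals
  open import Data.Integer as ℤ using (ℤ) renaming (+_ to pos)
  open import Data.List.Properties using (upTo-∷ʳ)
  open import Data.Rational using (ℚ; 0ℚ; 1ℚ; _+_; _*_; _-_; -_; _≤_; _<_)
  open import Data.Rational.Properties
  open import Tactic.RingSolver using (solve-∀)

  private
    advance : ∀ j r → Dec (r ℕ.< j ℕ.+ j) → ℕ × ℕ
    advance j r (yes _) = j , suc r
    advance j r (no _)  = suc j , 0

    next : ℕ × ℕ → ℕ × ℕ
    next (j , r) = advance j r (r ℕ.<? j ℕ.+ j)

  -- The pair `(j , r)` with `n = j² + r` and `r ≤ 2j`, advanced one integer at a time, so that a
  -- sum over `n` can be followed through the blocks of constant integer square root `j`.
  squareRoot : ℕ → ℕ × ℕ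
  squareRoot zero    = 0 , 0
  squareRoot (suc n) = next (squareRoot n)

  isqrt : ℕ → ℕ
  isqrt n = proj₁ (squareRoot n)

  isqrt-spec : ∀ n → let (j , r) = squareRoot n in (n ≡ j ℕ.* j ℕ.+ r) × (r ℕ.≤ j ℕ.+ j)
  isqrt-spec zero    = refl , z≤n
  isqrt-spec (suc n) = step (squareRoot n) (isqrt-spec n)
    where
    lemma : ∀ j → 1 ℕ.+ (j ℕ.* j ℕ.+ (j ℕ.+ j)) ≡ (1 ℕ.+ j) ℕ.* (1 ℕ.+ j) ℕ.+ 0
    lemma = ℕ.solve-∀
    step : ∀ ((j , r) : ℕ × ℕ) → (n ≡ j ℕ.* j ℕ.+ r) × (r ℕ.≤ j ℕ.+ j) →
      let (j′ , r′) = next (j , r) in (suc n ≡ j′ ℕ.* j′ ℕ.+ r′) × (r′ ℕ.≤ j′ ℕ.+ j′)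
    step (j , r) (n≡ , r≤2j) with r ℕ.<? j ℕ.+ j
    ... | yes r<2j = trans (cong suc n≡) (sym (ℕ.+-suc (j ℕ.* j) r)) , r<2j
    ... | no r≮2j  = trans (cong suc (trans n≡ (cong (j ℕ.* j ℕ.+_) (ℕ.≤-antisym r≤2j (ℕ.≮⇒≥ r≮2j))))) (lemma j) , z≤n

  isqrt²≤ : ∀ n → isqrt n ℕ.* isqrt n ℕ.≤ n
  isqrt²≤ n = subst (isqrt n ℕ.* isqrt n ℕ.≤_) (sym (proj₁ (isqrt-spec n))) (ℕ.m≤m+n (isqrt n ℕ.* isqrt n) _)

  ≤isqrt : ∀ {V n} → V ℕ.* V ℕ.≤ n → V ℕ.≤ isqrt n
  ≤isqrt {V} {n} V²≤n = ℕ.≮⇒≥ λ j<V → ℕ.<⇒≱ (ℕ.≤-<-trans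
    (subst (ℕ._≤ isqrt n ℕ.* isqrt n ℕ.+ (isqrt n ℕ.+ isqrt n)) (sym (proj₁ (isqrt-spec n))) (ℕ.+-monoʳ-≤ (isqrt n ℕ.* isqrt n) (proj₂ (isqrt-spec n))))
    (ℕ.≤-trans (ℕ.≤-reflexive (lemma (isqrt n))) (ℕ.*-mono-≤ j<V j<V))) V²≤n
    where
    lemma : ∀ j → 1 ℕ.+ (j ℕ.* j ℕ.+ (j ℕ.+ j)) ≡ (1 ℕ.+ j) ℕ.* (1 ℕ.+ j)
    lemma = ℕ.solve-∀

  inv-* : ∀ m n .{{_ : NonZero m}} .{{_ : NonZero n}} → inv (m ℕ.* n) {{ℕ.m*n≢0 m n}} ≡ inv m * inv n
  inv-* m n = sym (begin
    inv m * inv n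
      ≡⟨ sym (trans (cong (inv m * inv n *_) (trans (*-comm (ι (pos (m ℕ.* n))) (inv (m ℕ.* n))) (inv-ι (m ℕ.* n)))) (*-identityʳ _)) ⟩
    inv m * inv n * (ι (pos (m ℕ.* n)) * inv (m ℕ.* n))
      ≡⟨ cong (λ z → inv m * inv n * (z * inv (m ℕ.* n))) (trans (cong ι (ℤ.pos-* m n)) (ι-* (pos m) (pos n))) ⟩
    inv m * inv n * (ι (pos m) * ι (pos n) * inv (m ℕ.* n))
      ≡⟨ lemma (inv m) (inv n) (ι (pos m)) (ι (pos n)) (inv (m ℕ.* n)) ⟩
    inv m * ι (pos m) * (inv n * ι (pos n)) * inv (m ℕ.* n)
      ≡⟨ trans (cong (_* inv (m ℕ.* n)) (cong₂ _*_ (inv-ι m) (inv-ι n))) (trans (cong (_* inv (m ℕ.* n)) (*-identityˡ 1ℚ)) (*-identityˡ (inv (m ℕ.* n)))) ⟩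
    inv (m ℕ.* n) ∎)
    where
    open ≡-Reasoning
    instance
      mn≢0 : NonZero (m ℕ.* n)
      mn≢0 = ℕ.m*n≢0 m n
    lemma : ∀ a b c d e → a * b * (c * d * e) ≡ a * c * (b * d) * e
    lemma = solve-∀ ℚ-ring

  cubeInverse : ℕ → ℚ
  cubeInverse zero    = 0ℚ
  cubeInverse (suc j) = inv (suc j) * inv (suc j) * inv (suc j)

  0≤cubeInverse : ∀ j → 0ℚ ≤ cubeInverse j
  0≤cubeInverse zero    = ≤-refl
  0≤cubeInverse (suc j) = 0≤* (0≤* 0≤α 0≤α) 0≤α
    where
    0≤α : 0ℚ ≤ inv (suc j)
    0≤α = <⇒≤ (0<inv (suc j))

  cubeInverse≡ : ∀ u .{{_ : NonZero u}} → cubeInverse u ≡ inv (u ℕ.* u ℕ.* u) {{ℕ.m*n≢0 (u ℕ.* u) u {{ℕ.m*n≢0 u u}}}}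
  cubeInverse≡ u@(suc _) = sym (trans (inv-* (u ℕ.* u) u) (cong (_* inv u) (inv-* u u)))

  3ℚ : ℚ
  3ℚ = 1ℚ + 1ℚ + 1ℚ

  -- 1/j − 1/(j+1) is at least the square of 1/(j+1).
  block≤ : ∀ j .{{_ : NonZero j}} →
    3ℚ * inv (suc j) + ι (pos (suc (suc j ℕ.+ suc j))) * cubeInverse (suc j) ≤ 3ℚ * inv j
  block≤ j = begin
    -- The block with integer square root `j + 1` has `2 (j + 1) + 1` elements, which contribute at
    -- most `3 / (j + 1)²` together.
    3ℚ * α + ι (pos (suc (suc j ℕ.+ suc j))) * (α * α * α)
      ≡⟨ cong (λ z → 3ℚ * α + z * (α * α * α)) (trans (ι-+ (pos 1) (pos (suc j ℕ.+ suc j))) (cong₂ _+_ ι-1 (ι-+ (pos (suc j)) (pos (suc j))))) ⟩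
    3ℚ * α + (1ℚ + (J + J)) * (α * α * α)
      ≡⟨ expand α J ⟩
    3ℚ * α + (α * α * α + (α * J) * (α * α) + (α * J) * (α * α))
      ≡⟨ cong (λ z → 3ℚ * α + (α * α * α + z * (α * α) + z * (α * α))) (inv-ι (suc j)) ⟩
    3ℚ * α + (α * α * α + 1ℚ * (α * α) + 1ℚ * (α * α))
      ≤⟨ +-monoʳ-≤ (3ℚ * α) (+-mono-≤ (+-mono-≤ (≤-trans (*-monoˡ (α * α) 0≤α² α≤1) (≤-reflexive (trans (*-identityʳ (α * α)) (sym (*-identityˡ (α * α))))))
           ≤-refl) ≤-refl) ⟩
    3ℚ * α + (1ℚ * (α * α) + 1ℚ * (α * α) + 1ℚ * (α * α))
      ≡⟨ cong (3ℚ * α +_) (collect (α * α)) ⟩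
    3ℚ * α + 3ℚ * (α * α)
      ≤⟨ +-monoʳ-≤ (3ℚ * α) (*-monoˡ 3ℚ (nonNegative⁻¹ 3ℚ) (*-monoˡ α 0≤α α≤β)) ⟩
    3ℚ * α + 3ℚ * (α * β)
      ≡⟨ cong (λ z → 3ℚ * α + 3ℚ * z) (sym difference) ⟩
    3ℚ * α + 3ℚ * (β - α)
      ≡⟨ collect′ 3ℚ α β ⟩
    3ℚ * β ∎
    where
    open ≤-Reasoning
    α β J B : ℚ
    α = inv (suc j)
    β = inv j
    J = ι (pos (suc j))
    B = ι (pos j)
    0≤α : 0ℚ ≤ α
    0≤α = <⇒≤ (0<inv (suc j))
    0≤α² : 0ℚ ≤ α * α
    0≤α² = 0≤* 0≤α 0≤α
    α≤1 : α ≤ 1ℚ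
    α≤1 = inv≤ (suc j) (subst₂ _≤_ ι-1 (sym (*-identityˡ J)) (ι-mono (ℤ.+≤+ (s≤s z≤n))))
    α≤β : α ≤ β
    α≤β = inv-antimono j (suc j) (ℕ.n≤1+n j)
    difference : β - α ≡ α * β
    difference = trans (cong₂ _-_ (trans (sym (*-identityˡ β)) (cong (_* β) (sym (inv-ι (suc j))))) (trans (sym (*-identityʳ α)) (cong (α *_) (sym (inv-ι j)))))
      (trans (cong (λ z → α * z * β - α * (β * B)) (trans (ι-+ (pos 1) (pos j)) (cong (_+ B) ι-1))) (lemma α β B))
      where
      lemma : ∀ α β B → α * (1ℚ + B) * β - α * (β * B) ≡ α * β
      lemma = solve-∀ ℚ-ring
    expand : ∀ α J → 3ℚ * α + (1ℚ + (J + J)) * (α * α * α) ≡ 3ℚ * α + (α * α * α + (α * J) * (α * α) + (α * J) * (α * α))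
    expand α J = cong (3ℚ * α +_) (expand′ α J)
      where
      expand′ : ∀ α J → (1ℚ + (J + J)) * (α * α * α) ≡ α * α * α + (α * J) * (α * α) + (α * J) * (α * α)
      expand′ = solve-∀ ℚ-ring
    collect : ∀ x → 1ℚ * x + 1ℚ * x + 1ℚ * x ≡ 3ℚ * x
    collect x = sym (trans (*-distribʳ-+ x (1ℚ + 1ℚ) 1ℚ) (cong (_+ 1ℚ * x) (*-distribʳ-+ x 1ℚ 1ℚ)))
    collect′ : ∀ t α β → t * α + t * (β - α) ≡ t * β
    collect′ = solve-∀ ℚ-ring

  sumℚ : List ℕ → (ℕ → ℚ) → ℚ
  sumℚ []       f = 0ℚ
  sumℚ (x ∷ xs) f = f x + sumℚ xs f

  0≤sumℚ : ∀ xs {f} → (∀ x → 0ℚ ≤ f x) → 0ℚ ≤ sumℚ xs f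
  0≤sumℚ []       0≤f = ≤-refl
  0≤sumℚ (x ∷ xs) 0≤f = +-mono-≤ (0≤f x) (0≤sumℚ xs 0≤f)

  sumℚ-filter≤ : ∀ {P : Pred ℕ 0ℓ} (P? : Decidable P) xs {f} → (∀ x → 0ℚ ≤ f x) → sumℚ (filter P? xs) f ≤ sumℚ xs f
  sumℚ-filter≤ P? []       0≤f = ≤-refl
  sumℚ-filter≤ P? (x ∷ xs) {f} 0≤f with P? x
  ... | yes _ = +-monoʳ-≤ (f x) (sumℚ-filter≤ P? xs 0≤f)
  ... | no _  = subst (_≤ f x + sumℚ xs f) (+-identityˡ _) (+-mono-≤ (0≤f x) (sumℚ-filter≤ P? xs 0≤f))

  sumℚ-*ˡ : ∀ c xs f → sumℚ xs (λ x → c * f x) ≡ c * sumℚ xs f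
  sumℚ-*ˡ c []       f = sym (*-zeroʳ c)
  sumℚ-*ˡ c (x ∷ xs) f = trans (cong (c * f x +_) (sumℚ-*ˡ c xs f)) (sym (*-distribˡ-+ c (f x) (sumℚ xs f)))

  sumℚ-upTo-suc : ∀ n f → sumℚ (upTo (suc n)) f ≡ sumℚ (upTo n) f + f n
  sumℚ-upTo-suc n f = trans (cong (λ l → sumℚ l f) (sym (upTo-∷ʳ n))) (snoc (upTo n))
    where
    snoc : ∀ xs → sumℚ (xs ++ n ∷ []) f ≡ sumℚ xs f + f n
    snoc []       = +-comm (f n) 0ℚ
    snoc (x ∷ xs) = trans (cong (f x +_) (snoc xs)) (sym (+-assoc (f x) _ (f n)))

  -- `⌊√n⌋^(-3)` is a rational stand-in for `n^(-3/2)`. It is summed over all integers, and the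
  -- cut-off `V` makes the total as small as required.
  tail : ℕ → ℕ → ℚ
  tail V n with V ℕ.≤? isqrt n
  ... | yes _ = cubeInverse (isqrt n)
  ... | no _  = 0ℚ

  0≤tail : ∀ V n → 0ℚ ≤ tail V n
  0≤tail V n with V ℕ.≤? isqrt n
  ... | yes _ = 0≤cubeInverse (isqrt n)
  ... | no _  = ≤-refl

  tail-≥ : ∀ V n → V ℕ.≤ isqrt n → tail V n ≡ cubeInverse (isqrt n)
  tail-≥ V n V≤ with V ℕ.≤? isqrt n
  ... | yes _ = refl
  ... | no V≰ = contradiction V≤ V≰

  module _ (W : ℕ) where

    private
      V : ℕ
      V = suc (suc W)

      -- S is the sum of the tail over all n below j² + r.
      State : ℚ → ℕ × ℕ → Set
      State S (j , r) = (j ℕ.≤ suc W × S ≡ 0ℚ) ⊎ ∃ λ d → (j ≡ suc (suc (W ℕ.+ d))) ×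
        (S + 3ℚ * inv (suc (W ℕ.+ d)) ≤ 3ℚ * inv (suc W) + ι (pos r) * cubeInverse j)

      -- The terms of a block up to any point cost at most `3/(j-1) - 3/j`, the telescoping bound
      -- for the whole block.
      r-terms : ∀ {r} d → let j = suc (suc (W ℕ.+ d)) in r ℕ.≤ j ℕ.+ j →
        ι (pos r) * cubeInverse j + cubeInverse j + 3ℚ * inv j ≤ 3ℚ * inv (suc (W ℕ.+ d))
      r-terms {r} d r≤ = ≤-trans (≤-trans (+-monoˡ-≤ (3ℚ * inv j) (≤-trans (+-monoˡ-≤ (cubeInverse j) (*-monoʳ (cubeInverse j)
          (0≤cubeInverse j) (ι-mono (ℤ.+≤+ r≤)))) (≤-reflexive (trans (lemma (ι (pos (j ℕ.+ j))) (cubeInverse j))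
            (cong (_* cubeInverse j) (sym (trans (ι-+ (pos 1) (pos (j ℕ.+ j))) (cong (_+ ι (pos (j ℕ.+ j))) ι-1))))))))
        (≤-reflexive (+-comm (ι (pos (suc (j ℕ.+ j))) * cubeInverse j) (3ℚ * inv j)))) (block≤ (suc (W ℕ.+ d)))
        where
        j : ℕ
        j = suc (suc (W ℕ.+ d))
        lemma : ∀ x c → x * c + c ≡ (1ℚ + x) * c
        lemma = solve-∀ ℚ-ring

      step : ∀ S t ((j , r) : ℕ × ℕ) → r ℕ.≤ j ℕ.+ j → (j ℕ.≤ suc W → t ≡ 0ℚ) → (suc W ℕ.< j → t ≡ cubeInverse j) →
        State S (j , r) → State (S + t) (next (j , r))
      step S t (j , r) r≤2j small large (inj₁ (j≤ , refl)) with r ℕ.<? j ℕ.+ j | small j≤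
      ... | yes _ | refl = inj₁ (j≤ , refl)
      ... | no _  | refl with ℕ.m≤n⇒m<n∨m≡n j≤
      ...   | inj₁ j<   = inj₁ (j< , refl)
      -- The square root reaches the cut-off: the first block counted begins, with the sum still 0.
      ...   | inj₂ refl = inj₂ (0 , cong (λ w → suc (suc w)) (sym (ℕ.+-identityʳ W)) ,
        ≤-reflexive (trans (+-identityˡ _) (trans (cong (λ w → 3ℚ * inv (suc w)) (ℕ.+-identityʳ W))
          (sym (trans (cong (λ z → 3ℚ * inv (suc W) + z * cubeInverse (suc (suc W))) ι-0)
            (trans (cong (3ℚ * inv (suc W) +_) (*-zeroˡ (cubeInverse (suc (suc W))))) (+-identityʳ _)))))))
      step S t (j , r) r≤2j small large (inj₂ (d , refl , le)) with r ℕ.<? j ℕ.+ j | large (s≤s (s≤s (ℕ.m≤m+n W d)))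
      ... | yes _ | refl = inj₂ (d , refl , subst₂ _≤_ (lemma S (cubeInverse j) (3ℚ * inv (suc (W ℕ.+ d))))
        (trans (lemma′ (3ℚ * inv (suc W)) (ι (pos r)) (cubeInverse j))
          (cong (λ z → 3ℚ * inv (suc W) + z * cubeInverse j) (sym (trans (ι-+ (pos 1) (pos r)) (cong (_+ ι (pos r)) ι-1)))))
        (+-monoˡ-≤ (cubeInverse j) le))
        where
        lemma : ∀ S c z → S + z + c ≡ S + c + z
        lemma = solve-∀ ℚ-ring
        lemma′ : ∀ a r c → a + r * c + c ≡ a + (1ℚ + r) * c
        lemma′ = solve-∀ ℚ-ring
      ... | no _ | refl = inj₂ (suc d , cong (λ w → suc (suc w)) (sym (ℕ.+-suc W d)) , ≤-from-0≤ (begin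
          0ℚ
            ≤⟨ +-mono-≤ (0≤-from-≤ le) (0≤-from-≤ (r-terms d r≤2j)) ⟩
          3ℚ * inv (suc W) + ι (pos r) * c - (S + 3ℚ * inv (suc (W ℕ.+ d))) + (3ℚ * inv (suc (W ℕ.+ d)) - (ι (pos r) * c + c + 3ℚ * inv j))
            ≡⟨ lemma (3ℚ * inv (suc W)) (ι (pos r) * c) S (3ℚ * inv (suc (W ℕ.+ d))) c (3ℚ * inv j) ⟩
          3ℚ * inv (suc W) - (S + c + 3ℚ * inv j)
            ≡⟨ cong₂ (λ y z → y - (S + c + 3ℚ * z)) (sym (trans (cong (λ z → 3ℚ * inv (suc W) + z * cubeInverse (suc j)) ι-0)
                 (trans (cong (3ℚ * inv (suc W) +_) (*-zeroˡ (cubeInverse (suc j)))) (+-identityʳ (3ℚ * inv (suc W)))))) (cong (λ w → inv (suc w)) (sym (ℕ.+-suc W d))) ⟩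
          3ℚ * inv (suc W) + ι (pos 0) * cubeInverse (suc j) - (S + c + 3ℚ * inv (suc (W ℕ.+ suc d))) ∎))
        where
        open ≤-Reasoning
        c : ℚ
        c = cubeInverse j
        lemma : ∀ w rc S i c k → w + rc - (S + i) + (i - (rc + c + k)) ≡ w - (S + c + k)
        lemma = solve-∀ ℚ-ring

      state : ∀ n → State (sumℚ (upTo n) (tail V)) (squareRoot n)
      state zero    = inj₁ (z≤n , refl)
      state (suc n) = subst (λ S → State S (squareRoot (suc n))) (sym (sumℚ-upTo-suc n (tail V)))
        (step (sumℚ (upTo n) (tail V)) (tail V n) (squareRoot n) (proj₂ (isqrt-spec n)) small (tail-≥ V n) (state n))
        where
        small : isqrt n ℕ.≤ suc W → tail V n ≡ 0ℚ
        small j≤ with V ℕ.≤? isqrt n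
        ... | yes V≤ = contradiction (ℕ.≤-trans V≤ j≤) ℕ.1+n≰n
        ... | no _   = refl

    tail-sum≤ : ∀ n → sumℚ (upTo n) (tail (suc (suc W))) ≤ 3ℚ * inv (suc W)
    tail-sum≤ n = bound (squareRoot n) (proj₂ (isqrt-spec n)) (state n)
      where
      S : ℚ
      S = sumℚ (upTo n) (tail V)
      bound : ∀ ((j , r) : ℕ × ℕ) → r ℕ.≤ j ℕ.+ j → State S (j , r) → S ≤ 3ℚ * inv (suc W)
      bound (j , r) r≤2j (inj₁ (_ , S≡0)) = subst (_≤ 3ℚ * inv (suc W)) (sym S≡0) (0≤* (nonNegative⁻¹ 3ℚ) (<⇒≤ (0<inv (suc W))))
      bound (j , r) r≤2j (inj₂ (d , refl , le)) = ≤-from-0≤ (subst (0ℚ ≤_)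
        (lemma (3ℚ * inv (suc W)) (ι (pos r) * c) S (3ℚ * inv (suc (W ℕ.+ d))) c (3ℚ * inv j))
        (+-mono-≤ (+-mono-≤ (0≤-from-≤ le) (0≤-from-≤ (r-terms d r≤2j)))
          (+-mono-≤ (0≤cubeInverse j) (0≤* (nonNegative⁻¹ 3ℚ) (<⇒≤ (0<inv j))))))
        where
        c : ℚ
        c = cubeInverse j
        lemma : ∀ w rc S i c k → w + rc - (S + i) + (i - (rc + c + k)) + (c + k) ≡ w - S
        lemma = solve-∀ ℚ-ring

-- Cauchy reals: lower bounds, limits and vanishing factors

module RealNumbers where

  open Rationals
  import Defs as R
  open import Defs using (ℝ; seq; cauchy; fromℚ; 0ℝ; 1ℝ; ConvergesTo)
  open import Data.Integer as ℤ using (ℤ) renaming (+_ to pos)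
  open import Data.Rational using (ℚ; mkℚ; 0ℚ; 1ℚ; ½; _+_; _*_; _-_; -_; _≤_; _<_; ∣_∣; ↥_; ↧ₙ_; positive; Positive)
  open import Data.Rational.Properties
  open import Tactic.RingSolver using (solve-∀)

  0<½* : ∀ {ε} → 0ℚ < ε → 0ℚ < ½ * ε
  0<½* = 0<* (positive⁻¹ ½)

  halves : ∀ ε → ½ * ε + ½ * ε ≡ ε
  halves ε = trans (sym (*-distribʳ-+ ε ½ ½)) (*-identityˡ ε)

  p≤∣p∣ : ∀ p → p ≤ ∣ p ∣
  p≤∣p∣ p with ≤-total 0ℚ p
  ... | inj₁ 0≤p = ≤-reflexive (sym (0≤p⇒∣p∣≡p 0≤p))
  ... | inj₂ p≤0 = ≤-trans p≤0 (0≤∣p∣ p)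

  ≤-natural : ∀ q → ∃ λ n → q ≤ ι (pos n)
  ≤-natural q = ℤ.∣ ↥ q ∣ , subst (_≤ ι (pos ℤ.∣ ↥ q ∣)) (↥p/↧p≡p q) (/-≤ (↧ₙ q)
    (≤-trans (ι-mono (≤-∣∣* (↥ q) (↧ₙ q))) (≤-reflexive (trans (cong ι (ℤ.pos-* ℤ.∣ ↥ q ∣ (↧ₙ q))) (ι-* (pos ℤ.∣ ↥ q ∣) (pos (↧ₙ q)))))))
    where
    ≤-∣∣* : ∀ i n .{{_ : NonZero n}} → i ℤ.≤ pos (ℤ.∣ i ∣ ℕ.* n)
    ≤-∣∣* (pos m)    n = ℤ.+≤+ (ℕ.m≤m*n m n)
    ≤-∣∣* ℤ.-[1+ m ] n = ℤ.-≤+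

  archimedean : ∀ {δ} → 0ℚ < δ → ∃ λ n → inv (suc n) ≤ δ
  archimedean {δ} 0<δ = natural δ (positive 0<δ)
    where
    natural : ∀ δ → Positive δ → ∃ λ n → inv (suc n) ≤ δ
    natural δ@(mkℚ (pos (suc m)) d _) _ = d , inv≤ (suc d) (subst₂ _≤_ ι-1
      (trans (sym (/-ι (pos (suc m)) (suc d))) (cong (_* ι (pos (suc d))) (↥p/↧p≡p δ)))
      (ι-mono (ℤ.+≤+ (s≤s z≤n))))

  infix 4 _↘_

  -- Unlike fromℚ q ≤ x, this is preserved by products of lower bounds with no loss.
  _↘_ : ℝ → ℚ → Set
  x ↘ q = ∃ λ N → ∀ n → N ℕ.≤ n → q ≤ seq x n

  -- Equality with 0 as a real number.
  Null : ℝ → Set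
  Null x = ∀ ε → 0ℚ < ε → ∃ λ N → ∀ n → N ℕ.≤ n → ∣ seq x n ∣ ≤ ε

  ↘-weaken : ∀ {x q r} → r ≤ q → x ↘ q → x ↘ r
  ↘-weaken r≤q (N , above) = N , λ n N≤n → ≤-trans r≤q (above n N≤n)

  ↘-* : ∀ {x y q r} → 0ℚ ≤ q → 0ℚ ≤ r → x ↘ q → y ↘ r → (x R.* y) ↘ (q * r)
  ↘-* {x} {y} 0≤q 0≤r (M , above) (N , above′) = M ℕ.⊔ N , λ n le →
    let q≤x = above n (ℕ.m⊔n≤o⇒m≤o M N le)
        r≤y = above′ n (ℕ.m⊔n≤o⇒n≤o M N le)
    in *-mono 0≤q (≤-trans 0≤r r≤y) q≤x r≤y

  limit-↘ : ∀ {u : ℕ → ℝ} {l ε c} n → u n R.< l R.+ fromℚ ε → u n ↘ c → l ↘ (c - ε)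
  limit-↘ {u} {l} {ε} {c} n (δ , 0<δ , M , below) (N , above) = M ℕ.⊔ N , λ i le → ≤-from-0≤ (subst (0ℚ ≤_)
    (lemma (seq l i) ε δ (seq (u n) i) c)
    (+-mono-≤ (+-mono-≤ (0≤-from-≤ (below i (ℕ.m⊔n≤o⇒m≤o M N le))) (0≤-from-≤ (above i (ℕ.m⊔n≤o⇒n≤o M N le)))) (<⇒≤ 0<δ)))
    where
    lemma : ∀ l ε δ u c → (l + ε - (u + δ)) + (u - c) + δ ≡ l - (c - ε)
    lemma = solve-∀ ℚ-ring

  fromℚ-pos : ∀ {ε} → 0ℚ < ε → 0ℝ R.< fromℚ ε
  fromℚ-pos {ε} 0<ε = ε , 0<ε , 0 , λ _ _ → ≤-reflexive (+-identityˡ ε)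

  ∣∣≤ : ∀ {x ε} → x ≤ ε → - ε ≤ x → ∣ x ∣ ≤ ε
  ∣∣≤ {x} {ε} x≤ε -ε≤x with ∣p∣≡p∨∣p∣≡-p x
  ... | inj₁ eq = subst (_≤ ε) (sym eq) x≤ε
  ... | inj₂ eq = subst₂ _≤_ (sym eq) (neg-involutive ε) (neg-antimono-≤ -ε≤x)
    where
    neg-involutive : ∀ ε → - (- ε) ≡ ε
    neg-involutive = solve-∀ ℚ-ring

  -- As the sequence is known to converge, small terms at arbitrarily late indices suffice; the
  -- estimates for insoluble primes hold along an arithmetic progression of exponents.
  limit-null : ∀ {u : ℕ → ℚ} {l} → ConvergesTo (λ n → fromℚ (u n)) l →
    (∀ ε → 0ℚ < ε → ∀ N → ∃ λ n → (N ℕ.≤ n) × (0ℚ ≤ u n) × (u n ≤ ε)) → Null l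
  limit-null {u} {l} converges small ε 0<ε with converges (fromℚ (½ * ε)) (fromℚ-pos (0<½* 0<ε))
  ... | N , close with small (½ * ε) (0<½* 0<ε) N
  ...   | n , N≤n , 0≤u , u≤ with close n N≤n
  ...     | (δ , 0<δ , M , below) , (δ′ , 0<δ′ , M′ , above) = M ℕ.⊔ M′ , λ i le → ∣∣≤
    (≤-from-0≤ (subst (0ℚ ≤_) (trans (lemma (u n) (seq l i) (½ * ε) δ) (cong (_- seq l i) (halves ε)))
      (+-mono-≤ (+-mono-≤ (0≤-from-≤ (below i (ℕ.m⊔n≤o⇒m≤o M M′ le))) (0≤-from-≤ u≤)) (<⇒≤ 0<δ))))
    (≤-from-0≤ (subst (0ℚ ≤_) (trans (lemma′ (u n) (seq l i) (½ * ε) δ′) (cong (λ z → seq l i - - z) (halves ε)))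
      (+-mono-≤ (+-mono-≤ (+-mono-≤ (0≤-from-≤ (above i (ℕ.m⊔n≤o⇒n≤o M M′ le))) 0≤u) (<⇒≤ 0<δ′)) (<⇒≤ (0<½* 0<ε)))))
    where
    lemma : ∀ u l e δ → (u - (l + - e + δ)) + (e - u) + δ ≡ e + e - l
    lemma = solve-∀ ℚ-ring
    lemma′ : ∀ u l e δ → (l + e - (u + δ)) + u + δ + e ≡ l - - (e + e)
    lemma′ = solve-∀ ℚ-ring

  bounded : ∀ x → ∃ λ K → ∃ λ N → ∀ n → N ℕ.≤ n → ∣ seq x n ∣ ≤ ι (pos (suc K))
  bounded x with cauchy x 1ℚ (positive⁻¹ 1ℚ)
  ... | N , close with ≤-natural ∣ seq x N ∣
  ...   | K , ≤K = K , N , λ n N≤n → begin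
      ∣ seq x n ∣                               ≡⟨ cong ∣_∣ (lemma (seq x n) (seq x N)) ⟩
      ∣ (seq x n - seq x N) + seq x N ∣         ≤⟨ ∣p+q∣≤∣p∣+∣q∣ (seq x n - seq x N) (seq x N) ⟩
      ∣ seq x n - seq x N ∣ + ∣ seq x N ∣       ≤⟨ +-mono-≤ (close n N N≤n ℕ.≤-refl) ≤K ⟩
      1ℚ + ι (pos K)                            ≡⟨ sym (trans (ι-+ (pos 1) (pos K)) (cong (_+ ι (pos K)) ι-1)) ⟩
      ι (pos (suc K))                           ∎
    where
    open ≤-Reasoning
    lemma : ∀ a b → a ≡ (a - b) + b
    lemma = solve-∀ ℚ-ring

  private
    null-product : ∀ x y → Null x → ∀ ε → 0ℚ < ε → ∃ λ N → ∀ n → N ℕ.≤ n → ∣ seq x n ∣ * ∣ seq y n ∣ ≤ ε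
    null-product x y null ε 0<ε = combine (bounded y)
      where
      combine : (∃ λ K → ∃ λ N → ∀ n → N ℕ.≤ n → ∣ seq y n ∣ ≤ ι (pos (suc K))) →
        ∃ λ N → ∀ n → N ℕ.≤ n → ∣ seq x n ∣ * ∣ seq y n ∣ ≤ ε
      combine (K , N , ≤K) = M ℕ.⊔ N , λ n le → ≤-trans
        (*-mono {∣ seq x n ∣} {δ} {∣ seq y n ∣} {ι (pos (suc K))} (0≤∣p∣ (seq x n)) (0≤ι (suc K)) (small n (ℕ.m⊔n≤o⇒m≤o M N le)) (≤K n (ℕ.m⊔n≤o⇒n≤o M N le)))
        (≤-reflexive (trans (*-assoc ε (inv (suc K)) (ι (pos (suc K)))) (trans (cong (ε *_) (inv-ι (suc K))) (*-identityʳ ε))))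
        where
        δ : ℚ
        δ = ε * inv (suc K)
        0<δ : 0ℚ < δ
        0<δ = 0<* {ε} {inv (suc K)} 0<ε (0<inv (suc K))
        M : ℕ
        M = proj₁ (null δ 0<δ)
        small : ∀ n → M ℕ.≤ n → ∣ seq x n ∣ ≤ δ
        small = proj₂ (null δ 0<δ)

  null-*ˡ : ∀ x y → Null x → Null (x R.* y)
  null-*ˡ x y null ε 0<ε = proj₁ (null-product x y null ε 0<ε) , λ n N≤n →
    ≤-trans (≤-reflexive (∣p*q∣≡∣p∣*∣q∣ (seq x n) (seq y n))) (proj₂ (null-product x y null ε 0<ε) n N≤n)

  null-*ʳ : ∀ x y → Null y → Null (x R.* y)
  null-*ʳ x y null ε 0<ε = proj₁ (null-product y x null ε 0<ε) , λ n N≤n →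
    ≤-trans (≤-reflexive (trans (∣p*q∣≡∣p∣*∣q∣ (seq x n) (seq y n)) (*-comm ∣ seq x n ∣ ∣ seq y n ∣)))
      (proj₂ (null-product y x null ε 0<ε) n N≤n)

  productℝ : List ℕ → (ℕ → ℝ) → ℝ
  productℝ ps χ = foldr (λ p r → χ p R.* r) 1ℝ ps

  productℚ : List ℕ → (ℕ → ℚ) → ℚ
  productℚ ps c = foldr (λ p r → c p * r) 1ℚ ps

  null-productℝ : ∀ {ps} (χ : ℕ → ℝ) {p} → p ∈ ps → Null (χ p) → Null (productℝ ps χ)
  null-productℝ {p ∷ ps} χ (here refl) null = null-*ˡ (χ p) (productℝ ps χ) null
  null-productℝ {q ∷ ps} χ (there p∈)  null = null-*ʳ (χ q) (productℝ ps χ) (null-productℝ {ps} χ p∈ null)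

  0≤productℚ : ∀ ps {c} → (∀ {p} → p ∈ ps → 0ℚ ≤ c p) → 0ℚ ≤ productℚ ps c
  0≤productℚ []       0≤c = 0≤1
  0≤productℚ (p ∷ ps) 0≤c = 0≤* (0≤c (here refl)) (0≤productℚ ps λ p∈ → 0≤c (there p∈))

  -- Each local lower bound is given under a double negation; for a finite product these can be
  -- collected into one.
  productℝ-↘ : ∀ ps (χ : ℕ → ℝ) {c} → (∀ {p} → p ∈ ps → 0ℚ ≤ c p) → (∀ {p} → p ∈ ps → ¬ ¬ χ p ↘ c p) →
    ¬ ¬ productℝ ps χ ↘ productℚ ps c
  productℝ-↘ []       χ 0≤c above fail = fail (0 , λ _ _ → ≤-reflexive refl)
  productℝ-↘ (p ∷ ps) χ 0≤c above fail = above (here refl) λ above₁ →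
    productℝ-↘ ps χ (λ p∈ → 0≤c (there p∈)) (λ p∈ → above (there p∈)) λ above₂ →
      fail (↘-* {χ p} {productℝ ps χ} (0≤c (here refl)) (0≤productℚ ps λ p∈ → 0≤c (there p∈)) above₁ above₂)

  limit-null⇒≯0 : ∀ {u : ℕ → ℝ} {l} → ConvergesTo u l → (∃ λ N → ∀ n → N ℕ.≤ n → Null (u n)) → ¬ 0ℝ R.< l
  limit-null⇒≯0 {u} {l} converges (N , null) (ε , 0<ε , M , positive-l) with converges (fromℚ (½ * ε)) (fromℚ-pos (0<½* 0<ε))
  ... | N′ , close with close (N ℕ.⊔ N′) (ℕ.m≤n⊔m N N′) | null (N ℕ.⊔ N′) (ℕ.m≤m⊔n N N′) (½ * (½ * ε)) (0<½* (0<½* 0<ε))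
  ...   | (δ , 0<δ , M₁ , below) , _ | M₂ , small = <-irrefl refl (<-≤-trans (0<½* (0<½* 0<ε)) (≤-from-0≤ (subst (0ℚ ≤_)
      (trans (lemma (seq l i) ε (seq (u n) i) (½ * ε) q δ)
        (trans (cong (λ z → q + ½ * ε - z) (sym (halves ε))) (trans (cong (λ z → q + z - (z + z)) (sym (halves (½ * ε)))) (lemma′ q))))
      (+-mono-≤ (+-mono-≤ (+-mono-≤ (0≤-from-≤ (positive-l i M≤i)) (0≤-from-≤ (below i M₁≤i)))
        (0≤-from-≤ (≤-trans (p≤∣p∣ (seq (u n) i)) (small i M₂≤i)))) (<⇒≤ 0<δ)))))
    where
    q : ℚ
    q = ½ * (½ * ε)
    n i : ℕ
    n = N ℕ.⊔ N′
    i = M ℕ.⊔ (M₁ ℕ.⊔ M₂)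
    M≤i : M ℕ.≤ i
    M≤i = ℕ.m≤m⊔n M (M₁ ℕ.⊔ M₂)
    M₁≤i : M₁ ℕ.≤ i
    M₁≤i = ℕ.≤-trans (ℕ.m≤m⊔n M₁ M₂) (ℕ.m≤n⊔m M (M₁ ℕ.⊔ M₂))
    M₂≤i : M₂ ℕ.≤ i
    M₂≤i = ℕ.≤-trans (ℕ.m≤n⊔m M₁ M₂) (ℕ.m≤n⊔m M (M₁ ℕ.⊔ M₂))
    lemma : ∀ l ε u h q δ → (l - (0ℚ + ε)) + (u - (l + - h + δ)) + (q - u) + δ ≡ q + h - ε
    lemma = solve-∀ ℚ-ring
    lemma′ : ∀ q → q + (q + q) - ((q + q) + (q + q)) ≡ 0ℚ - q
    lemma′ = solve-∀ ℚ-ring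

-- Lower bound for the singular series

module SingularSeries where

  open LocalSolutions using (weight; Soluble; solutionCount-soluble; solutionCount-insoluble; n<p^n)
  open GoodPrimes using (module GoodPrime)
  open BadPrimes
  open Rationals
  open InverseCubes
  open RealNumbers
  import Defs as R
  open import Defs using (ℝ; fromℚ; 0ℝ; ConvergesTo; IsLocalDensity; normalisedCount)
  open import Data.Integer as ℤ using (ℤ; 0ℤ) renaming (+_ to pos)
  open import Data.List.Membership.Propositional.Properties using (∈-filter⁺; ∈-upTo⁺)
  import Data.List.Relation.Unary.All as List
  import Data.List.Relation.Unary.All.Properties as List
  import Data.List.Relation.Unary.Unique.Propositional.Properties as Unique
  open import Data.Nat.Divisibility using (_∣_; _∣?_; ∣⇒≤)
  open import Data.Rational using (ℚ; 0ℚ; 1ℚ; ½; _+_; _*_; _-_; -_; _≤_; _<_; positive; nonNegative)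
  open import Data.Rational.Properties
  open import Tactic.RingSolver using (solve-∀)

  ι-mono-< : ∀ {m n} → m ℕ.< n → ι (pos m) < ι (pos n)
  ι-mono-< m<n = ≰⇒> λ le → ℕ.<⇒≱ m<n (ℤ.drop‿+≤+ (ι-cancel le))

  inv-anti-< : ∀ m n .{{_ : NonZero m}} .{{_ : NonZero n}} → m ℕ.< n → inv n < inv m
  inv-anti-< m n m<n = *-cancelʳ-<-nonNeg (ι (pos n)) {{nonNegative (0≤ι n)}}
    (subst (_< inv m * ι (pos n)) (trans (inv-ι m) (sym (inv-ι n))) (*-monoʳ-<-pos (inv m) {{positive (0<inv m)}} (ι-mono-< m<n)))

  -- A term that is at least `c` and within `c - c′` of the limit suffices, so the counts are wanted
  -- only at arbitrarily large `h`. This gap is why the constants at both kinds of primes have one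
  -- unit to spare.
  density-↘ : ∀ {u : ℕ → ℚ} {χ c c′} → ConvergesTo (λ h → fromℚ (u h)) χ →
    (∀ N → ∃ λ h → (N ℕ.≤ h) × (c ≤ u h)) → c′ < c → χ ↘ c′
  density-↘ {u} {χ} {c} {c′} converges large c′<c =
    subst (χ ↘_) (lemma c c′) (limit-↘ {λ h → fromℚ (u h)} {χ} {c - c′} {c} h (proj₂ (proj₂ limit h N≤h)) (0 , λ _ _ → c≤u))
    where
    lemma : ∀ c c′ → c - (c - c′) ≡ c′
    lemma = solve-∀ ℚ-ring
    0<gap : 0ℚ < c - c′
    0<gap = subst (_< c - c′) (+-inverseʳ c′) (+-monoˡ-< (- c′) c′<c)
    limit : ∃ λ N → ∀ h → N ℕ.≤ h → ((χ R.- fromℚ (c - c′)) R.< fromℚ (u h)) × (fromℚ (u h) R.< (χ R.+ fromℚ (c - c′)))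
    limit = converges (fromℚ (c - c′)) (fromℚ-pos 0<gap)
    N h : ℕ
    N = proj₁ limit
    h = proj₁ (large N)
    N≤h : N ℕ.≤ h
    N≤h = proj₁ (proj₂ (large N))
    c≤u : c ≤ u h
    c≤u = proj₂ (proj₂ (large N))

  -- inv, extended by the junk value 0 at 0.
  inv₀ : ℕ → ℚ
  inv₀ zero    = 0ℚ
  inv₀ (suc n) = inv (suc n)

  inv₀≡inv : ∀ n .{{_ : NonZero n}} → inv₀ n ≡ inv n
  inv₀≡inv (suc n) = refl

  0≤inv₀ : ∀ n → 0ℚ ≤ inv₀ n
  0≤inv₀ zero    = ≤-refl
  0≤inv₀ (suc n) = <⇒≤ (0<inv (suc n))

  -- Weierstrass's inequality for the product of the `1 - x p`. The multiplier `Y p` will be 1 at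
  -- good primes and offset the small density at bad ones, so that one product handles both kinds.
  productℚ-bound : ∀ ps {c x : ℕ → ℚ} {Y : ℕ → ℕ} → (∀ p → 0ℚ ≤ x p) →
    (∀ {p} → p ∈ ps → 1ℚ - x p ≤ c p * ι (pos (Y p))) → sumℚ ps x ≤ 1ℚ →
    1ℚ - sumℚ ps x ≤ productℚ ps c * ι (pos (∏ ps Y))
  productℚ-bound []       0≤x le sum≤1 = ≤-reflexive (sym (trans (*-identityˡ (ι (pos 1))) ι-1))
  productℚ-bound (p ∷ ps) {c} {x} {Y} 0≤x le sum≤1 = begin
    1ℚ - (x p + S)
      ≤⟨ ≤-from-0≤ (subst (0ℚ ≤_) (expand (x p) S) (0≤* {x p} {S} (0≤x p) 0≤S)) ⟩
    (1ℚ - x p) * (1ℚ - S)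
      ≤⟨ *-mono {1ℚ - x p} {c p * ι (pos (Y p))} {1ℚ - S} {productℚ ps c * ι (pos (∏ ps Y))}
           (0≤-from-≤ x≤1) (≤-trans (0≤-from-≤ S≤1) IH) (le (here refl)) IH ⟩
    c p * ι (pos (Y p)) * (productℚ ps c * ι (pos (∏ ps Y)))
      ≡⟨ rearrange (c p) (ι (pos (Y p))) (productℚ ps c) (ι (pos (∏ ps Y))) ⟩
    c p * productℚ ps c * (ι (pos (Y p)) * ι (pos (∏ ps Y)))
      ≡⟨ cong (c p * productℚ ps c *_) (trans (sym (ι-* (pos (Y p)) (pos (∏ ps Y)))) (cong ι (sym (ℤ.pos-* (Y p) (∏ ps Y))))) ⟩
    c p * productℚ ps c * ι (pos (Y p ℕ.* ∏ ps Y)) ∎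
    where
    open ≤-Reasoning
    S : ℚ
    S = sumℚ ps x
    0≤S : 0ℚ ≤ S
    0≤S = 0≤sumℚ ps 0≤x
    x≤1 : x p ≤ 1ℚ
    x≤1 = ≤-trans (subst (_≤ x p + S) (+-identityʳ (x p)) (+-monoʳ-≤ (x p) 0≤S)) sum≤1
    S≤1 : S ≤ 1ℚ
    S≤1 = ≤-trans (subst (_≤ x p + S) (+-identityˡ S) (+-monoˡ-≤ S (0≤x p))) sum≤1
    IH : 1ℚ - S ≤ productℚ ps c * ι (pos (∏ ps Y))
    IH = productℚ-bound ps {c} {x} {Y} 0≤x (λ p∈ → le (there p∈)) S≤1
    expand : ∀ x y → x * y ≡ (1ℚ - x) * (1ℚ - y) - (1ℚ - (x + y))
    expand = solve-∀ ℚ-ring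
    rearrange : ∀ a b c d → a * b * (c * d) ≡ a * c * (b * d)
    rearrange = solve-∀ ℚ-ring

  ∏-filter : ∀ {P : ℕ → Set} (P? : ∀ n → Dec (P n)) ps (f : ℕ → ℕ) {g} →
    (∀ p → P p → g p ≡ f p) → (∀ p → ¬ P p → g p ≡ 1) → ∏ ps g ≡ ∏ (filter P? ps) f
  ∏-filter P? []       f g≡f g≡1 = refl
  ∏-filter P? (p ∷ ps) f g≡f g≡1 with P? p
  ... | yes Pp = cong₂ ℕ._*_ (g≡f p Pp) (∏-filter P? ps f g≡f g≡1)
  ... | no ¬Pp = trans (cong₂ ℕ._*_ (g≡1 p ¬Pp) (∏-filter P? ps f g≡f g≡1)) (ℕ.+-identityʳ _)

  module _ (k′ s′ : ℕ) where

    private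
      k s : ℕ
      k = suc k′
      s = suc s′

    -- `lossConstant` is the loss `deviationConstant + 1` at a good prime, plus 1 for a strict
    -- inequality. `rootBound` keeps the total loss within `lossConstant * 3 / (6 * lossConstant)`,
    -- which is one half. Primes beyond `primeBound` have integer square root at least `rootBound`
    -- and do not divide `k`.
    lossConstant rootBound primeBound : ℕ
    lossConstant = suc (suc ((2 ℕ.* k) ℕ.^ s))
    rootBound = suc (6 ℕ.* lossConstant)
    primeBound = rootBound ℕ.* rootBound ℕ.+ k

    lossSum≤½ : ∀ n → ι (pos lossConstant) * sumℚ (upTo n) (tail rootBound) ≤ ½
    lossSum≤½ n = ≤-trans (*-monoˡ (ι (pos lossConstant)) (0≤ι lossConstant) (tail-sum≤ (ℕ.pred (6 ℕ.* lossConstant)) n))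
      (≤-reflexive (begin
        ι (pos lossConstant) * (3ℚ * i)
          ≡⟨ lemma (ι (pos lossConstant)) 3ℚ i ⟩
        3ℚ * ι (pos lossConstant) * i
          ≡⟨ cong (λ z → z * ι (pos lossConstant) * i) three ⟩
        ½ * ι (pos 6) * ι (pos lossConstant) * i
          ≡⟨ lemma′ ½ (ι (pos 6)) (ι (pos lossConstant)) i ⟩
        ½ * (i * (ι (pos 6) * ι (pos lossConstant)))
          ≡⟨ cong (λ z → ½ * (i * z)) (trans (sym (ι-* (pos 6) (pos lossConstant))) (cong ι (sym (ℤ.pos-* 6 lossConstant)))) ⟩
        ½ * (i * ι (pos (6 ℕ.* lossConstant)))
          ≡⟨ cong (½ *_) (inv-ι (6 ℕ.* lossConstant)) ⟩
        ½ * 1ℚ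
          ≡⟨ *-identityʳ ½ ⟩
        ½ ∎))
      where
      open ≡-Reasoning
      i : ℚ
      i = inv (6 ℕ.* lossConstant)
      three : 3ℚ ≡ ½ * ι (pos 6)
      three = cong (½ *_) (sym (ι-def (pos 6)))
      lemma : ∀ c t i → c * (t * i) ≡ t * c * i
      lemma = solve-∀ ℚ-ring
      lemma′ : ∀ h x c i → h * x * c * i ≡ h * (i * (x * c))
      lemma′ = solve-∀ ℚ-ring

    module _ (5≤s′ : 5 ℕ.≤ s′) (k′<s′ : k′ ℕ.< s′) (T : ℕ) .{{_ : NonZero T}} (a : Vec ℤ s)
      (a≢0 : All (_≢ 0ℤ) a) (balanced : Balanced T a) {𝔖 : ℝ} (χ : ℕ → ℝ)
      (local : ∀ p (p-prime : Prime p) → IsLocalDensity k a p {{prime⇒nonZero p-prime}} (χ p))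
      (converges : ConvergesTo (λ n → R.productOverPrimes≤ n χ) 𝔖) (0<𝔖 : 0ℝ R.< 𝔖) where

      private
        G : ℕ
        G = badNumber primeBound a

        m : ℕ → ℕ
        m p = 2 ℕ.* suc (weight p k a)

        loss : ℕ → ℚ
        loss p = ι (pos lossConstant) * tail rootBound p

        factorIn : ∀ p → Dec (p ∣ G) → ℕ
        factorIn p (yes _) = badFactor k a p
        factorIn p (no _)  = 1

        boundIn : ∀ p → Dec (p ∣ G) → ℚ
        boundIn p (yes _) = inv₀ (badFactor k a p)
        boundIn p (no _)  = 1ℚ - loss p

        factor : ℕ → ℕ
        factor p = factorIn p (p ∣? G)

        bound : ℕ → ℚ
        bound p = boundIn p (p ∣? G)

        primes : ℕ → List ℕ
        primes n = filter prime? (upTo (suc n))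

        0≤loss : ∀ p → 0ℚ ≤ loss p
        0≤loss p = 0≤* {ι (pos lossConstant)} {tail rootBound p} (0≤ι lossConstant) (0≤tail rootBound p)

      module _ {p : ℕ} (p-prime : Prime p) where

        private
          instance
            p≢0 : NonZero p
            p≢0 = prime⇒nonZero p-prime
            p^m≢0 : NonZero (p ℕ.^ m p)
            p^m≢0 = ℕ.m^n≢0 p (m p)
          1<p : 1 ℕ.< p
          1<p = ℕ.nonTrivial⇒n>1 p {{prime⇒nonTrivial p-prime}}

          insoluble⇒null : ¬ Soluble p-prime k′ (p ℕ.^ m p) a → Null (χ p)
          insoluble⇒null insoluble = limit-null {normalisedCount k a p} {χ p} (local p p-prime) small
            where
            small : ∀ ε → 0ℚ < ε → ∀ N → ∃ λ h → (N ℕ.≤ h) × (0ℚ ≤ normalisedCount k a p h) × (normalisedCount k a p h ≤ ε)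
            small ε 0<ε N = t ℕ.* k ℕ.+ m p ,
              ℕ.≤-trans (ℕ.m≤n+m N (p ℕ.^ m p ℕ.* suc D)) (ℕ.≤-trans (ℕ.m≤m*n t k) (ℕ.m≤m+n (t ℕ.* k) (m p))) ,
              0≤normalisedCount k a p (t ℕ.* k ℕ.+ m p) ,
              ≤-trans (normalisedCount-insoluble k a p k′ (m p) t k′<s′ (solutionCount-insoluble p-prime k′ (m p) a insoluble t))
                (≤-trans (*-monoˡ (ι (pos (p ℕ.^ m p))) (0≤ι (p ℕ.^ m p))
                    (≤-trans (inv-antimono (p ℕ.^ m p ℕ.* suc D) (p ℕ.^ t) product≤) (≤-reflexive (inv-* (p ℕ.^ m p) (suc D)))))
                  (≤-trans (≤-reflexive cancel) (proj₂ (archimedean 0<ε))))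
              where
              D t : ℕ
              D = proj₁ (archimedean 0<ε)
              -- As `t < p^t`, this makes `p^m / p^t` at most `1 / (D + 1) ≤ ε`; the summand `N`
              -- makes the exponent late enough.
              t = p ℕ.^ m p ℕ.* suc D ℕ.+ N
              instance
                p^t≢0 : NonZero (p ℕ.^ t)
                p^t≢0 = ℕ.m^n≢0 p t
                product≢0 : NonZero (p ℕ.^ m p ℕ.* suc D)
                product≢0 = ℕ.m*n≢0 (p ℕ.^ m p) (suc D)
              product≤ : p ℕ.^ m p ℕ.* suc D ℕ.≤ p ℕ.^ t
              product≤ = ℕ.≤-trans (ℕ.m≤m+n (p ℕ.^ m p ℕ.* suc D) N) (ℕ.<⇒≤ (n<p^n 1<p t))
              cancel : ι (pos (p ℕ.^ m p)) * (inv (p ℕ.^ m p) * inv (suc D)) ≡ inv (suc D)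
              cancel = trans (lemma (ι (pos (p ℕ.^ m p))) (inv (p ℕ.^ m p)) (inv (suc D))) (ι-inv-cancel (p ℕ.^ m p) (inv (suc D)))
                where
                lemma : ∀ x y z → x * (y * z) ≡ y * (x * z)
                lemma = solve-∀ ℚ-ring

          -- A vanishing density annihilates every partial product from `p` on, against `𝔖 > 0`.
          not-insoluble : ¬ ¬ Soluble p-prime k′ (p ℕ.^ m p) a
          not-insoluble insoluble = limit-null⇒≯0 {λ n → R.productOverPrimes≤ n χ} {𝔖} converges
            (p , λ n p≤n → null-productℝ {primes n} χ (∈-filter⁺ prime? (∈-upTo⁺ (s≤s p≤n)) p-prime) (insoluble⇒null insoluble)) 0<𝔖

        bad-density : ¬ ¬ χ p ↘ inv₀ (badFactor k a p)
        bad-density fail = not-insoluble λ soluble → fail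
          (density-↘ {normalisedCount k a p} {χ p} {inv ((p ℕ.^ m p) ℕ.^ s′)} {inv₀ (badFactor k a p)} (local p p-prime)
            (λ N → N ℕ.+ m p , ℕ.m≤m+n N (m p) ,
              normalisedCount-soluble k a p (m p) N (solutionCount-soluble p-prime k′ a a≢0 soluble N))
            (subst (_< inv ((p ℕ.^ m p) ℕ.^ s′)) (sym (inv₀≡inv ((p ℕ.^ m p) ℕ.^ s)))
              (inv-anti-< ((p ℕ.^ m p) ℕ.^ s′) ((p ℕ.^ m p) ℕ.^ s) (ℕ.^-monoʳ-< (p ℕ.^ m p) 1<p^m (ℕ.n<1+n s′)))))
          where
          instance
            _ : NonZero ((p ℕ.^ m p) ℕ.^ s′)
            _ = ℕ.m^n≢0 (p ℕ.^ m p) s′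
            _ : NonZero ((p ℕ.^ m p) ℕ.^ s)
            _ = ℕ.m^n≢0 (p ℕ.^ m p) s
          1<p^m : 1 ℕ.< p ℕ.^ m p
          1<p^m = ℕ.≤-<-trans (s≤s z≤n) (n<p^n 1<p (m p))

        module _ (p∤G : ¬ p ∣ G) where

          private
            primeBound<p : primeBound ℕ.< p
            primeBound<p = proj₁ (good-prime p-prime primeBound a p∤G)
            p∤k : ¬ p ∣ k
            p∤k p∣k = ℕ.<⇒≱ primeBound<p (ℕ.≤-trans (∣⇒≤ p∣k) (ℕ.m≤n+m k (rootBound ℕ.* rootBound)))
            u u³ : ℕ
            u = isqrt p
            u³ = u ℕ.* u ℕ.* u
            rootBound≤u : rootBound ℕ.≤ u
            rootBound≤u = ≤isqrt (ℕ.≤-trans (ℕ.m≤m+n (rootBound ℕ.* rootBound) k) (ℕ.<⇒≤ primeBound<p))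
            instance
              u≢0 : NonZero u
              u≢0 = ℕ.>-nonZero (ℕ.<-≤-trans (s≤s z≤n) rootBound≤u)
              u²≢0 : NonZero (u ℕ.* u)
              u²≢0 = ℕ.m*n≢0 u u
              u³≢0 : NonZero u³
              u³≢0 = ℕ.m*n≢0 (u ℕ.* u) u
            loss≡ : loss p ≡ ι (pos lossConstant) * inv u³
            loss≡ = cong (ι (pos lossConstant) *_) (trans (tail-≥ rootBound p rootBound≤u) (cubeInverse≡ u))

          good-density : χ p ↘ (1ℚ - loss p)
          good-density = density-↘ {normalisedCount k a p} {χ p} {1ℚ - ι (pos (ℕ.pred lossConstant)) * inv u³} {1ℚ - loss p} (local p p-prime)
            (λ N → suc N , ℕ.n≤1+n N , normalisedCount-good k a p u³ (ℕ.pred lossConstant) N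
              (GoodPrime.solutionCount-good p-prime k′ p∤k 5≤s′ a (proj₂ (good-prime p-prime primeBound a p∤G)) {u} (isqrt²≤ p) N))
            (+-monoʳ-< 1ℚ (neg-antimono-< (subst (ι (pos (ℕ.pred lossConstant)) * inv u³ <_) (sym loss≡)
              (*-monoˡ-<-pos (inv u³) {{positive (0<inv u³)}} (ι-mono-< (ℕ.n<1+n (ℕ.pred lossConstant)))))))

          0≤good : 0ℚ ≤ 1ℚ - loss p
          0≤good = 0≤-from-≤ (subst₂ _≤_ (sym loss≡) (trans (*-comm (ι (pos u³)) (inv u³)) (inv-ι u³))
            (*-monoʳ (inv u³) (<⇒≤ (0<inv u³)) (ι-mono (ℤ.+≤+ lossConstant≤u³))))
            where
            lossConstant≤u³ : lossConstant ℕ.≤ u³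
            lossConstant≤u³ = ℕ.≤-trans (ℕ.m≤n*m lossConstant 6) (ℕ.≤-trans (ℕ.n≤1+n _) (ℕ.≤-trans rootBound≤u (ℕ.m≤n*m u (u ℕ.* u))))

      private
        module _ {p : ℕ} (p-prime : Prime p) where

          boundIn-↘ : ∀ d → ¬ ¬ χ p ↘ boundIn p d
          boundIn-↘ (yes _)  = bad-density p-prime
          boundIn-↘ (no p∤G) = λ fail → fail (good-density p-prime p∤G)

          0≤boundIn : ∀ d → 0ℚ ≤ boundIn p d
          0≤boundIn (yes _)  = 0≤inv₀ (badFactor k a p)
          0≤boundIn (no p∤G) = 0≤good p-prime p∤G

          boundIn-* : ∀ d → 1ℚ - loss p ≤ boundIn p d * ι (pos (factorIn p d))
          boundIn-* (no _)  = ≤-reflexive (sym (trans (cong ((1ℚ - loss p) *_) ι-1) (*-identityʳ (1ℚ - loss p))))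
          boundIn-* (yes _) = ≤-trans (≤-from-0≤ (subst (0ℚ ≤_) (lemma (loss p)) (0≤loss p)))
            (≤-reflexive (sym (trans (cong (_* ι (pos (badFactor k a p))) (inv₀≡inv (badFactor k a p))) (inv-ι (badFactor k a p)))))
            where
            lemma : ∀ x → x ≡ 1ℚ - (1ℚ - x)
            lemma = solve-∀ ℚ-ring
            instance
              badFactor≢0 : NonZero (badFactor k a p)
              badFactor≢0 = ℕ.m^n≢0 (p ℕ.^ m p) s {{ℕ.m^n≢0 p (m p) {{prime⇒nonZero p-prime}}}}

        prime-∈ : ∀ {n p} → p ∈ primes n → Prime p
        prime-∈ {n} p∈ = List.lookup (List.all-filter prime? (upTo (suc n))) p∈

      seriesBound : ℕ
      seriesBound = badConstant k primeBound s ℕ.* T ℕ.^ badExponent k primeBound s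

      private
        ∏-factor≤ : ∀ n → ∏ (primes n) factor ℕ.≤ seriesBound
        ∏-factor≤ n = ℕ.≤-trans (ℕ.≤-reflexive (∏-filter (_∣? G) (primes n) (badFactor k a) (λ p → is-bad p (p ∣? G)) (λ p → is-good p (p ∣? G))))
          (∏-badFactor≤ {filter (_∣? G) (primes n)} (Unique.filter⁺ (_∣? G) (Unique.filter⁺ prime? (Unique.upTo⁺ (suc n))))
            (List.filter⁺ (_∣? G) (List.all-filter prime? (upTo (suc n)))) k primeBound T a a≢0 balanced
            (List.all-filter (_∣? G) (primes n)))
          where
          is-bad : ∀ p d → p ∣ G → factorIn p d ≡ badFactor k a p
          is-bad p (yes _)  p∣G = refl
          is-bad p (no p∤G) p∣G = contradiction p∣G p∤G
          is-good : ∀ p d → ¬ p ∣ G → factorIn p d ≡ 1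
          is-good p (yes p∣G) p∤G = contradiction p∣G p∤G
          is-good p (no _)    p∤G = refl

        loss-sum≤½ : ∀ n → sumℚ (primes n) loss ≤ ½
        loss-sum≤½ n = ≤-trans (≤-reflexive (sumℚ-*ˡ (ι (pos lossConstant)) (primes n) (tail rootBound)))
          (≤-trans (*-monoˡ (ι (pos lossConstant)) (0≤ι lossConstant) (sumℚ-filter≤ prime? (upTo (suc n)) (0≤tail rootBound)))
            (lossSum≤½ (suc n)))

      module _ .{{_ : NonZero seriesBound}} where

        private
          -- One half survives the losses at good primes, and `seriesBound` collects the bad ones.
          L : ℚ
          L = ½ * inv seriesBound

          product≥ : ∀ n → L ≤ productℚ (primes n) bound
          product≥ n = begin
            ½ * inv seriesBound
              ≤⟨ *-monoʳ {½} {productℚ (primes n) bound * ι (pos seriesBound)} (inv seriesBound) (<⇒≤ (0<inv seriesBound)) half≤ ⟩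
            productℚ (primes n) bound * ι (pos seriesBound) * inv seriesBound
              ≡⟨ trans (*-assoc (productℚ (primes n) bound) (ι (pos seriesBound)) (inv seriesBound))
                   (trans (cong (productℚ (primes n) bound *_) (trans (*-comm (ι (pos seriesBound)) (inv seriesBound)) (inv-ι seriesBound)))
                     (*-identityʳ (productℚ (primes n) bound))) ⟩
            productℚ (primes n) bound ∎
            where
            open ≤-Reasoning
            half≤ : ½ ≤ productℚ (primes n) bound * ι (pos seriesBound)
            half≤ = begin
              ½
                ≤⟨ +-monoʳ-≤ 1ℚ (neg-antimono-≤ (loss-sum≤½ n)) ⟩
              1ℚ - sumℚ (primes n) loss
                ≤⟨ productℚ-bound (primes n) {bound} {loss} {factor} 0≤loss (λ {p} p∈ → boundIn-* (prime-∈ {n} p∈) (p ∣? G))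
                     (≤-trans (loss-sum≤½ n) (≤-from-0≤ (nonNegative⁻¹ (1ℚ - ½)))) ⟩
              productℚ (primes n) bound * ι (pos (∏ (primes n) factor))
                ≤⟨ *-monoˡ (productℚ (primes n) bound) (0≤productℚ (primes n) λ {p} p∈ → 0≤boundIn (prime-∈ {n} p∈) (p ∣? G)) (ι-mono (ℤ.+≤+ (∏-factor≤ n))) ⟩
              productℚ (primes n) bound * ι (pos seriesBound) ∎

          0<½L : 0ℚ < ½ * L
          0<½L = 0<½* {L} (0<* {½} {inv seriesBound} (positive⁻¹ ½) (0<inv seriesBound))

        -- The lower bound `L` for the partial products is uniform in their length, so it is enough
        -- to look at one product within `L / 2` of the limit.
        singularSeries-↘ : ¬ ¬ 𝔖 ↘ (½ * L)
        singularSeries-↘ fail = productℝ-↘ (primes N) χ {bound} (λ {p} p∈ → 0≤boundIn (prime-∈ {N} p∈) (p ∣? G)) (λ {p} p∈ → boundIn-↘ (prime-∈ {N} p∈) (p ∣? G)) λ above →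
          fail (subst (𝔖 ↘_) half (limit-↘ {λ n → R.productOverPrimes≤ n χ} {𝔖} {½ * L} {L} N
            (proj₂ (proj₂ limit N ℕ.≤-refl)) (↘-weaken {productℝ (primes N) χ} (product≥ N) above)))
          where
          limit : ∃ λ N → ∀ n → N ℕ.≤ n → ((𝔖 R.- fromℚ (½ * L)) R.< R.productOverPrimes≤ n χ) × (R.productOverPrimes≤ n χ R.< (𝔖 R.+ fromℚ (½ * L)))
          limit = converges (fromℚ (½ * L)) (fromℚ-pos 0<½L)
          N : ℕ
          N = proj₁ limit
          lemma : ∀ x → x + x - x ≡ x
          lemma = solve-∀ ℚ-ring
          half : L - ½ * L ≡ ½ * L
          half = trans (cong (_- ½ * L) (sym (halves L))) (lemma (½ * L))

-- Powers of rationals, integer roots and comparison of reals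

module PowersAndRoots where

  open Rationals
  open RealNumbers using (0<½*; halves; p≤∣p∣)
  import Defs as R
  open import Defs using (seq; cauchy)
  open import Data.Integer as ℤ using (ℤ) renaming (+_ to pos)
  open import Data.Rational using (ℚ; 0ℚ; 1ℚ; ½; _+_; _*_; _-_; -_; _≤_; _<_; _≤?_)
  open import Data.Rational.Properties
  open import Tactic.RingSolver using (solve-∀)

  infixr 8 _^ℚ_

  _^ℚ_ : ℚ → ℕ → ℚ
  q ^ℚ zero  = 1ℚ
  q ^ℚ suc n = q * q ^ℚ n

  seq-^ : ∀ x n i → seq (x R.^ n) i ≡ seq x i ^ℚ n
  seq-^ x zero    i = refl
  seq-^ x (suc n) i = cong (seq x i *_) (seq-^ x n i)

  0≤^ℚ : ∀ {q} n → 0ℚ ≤ q → 0ℚ ≤ q ^ℚ n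
  0≤^ℚ     zero    0≤q = 0≤1
  0≤^ℚ {q} (suc n) 0≤q = 0≤* {q} {q ^ℚ n} 0≤q (0≤^ℚ n 0≤q)

  0<^ℚ : ∀ {q} n → 0ℚ < q → 0ℚ < q ^ℚ n
  0<^ℚ     zero    0<q = positive⁻¹ 1ℚ
  0<^ℚ {q} (suc n) 0<q = 0<* {q} {q ^ℚ n} 0<q (0<^ℚ n 0<q)

  ^ℚ-mono : ∀ {q r} n → 0ℚ ≤ q → q ≤ r → q ^ℚ n ≤ r ^ℚ n
  ^ℚ-mono         zero    0≤q q≤r = ≤-refl
  ^ℚ-mono {q} {r} (suc n) 0≤q q≤r =
    *-mono {q} {r} {q ^ℚ n} {r ^ℚ n} 0≤q (0≤^ℚ n (≤-trans 0≤q q≤r)) q≤r (^ℚ-mono n 0≤q q≤r)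

  ^ℚ-distrib-* : ∀ q r n → (q * r) ^ℚ n ≡ q ^ℚ n * r ^ℚ n
  ^ℚ-distrib-* q r zero    = refl
  ^ℚ-distrib-* q r (suc n) = trans (cong (q * r *_) (^ℚ-distrib-* q r n)) (lemma q r (q ^ℚ n) (r ^ℚ n))
    where
    lemma : ∀ a b c d → a * b * (c * d) ≡ a * c * (b * d)
    lemma = solve-∀ ℚ-ring

  ^ℚ-+ : ∀ q m n → q ^ℚ (m ℕ.+ n) ≡ q ^ℚ m * q ^ℚ n
  ^ℚ-+ q zero    n = sym (*-identityˡ (q ^ℚ n))
  ^ℚ-+ q (suc m) n = trans (cong (q *_) (^ℚ-+ q m n)) (sym (*-assoc q (q ^ℚ m) (q ^ℚ n)))

  ^ℚ-* : ∀ q m n → (q ^ℚ m) ^ℚ n ≡ q ^ℚ (m ℕ.* n)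
  ^ℚ-* q m zero    = cong (q ^ℚ_) (sym (ℕ.*-zeroʳ m))
  ^ℚ-* q m (suc n) = trans (cong (q ^ℚ m *_) (^ℚ-* q m n)) (trans (sym (^ℚ-+ q m (m ℕ.* n))) (cong (q ^ℚ_) (sym (ℕ.*-suc m n))))

  1^ℚ : ∀ n → 1ℚ ^ℚ n ≡ 1ℚ
  1^ℚ zero    = refl
  1^ℚ (suc n) = trans (*-identityˡ (1ℚ ^ℚ n)) (1^ℚ n)

  ι-^ : ∀ m n → ι (pos (m ℕ.^ n)) ≡ ι (pos m) ^ℚ n
  ι-^ m zero    = ι-1
  ι-^ m (suc n) = trans (cong ι (ℤ.pos-* m (m ℕ.^ n))) (trans (ι-* (pos m) (pos (m ℕ.^ n))) (cong (ι (pos m) *_) (ι-^ m n)))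

  -- Transfers a positive gap between two numbers to their powers, as required when a bound for K-th
  -- powers is to bound the numbers themselves.
  ^ℚ-superadditive : ∀ {q r} n .{{_ : NonZero n}} → 0ℚ ≤ q → 0ℚ ≤ r → q ^ℚ n + r ^ℚ n ≤ (q + r) ^ℚ n
  ^ℚ-superadditive {q} {r} (suc zero)    0≤q 0≤r = ≤-reflexive (lemma q r)
    where
    lemma : ∀ q r → q * 1ℚ + r * 1ℚ ≡ (q + r) * 1ℚ
    lemma = solve-∀ ℚ-ring
  ^ℚ-superadditive {q} {r} (suc n@(suc _)) 0≤q 0≤r = begin
    q * q ^ℚ n + r * r ^ℚ n
      ≤⟨ ≤-from-0≤ (subst (0ℚ ≤_) (lemma q r (q ^ℚ n) (r ^ℚ n))
           (+-mono-≤ (0≤* {q} {r ^ℚ n} 0≤q (0≤^ℚ n 0≤r)) (0≤* {r} {q ^ℚ n} 0≤r (0≤^ℚ n 0≤q)))) ⟩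
    (q + r) * (q ^ℚ n + r ^ℚ n)
      ≤⟨ *-monoˡ {q ^ℚ n + r ^ℚ n} {(q + r) ^ℚ n} (q + r) (+-mono-≤ 0≤q 0≤r) (^ℚ-superadditive n 0≤q 0≤r) ⟩
    (q + r) * (q + r) ^ℚ n ∎
    where
    open ≤-Reasoning
    lemma : ∀ q r x y → q * y + r * x ≡ (q + r) * (x + y) - (q * x + r * y)
    lemma = solve-∀ ℚ-ring

  ceiling : ∀ {q} n → 0ℚ ≤ q → q ≤ ι (pos n) → ∃ λ N → (q ≤ ι (pos N)) × (ι (pos N) ≤ q + 1ℚ)
  ceiling {q} zero    0≤q q≤n = 0 , q≤n , ≤-trans (≤-reflexive ι-0) (+-mono-≤ 0≤q 0≤1)
  ceiling {q} (suc n) 0≤q q≤1+n with q ≤? ι (pos n)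
  ... | yes q≤n = ceiling n 0≤q q≤n
  ... | no q≰n  = suc n , q≤1+n , ≤-trans (≤-reflexive (trans (ι-+ (pos 1) (pos n)) (trans (cong (_+ ι (pos n)) ι-1) (+-comm 1ℚ (ι (pos n))))))
    (+-monoˡ-≤ 1ℚ (<⇒≤ (≰⇒> q≰n)))

  -- The integer part of the K-th root of `N + 1` is at least 1 and is written `T + 1`; it grows by
  -- at most 1 when `N` does.
  integerRoot : ∀ K .{{_ : NonZero K}} N → ∃ λ T → (suc T ℕ.^ K ℕ.≤ suc N) × (suc N ℕ.< suc (suc T) ℕ.^ K)
  integerRoot K zero    = 0 , ℕ.≤-reflexive (ℕ.^-zeroˡ K) , 1<2^ K
    where
    1<2^ : ∀ K .{{_ : NonZero K}} → 1 ℕ.< 2 ℕ.^ K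
    1<2^ (suc K) = ℕ.*-mono-≤ {2} {2} {1} {2 ℕ.^ K} ℕ.≤-refl (ℕ.m^n>0 2 K)
  integerRoot K (suc N) with integerRoot K N
  ... | T , T^K≤N , N<T^K with suc (suc T) ℕ.^ K ℕ.≤? suc (suc N)
  ...   | yes le = suc T , le , ℕ.≤-<-trans N<T^K (ℕ.^-monoˡ-< K (ℕ.n<1+n (suc (suc T))))
  ...   | no ≰   = T , ℕ.≤-trans T^K≤N (ℕ.n≤1+n (suc N)) , ℕ.≰⇒> ≰

  -- The sequences are compared at one late index, where the order of rationals is decidable, with
  -- threshold `ε / 2`: below it `x ≤ y + ε` from there on, above it a gap of `ε / 4` persists.
  ≮⇒≥ℝ : ∀ {x y} → ¬ y R.< x → x R.≤ y
  ≮⇒≥ℝ {x} {y} y≮x ε 0<ε = N , λ n N≤n → decide n N≤n (seq x N ≤? seq y N + 4δ)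
    where
    δ 2δ 4δ : ℚ
    δ = ½ * (½ * (½ * ε))
    2δ = ½ * (½ * ε)
    4δ = ½ * ε
    0<δ : 0ℚ < δ
    0<δ = 0<½* (0<½* (0<½* 0<ε))
    N : ℕ
    N = proj₁ (cauchy x δ 0<δ) ℕ.⊔ proj₁ (cauchy y δ 0<δ)
    close-x : ∀ m n → N ℕ.≤ m → N ℕ.≤ n → seq x m - seq x n ≤ δ
    close-x m n N≤m N≤n = ≤-trans (p≤∣p∣ (seq x m - seq x n))
      (proj₂ (cauchy x δ 0<δ) m n (ℕ.m⊔n≤o⇒m≤o _ _ N≤m) (ℕ.m⊔n≤o⇒m≤o _ _ N≤n))
    close-y : ∀ m n → N ℕ.≤ m → N ℕ.≤ n → seq y m - seq y n ≤ δ
    close-y m n N≤m N≤n = ≤-trans (p≤∣p∣ (seq y m - seq y n))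
      (proj₂ (cauchy y δ 0<δ) m n (ℕ.m⊔n≤o⇒n≤o _ _ N≤m) (ℕ.m⊔n≤o⇒n≤o _ _ N≤n))
    4δ≡ : 4δ ≡ (δ + δ) + (δ + δ)
    4δ≡ = sym (trans (cong₂ _+_ (halves 2δ) (halves 2δ)) (halves 4δ))
    ε≡ : ε ≡ ((δ + δ) + (δ + δ)) + ((δ + δ) + (δ + δ))
    ε≡ = trans (sym (halves ε)) (cong₂ _+_ 4δ≡ 4δ≡)
    decide : ∀ n → N ℕ.≤ n → Dec (seq x N ≤ seq y N + 4δ) → seq x n ≤ seq y n + ε
    decide n N≤n (yes le) = ≤-from-0≤ (subst (0ℚ ≤_)
      (trans (cong (λ z → (δ - (seq x n - seq x N)) + (δ - (seq y N - seq y n)) + (seq y N + z - seq x N) + (δ + δ)) 4δ≡)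
        (trans (lemma (seq x n) (seq x N) (seq y n) (seq y N) δ) (cong (λ z → seq y n + z - seq x n) (sym ε≡))))
      (+-mono-≤ (+-mono-≤ (+-mono-≤ (0≤-from-≤ (close-x n N N≤n ℕ.≤-refl)) (0≤-from-≤ (close-y N n ℕ.≤-refl N≤n))) (0≤-from-≤ le))
        (+-mono-≤ (<⇒≤ 0<δ) (<⇒≤ 0<δ))))
      where
      lemma : ∀ x X y Y δ → (δ - (x - X)) + (δ - (Y - y)) + (Y + ((δ + δ) + (δ + δ)) - X) + (δ + δ) ≡
        y + (((δ + δ) + (δ + δ)) + ((δ + δ) + (δ + δ))) - x
      lemma = solve-∀ ℚ-ring
    decide n N≤n (no ≰) = contradiction (2δ , 0<½* (0<½* 0<ε) , N , gap) y≮x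
      where
      lemma : ∀ x X y Y δ → (δ - (X - x)) + (δ - (y - Y)) + (X - (Y + ((δ + δ) + (δ + δ)))) ≡ x - (y + (δ + δ))
      lemma = solve-∀ ℚ-ring
      gap : ∀ m → N ℕ.≤ m → seq y m + 2δ ≤ seq x m
      gap m N≤m = ≤-from-0≤ (subst (0ℚ ≤_)
        (trans (cong (λ z → (δ - (seq x N - seq x m)) + (δ - (seq y m - seq y N)) + (seq x N - (seq y N + z))) 4δ≡)
          (trans (lemma (seq x m) (seq x N) (seq y m) (seq y N) δ) (cong (λ z → seq x m - (seq y m + z)) (halves 2δ))))
        (+-mono-≤ (+-mono-≤ (0≤-from-≤ (close-x N m ℕ.≤-refl N≤m)) (0≤-from-≤ (close-y m N N≤m ℕ.≤-refl))) (0≤-from-≤ (<⇒≤ (≰⇒> ≰)))))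

-- From a bound for T to a bound for the count

module CountingBound where

  open GoodPrimes using (^ℕ-distrib-*)
  open BadPrimes using (Balanced)
  open UnbalancedVectors using (imbalanceConstant; unbalanced-few; vectors-few)
  open Rationals
  open RealNumbers
  open SingularSeries
  open PowersAndRoots
  import Defs as R
  open import Defs using (ℝ; seq; cauchy; fromℚ; fromℕ; 0ℝ; 1ℝ; IsPower; maxNorm)
  open import Data.Integer as ℤ using (ℤ; 0ℤ) renaming (+_ to pos)
  open import Data.Rational using (ℚ; 0ℚ; 1ℚ; ½; _+_; _*_; _-_; -_; _≤_; _<_; _/_; ∣_∣; positive)
  open import Data.Rational.Properties
  open import Tactic.RingSolver using (solve-∀)

  -- The hypotheses give `T^(En+1) ≤ N ≤ 12 (4 c T^E)^n`; a factor `T^(En)` cancels and one power of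
  -- `T` is left.
  lower-bound⇒T-bounded : ∀ c E n N T .{{_ : NonZero (c ℕ.* T ℕ.^ E)}} .{{_ : NonZero T}} → T ℕ.^ suc (E ℕ.* n) ℕ.≤ N →
    ι (pos N) * (½ * (½ * inv (c ℕ.* T ℕ.^ E))) ^ℚ n ≤ ι (pos 12) → T ℕ.≤ 12 ℕ.* (4 ℕ.* c) ℕ.^ n
  lower-bound⇒T-bounded c E n N T T^≤N le = ℕ.*-cancelʳ-≤ T (12 ℕ.* (4 ℕ.* c) ℕ.^ n) (T ℕ.^ (E ℕ.* n)) {{ℕ.m^n≢0 T (E ℕ.* n)}} (begin
    T ℕ.* T ℕ.^ (E ℕ.* n)
      ≤⟨ T^≤N ⟩
    N
      ≤⟨ N≤ ⟩
    12 ℕ.* (4 ℕ.* B) ℕ.^ n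
      ≡⟨ cong (12 ℕ.*_) (trans (cong (ℕ._^ n) (sym (ℕ.*-assoc 4 c (T ℕ.^ E)))) (trans (^ℕ-distrib-* (4 ℕ.* c) (T ℕ.^ E) n)
           (cong ((4 ℕ.* c) ℕ.^ n ℕ.*_) (ℕ.^-*-assoc T E n)))) ⟩
    12 ℕ.* ((4 ℕ.* c) ℕ.^ n ℕ.* T ℕ.^ (E ℕ.* n))
      ≡⟨ sym (ℕ.*-assoc 12 ((4 ℕ.* c) ℕ.^ n) (T ℕ.^ (E ℕ.* n))) ⟩
    12 ℕ.* (4 ℕ.* c) ℕ.^ n ℕ.* T ℕ.^ (E ℕ.* n) ∎)
    where
    open ℕ.≤-Reasoning
    B : ℕ
    B = c ℕ.* T ℕ.^ E
    q X : ℚ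
    q = ½ * (½ * inv B)
    X = ι (pos (4 ℕ.* B)) ^ℚ n
    q*4B : q * ι (pos (4 ℕ.* B)) ≡ 1ℚ
    q*4B = trans (cong (q *_) (trans (cong ι (ℤ.pos-* 4 B)) (ι-* (pos 4) (pos B))))
      (trans (lemma ½ (inv B) (ι (pos 4)) (ι (pos B))) (trans (cong₂ _*_ quarter (inv-ι B)) (*-identityʳ 1ℚ)))
      where
      lemma : ∀ h i f b → h * (h * i) * (f * b) ≡ h * h * f * (i * b)
      lemma = solve-∀ ℚ-ring
      quarter : ½ * ½ * ι (pos 4) ≡ 1ℚ
      quarter = cong (½ * ½ *_) (ι-def (pos 4))
    unit : q ^ℚ n * X ≡ 1ℚ
    unit = trans (sym (^ℚ-distrib-* q (ι (pos (4 ℕ.* B))) n)) (trans (cong (_^ℚ n) q*4B) (1^ℚ n))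
    N≤ : N ℕ.≤ 12 ℕ.* (4 ℕ.* B) ℕ.^ n
    N≤ = ℤ.drop‿+≤+ (ι-cancel (subst₂ _≤_
      (trans (*-assoc (ι (pos N)) (q ^ℚ n) X) (trans (cong (ι (pos N) *_) unit) (*-identityʳ (ι (pos N)))))
      (trans (cong (ι (pos 12) *_) (sym (ι-^ (4 ℕ.* B) n))) (trans (sym (ι-* (pos 12) (pos ((4 ℕ.* B) ℕ.^ n)))) (cong ι (sym (ℤ.pos-* 12 ((4 ℕ.* B) ℕ.^ n))))))
      (*-monoʳ {ι (pos N) * q ^ℚ n} {ι (pos 12)} X (0≤^ℚ n (0≤ι (4 ℕ.* B))) le)))

  -- `D` covers the case of bounded `T`, `2^s` comes from the signs of the entries, and the leading
  -- 2 from `T + 1 ≤ 2 T`.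
  countConstant : ℕ → ℕ → ℕ
  countConstant s D = 2 ℕ.* ((D ℕ.+ imbalanceConstant s) ℕ.* 2 ℕ.^ s)

  module _ (s K D N T : ℕ) .{{_ : NonZero N}} .{{_ : NonZero T}} (N<T+1^K : N ℕ.< suc T ℕ.^ K) (as : List (Vec ℤ s)) (unique : Unique as)
    (bounded : ∀ {a} → a ∈ as → All (_≢ 0ℤ) a × (maxNorm a ℕ.≤ N))
    (T-bounded : ∀ {a} → a ∈ as → Balanced T a → T ℕ.≤ D) where

    private
      M : ℕ
      M = length as

      cases : T ℕ.* M ℕ.≤ (D ℕ.+ imbalanceConstant s) ℕ.* (2 ℕ.* N) ℕ.^ s
      -- For `T ≤ D` the trivial count of all vectors suffices; for `T > D` no vector in the list is
      -- balanced.
      cases with T ℕ.≤? D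
      ... | yes T≤ = ℕ.*-mono-≤ (ℕ.≤-trans T≤ (ℕ.m≤m+n D (imbalanceConstant s))) (vectors-few s N as unique bounded)
      ... | no T≰ = ℕ.≤-trans
        (unbalanced-few s N T as unique λ a∈ → proj₁ (bounded a∈) , proj₂ (bounded a∈) , λ balanced → T≰ (T-bounded a∈ balanced))
        (ℕ.*-monoˡ-≤ ((2 ℕ.* N) ℕ.^ s) (ℕ.m≤n+m (imbalanceConstant s) D))

    -- The saving `1/T` is of order `N^(-1/K)`; taking K-th powers expresses it without roots.
    count^K≤ : M ℕ.^ K ℕ.* N ℕ.≤ countConstant s D ℕ.^ K ℕ.* N ℕ.^ (s ℕ.* K)
    count^K≤ = begin
      M ℕ.^ K ℕ.* N
        ≤⟨ ℕ.*-monoʳ-≤ (M ℕ.^ K) (ℕ.≤-trans (ℕ.<⇒≤ N<T+1^K) (ℕ.^-monoˡ-≤ K T+1≤2T)) ⟩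
      M ℕ.^ K ℕ.* (2 ℕ.* T) ℕ.^ K
        ≡⟨ trans (sym (^ℕ-distrib-* M (2 ℕ.* T) K)) (cong (ℕ._^ K) (lemma M T)) ⟩
      (2 ℕ.* (T ℕ.* M)) ℕ.^ K
        ≤⟨ ℕ.^-monoˡ-≤ K (ℕ.*-monoʳ-≤ 2 cases) ⟩
      (2 ℕ.* (C ℕ.* (2 ℕ.* N) ℕ.^ s)) ℕ.^ K
        ≡⟨ cong (λ z → (2 ℕ.* (C ℕ.* z)) ℕ.^ K) (^ℕ-distrib-* 2 N s) ⟩
      (2 ℕ.* (C ℕ.* (2 ℕ.^ s ℕ.* N ℕ.^ s))) ℕ.^ K
        ≡⟨ cong (ℕ._^ K) (lemma′ C (2 ℕ.^ s) (N ℕ.^ s)) ⟩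
      (countConstant s D ℕ.* N ℕ.^ s) ℕ.^ K
        ≡⟨ trans (^ℕ-distrib-* (countConstant s D) (N ℕ.^ s) K) (cong (countConstant s D ℕ.^ K ℕ.*_) (ℕ.^-*-assoc N s K)) ⟩
      countConstant s D ℕ.^ K ℕ.* N ℕ.^ (s ℕ.* K) ∎
      where
      open ℕ.≤-Reasoning
      C : ℕ
      C = D ℕ.+ imbalanceConstant s
      lemma : ∀ M T → M ℕ.* (2 ℕ.* T) ≡ 2 ℕ.* (T ℕ.* M)
      lemma = ℕ.solve-∀
      lemma′ : ∀ C x y → 2 ℕ.* (C ℕ.* (x ℕ.* y)) ≡ 2 ℕ.* (C ℕ.* x) ℕ.* y
      lemma′ = ℕ.solve-∀
      T+1≤2T : suc T ℕ.≤ 2 ℕ.* T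
      T+1≤2T = subst (suc T ℕ.≤_) (cong (T ℕ.+_) (sym (ℕ.+-identityʳ T))) (ℕ.+-monoˡ-≤ T (ℕ.>-nonZero⁻¹ T))

  -- `N + 1` replaces the real number `A`: it lies between `A` and `6 A` from some index of the
  -- Cauchy sequence on.
  Approximates : ℝ → ℕ → ℕ → Set
  Approximates A N I = ∀ i → I ℕ.≤ i →
    (0ℚ ≤ seq A i) × (seq A i ≤ ι (pos (suc N))) × (ι (pos (suc N)) ≤ ι (pos 6) * seq A i)

  -- The terms of `A` are eventually at least `1/2`, so the error `5/2` from rounding and
  -- oscillation is at most `5 A`.
  naturalApproximation : ∀ A → 1ℝ R.≤ A → ∃ λ N → (∀ m → fromℕ m R.≤ A → m ℕ.≤ suc N) × ∃ (Approximates A N)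
  naturalApproximation A 1≤A = ℕ.pred N , norms , I , λ i I≤i → ≤-trans 0≤½ (½≤A i I≤i) ,
    subst (λ m → seq A i ≤ ι (pos m)) (sym N≡) (≤-trans (≤-trans (close i I≤i) (+-monoʳ-≤ (seq A I) ½≤1)) (proj₁ (proj₂ approximation))) ,
    subst (λ m → ι (pos m) ≤ ι (pos 6) * seq A i) (sym N≡) (upper i I≤i)
    where
    0≤½ : 0ℚ ≤ ½
    0≤½ = nonNegative⁻¹ ½
    ½≤1 : ½ ≤ 1ℚ
    ½≤1 = ≤-from-0≤ (nonNegative⁻¹ (1ℚ - ½))
    lower : ∃ λ I → ∀ i → I ℕ.≤ i → 1ℚ ≤ seq A i + ½
    lower = 1≤A ½ (positive⁻¹ ½)
    oscillation : ∃ λ I → ∀ i j → I ℕ.≤ i → I ℕ.≤ j → ∣ seq A i - seq A j ∣ ≤ ½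
    oscillation = cauchy A ½ (positive⁻¹ ½)
    I : ℕ
    I = proj₁ lower ℕ.⊔ proj₁ oscillation
    ½≤A : ∀ i → I ℕ.≤ i → ½ ≤ seq A i
    ½≤A i I≤i = subst (½ ≤_) (lemma (seq A i) ½) (+-monoˡ-≤ (- ½) (proj₂ lower i (ℕ.m⊔n≤o⇒m≤o (proj₁ lower) (proj₁ oscillation) I≤i)))
      where
      lemma : ∀ a h → a + h + - h ≡ a
      lemma = solve-∀ ℚ-ring
    difference : ∀ i j → I ℕ.≤ i → I ℕ.≤ j → seq A i ≤ seq A j + ½
    difference i j I≤i I≤j = subst (_≤ seq A j + ½) (lemma (seq A i) (seq A j)) (+-monoʳ-≤ (seq A j)
      (≤-trans (p≤∣p∣ (seq A i - seq A j)) (proj₂ oscillation i j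
        (ℕ.m⊔n≤o⇒n≤o (proj₁ lower) (proj₁ oscillation) I≤i) (ℕ.m⊔n≤o⇒n≤o (proj₁ lower) (proj₁ oscillation) I≤j))))
      where
      lemma : ∀ a b → b + (a - b) ≡ a
      lemma = solve-∀ ℚ-ring
    close : ∀ i → I ℕ.≤ i → seq A i ≤ seq A I + ½
    close i I≤i = difference i I I≤i ℕ.≤-refl
    q : ℚ
    q = seq A I + 1ℚ
    1≤q : 1ℚ ≤ q
    1≤q = subst (_≤ q) (+-identityˡ 1ℚ) (+-monoˡ-≤ 1ℚ (≤-trans 0≤½ (½≤A I ℕ.≤-refl)))
    approximation : ∃ λ N → (q ≤ ι (pos N)) × (ι (pos N) ≤ q + 1ℚ)
    approximation = ceiling (proj₁ (≤-natural q)) (≤-trans 0≤1 1≤q) (proj₂ (≤-natural q))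
    N : ℕ
    N = proj₁ approximation
    1≤N : 1 ℕ.≤ N
    1≤N = ℤ.drop‿+≤+ (ι-cancel (subst (_≤ ι (pos N)) (sym ι-1) (≤-trans 1≤q (proj₁ (proj₂ approximation)))))
    N≡ : suc (ℕ.pred N) ≡ N
    N≡ = ℕ.suc-pred N {{ℕ.>-nonZero 1≤N}}
    norms : ∀ m → fromℕ m R.≤ A → m ℕ.≤ suc (ℕ.pred N)
    norms m m≤A = subst (m ℕ.≤_) (sym N≡) (ℤ.drop‿+≤+ (ι-cancel (≤-trans (subst (_≤ q) (sym (ι-def (pos m)))
      (≤-trans (proj₂ bound i (ℕ.m≤m⊔n (proj₁ bound) I)) (subst (seq A i + ½ ≤_) (+-assoc (seq A I) ½ ½) (+-monoˡ-≤ ½ (close i (ℕ.m≤n⊔m (proj₁ bound) I))))))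
      (proj₁ (proj₂ approximation)))))
      where
      bound : ∃ λ J → ∀ i → J ℕ.≤ i → pos m / 1 ≤ seq A i + ½
      bound = m≤A ½ (positive⁻¹ ½)
      i : ℕ
      i = proj₁ bound ℕ.⊔ I
    upper : ∀ i → I ℕ.≤ i → ι (pos N) ≤ ι (pos 6) * seq A i
    upper i I≤i = begin
      ι (pos N)
        ≤⟨ proj₂ (proj₂ approximation) ⟩
      seq A I + 1ℚ + 1ℚ
        ≤⟨ +-monoˡ-≤ 1ℚ (+-monoˡ-≤ 1ℚ (difference I i ℕ.≤-refl I≤i)) ⟩
      seq A i + ½ + 1ℚ + 1ℚ
        ≡⟨ trans (+-assoc (seq A i + ½) 1ℚ 1ℚ) (+-assoc (seq A i) ½ (1ℚ + 1ℚ)) ⟩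
      seq A i + (½ + (1ℚ + 1ℚ))
        ≡⟨ cong (seq A i +_) (sym (trans (*-comm ½ (ι (pos 5))) (trans (cong (_* ½) (ι-def (pos 5))) refl))) ⟩
      seq A i + ½ * ι (pos 5)
        ≤⟨ +-monoʳ-≤ (seq A i) (*-monoʳ {½} {seq A i} (ι (pos 5)) (0≤ι 5) (½≤A i I≤i)) ⟩
      seq A i + seq A i * ι (pos 5)
        ≡⟨ lemma (seq A i) (ι (pos 5)) ⟩
      (1ℚ + ι (pos 5)) * seq A i
        ≡⟨ cong (_* seq A i) (sym (trans (ι-+ (pos 1) (pos 5)) (cong (_+ ι (pos 5)) ι-1))) ⟩
      ι (pos 6) * seq A i ∎
      where
      open ≤-Reasoning
      lemma : ∀ a f → a + a * f ≡ (1ℚ + f) * a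
      lemma = solve-∀ ℚ-ring

  module _ (s K : ℕ) .{{_ : NonZero K}} where

    -- Half of `1/K`, so that `s - 1/K` lies strictly below `s - γ`, as the comparison in `IsPower`
    -- demands.
    saving : ℝ
    saving = fromℚ (½ * inv K)

    -- `Q` is controlled through `A^(sK) ≤ A Q^K`. If `C Q + ε ≤ M`, superadditivity of K-th powers
    -- produces a gap `(N + 1) ε^K`, which exceeds the error `ε^K / 2` allowed in that inequality.
    bound≤power : ∀ C₁ M N → M ℕ.^ K ℕ.* suc N ℕ.≤ C₁ ℕ.^ K ℕ.* suc N ℕ.^ (s ℕ.* K) →
      ∀ A I → Approximates A N I →
      ∀ Q → IsPower A (fromℕ s R.- saving) Q → fromℕ M R.≤ (fromℕ (suc (C₁ ℕ.* 6 ℕ.^ s)) R.* Q)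
    bound≤power C₁ M N count A I approximates Q power = ≮⇒≥ℝ {fromℕ M} {fromℕ C₄ R.* Q} contradictory
      where
      C₄ : ℕ
      C₄ = suc (C₁ ℕ.* 6 ℕ.^ s)
      instance
        C₄^K≢0 : NonZero (C₄ ℕ.^ K)
        C₄^K≢0 = ℕ.m^n≢0 C₄ K
      C n x : ℚ
      C = ι (pos C₄)
      n = ι (pos (suc N))
      x = ι (pos M)
      exponent< : fromℚ ((s ℕ.* K ℤ.⊖ 1) / K) R.< (fromℕ s R.- saving)
      -- `(sK - 1) / K = s - 2h` lies below `s - h` by `h`.
      exponent< = h , 0<½* {inv K} (0<inv K) , 0 , λ _ _ → ≤-trans (+-monoˡ-≤ h (/-≤ {ι (pos s) - inv K} K le))
        (≤-reflexive (trans (cong (λ z → ι (pos s) - z + h) (sym (halves (inv K)))) (trans (lemma (ι (pos s)) h) (cong (_- h) (ι-def (pos s))))))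
        where
        h : ℚ
        h = ½ * inv K
        lemma : ∀ s h → s - (h + h) + h ≡ s - h
        lemma = solve-∀ ℚ-ring
        lemma′ : ∀ s i k → (s - i) * k ≡ s * k - i * k
        lemma′ = solve-∀ ℚ-ring
        le : ι (s ℕ.* K ℤ.⊖ 1) ≤ (ι (pos s) - inv K) * ι (pos K)
        le = ≤-reflexive (sym (trans (lemma′ (ι (pos s)) (inv K) (ι (pos K))) (trans (cong₂ _-_
          (trans (sym (ι-* (pos s) (pos K))) (cong ι (sym (ℤ.pos-* s K)))) (trans (inv-ι K) (sym ι-1)))
          (trans (cong (ι (pos (s ℕ.* K)) +_) (sym (ι-neg (pos 1)))) (trans (sym (ι-+ (pos (s ℕ.* K)) (ℤ.- pos 1))) (cong ι (ℤ.m-n≡m⊖n (s ℕ.* K) 1)))))))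
      above : (A R.^ (s ℕ.* K)) R.≤ ((A R.^ 1) R.* (Q R.^ K))
      above = IsPower.above power (s ℕ.* K) 1 K exponent<
      embedded : ∀ α → 0ℚ ≤ α → n ≤ ι (pos 6) * α → x ^ℚ K * n ≤ C ^ℚ K * α ^ℚ (s ℕ.* K)
      embedded α 0≤α n≤6α = begin
        x ^ℚ K * n
          ≡⟨ sym (trans (cong ι (ℤ.pos-* (M ℕ.^ K) (suc N))) (trans (ι-* (pos (M ℕ.^ K)) (pos (suc N))) (cong (_* n) (ι-^ M K)))) ⟩
        ι (pos (M ℕ.^ K ℕ.* suc N))
          ≤⟨ ι-mono (ℤ.+≤+ count) ⟩
        ι (pos (C₁ ℕ.^ K ℕ.* suc N ℕ.^ (s ℕ.* K)))
          ≡⟨ trans (cong ι (ℤ.pos-* (C₁ ℕ.^ K) (suc N ℕ.^ (s ℕ.* K)))) (trans (ι-* (pos (C₁ ℕ.^ K)) (pos (suc N ℕ.^ (s ℕ.* K))))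
               (cong₂ _*_ (ι-^ C₁ K) (ι-^ (suc N) (s ℕ.* K)))) ⟩
        ι (pos C₁) ^ℚ K * n ^ℚ (s ℕ.* K)
          ≤⟨ *-monoˡ {n ^ℚ (s ℕ.* K)} {(ι (pos 6) * α) ^ℚ (s ℕ.* K)} (ι (pos C₁) ^ℚ K) (0≤^ℚ K (0≤ι C₁)) (^ℚ-mono (s ℕ.* K) (0≤ι (suc N)) n≤6α) ⟩
        ι (pos C₁) ^ℚ K * (ι (pos 6) * α) ^ℚ (s ℕ.* K)
          ≡⟨ cong (ι (pos C₁) ^ℚ K *_) (^ℚ-distrib-* (ι (pos 6)) α (s ℕ.* K)) ⟩
        ι (pos C₁) ^ℚ K * (ι (pos 6) ^ℚ (s ℕ.* K) * α ^ℚ (s ℕ.* K))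
          ≡⟨ sym (*-assoc (ι (pos C₁) ^ℚ K) (ι (pos 6) ^ℚ (s ℕ.* K)) (α ^ℚ (s ℕ.* K))) ⟩
        ι (pos C₁) ^ℚ K * ι (pos 6) ^ℚ (s ℕ.* K) * α ^ℚ (s ℕ.* K)
          ≡⟨ cong (_* α ^ℚ (s ℕ.* K)) (trans (cong (ι (pos C₁) ^ℚ K *_) (trans (sym (^ℚ-* (ι (pos 6)) s K)) (cong (_^ℚ K) (sym (ι-^ 6 s)))))
               (trans (sym (^ℚ-distrib-* (ι (pos C₁)) (ι (pos (6 ℕ.^ s))) K)) (cong (_^ℚ K)
                 (trans (sym (ι-* (pos C₁) (pos (6 ℕ.^ s)))) (cong ι (sym (ℤ.pos-* C₁ (6 ℕ.^ s)))))))) ⟩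
        ι (pos (C₁ ℕ.* 6 ℕ.^ s)) ^ℚ K * α ^ℚ (s ℕ.* K)
          ≤⟨ *-monoʳ {ι (pos (C₁ ℕ.* 6 ℕ.^ s)) ^ℚ K} {C ^ℚ K} (α ^ℚ (s ℕ.* K)) (0≤^ℚ (s ℕ.* K) 0≤α)
               (^ℚ-mono K (0≤ι (C₁ ℕ.* 6 ℕ.^ s)) (ι-mono (ℤ.+≤+ (ℕ.n≤1+n (C₁ ℕ.* 6 ℕ.^ s))))) ⟩
        C ^ℚ K * α ^ℚ (s ℕ.* K) ∎
        where open ≤-Reasoning
      contradictory : ¬ (fromℕ C₄ R.* Q) R.< fromℕ M
      contradictory (ε , 0<ε , J , gap) = <-irrefl refl (<-≤-trans ½e<e (≤-trans e≤ne ne≤½e))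
        where
        e ε′ : ℚ
        e = ε ^ℚ K
        -- Chosen so that `C^K ε′` is half of `ε^K`.
        ε′ = inv (C₄ ℕ.^ K) * (½ * e)
        0<e : 0ℚ < e
        0<e = 0<^ℚ K 0<ε
        0<ε′ : 0ℚ < ε′
        0<ε′ = 0<* {inv (C₄ ℕ.^ K)} {½ * e} (0<inv (C₄ ℕ.^ K)) (0<½* {e} 0<e)
        ½e<e : ½ * e < e
        ½e<e = subst₂ _<_ (+-identityʳ (½ * e)) (halves e) (+-monoʳ-< (½ * e) (0<½* {e} 0<e))
        C^Kε′ : C ^ℚ K * ε′ ≡ ½ * e
        C^Kε′ = trans (cong (_* ε′) (sym (ι-^ C₄ K))) (trans (lemma (ι (pos (C₄ ℕ.^ K))) (inv (C₄ ℕ.^ K)) (½ * e)) (ι-inv-cancel (C₄ ℕ.^ K) (½ * e)))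
          where
          lemma : ∀ a b c → a * (b * c) ≡ b * (a * c)
          lemma = solve-∀ ℚ-ring
        eventually : ∃ λ J → ∀ i → J ℕ.≤ i → seq (A R.^ (s ℕ.* K)) i ≤ seq ((A R.^ 1) R.* (Q R.^ K)) i + ε′
        eventually = above ε′ 0<ε′
        Q-positive : 0ℝ R.< Q
        Q-positive = IsPower.positive power
        J′ J″ i : ℕ
        J′ = proj₁ eventually
        J″ = proj₁ (proj₂ (proj₂ Q-positive))
        i = (I ℕ.⊔ J) ℕ.⊔ (J′ ℕ.⊔ J″)
        I≤i : I ℕ.≤ i
        I≤i = ℕ.≤-trans (ℕ.m≤m⊔n I J) (ℕ.m≤m⊔n (I ℕ.⊔ J) (J′ ℕ.⊔ J″))
        J≤i : J ℕ.≤ i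
        J≤i = ℕ.≤-trans (ℕ.m≤n⊔m I J) (ℕ.m≤m⊔n (I ℕ.⊔ J) (J′ ℕ.⊔ J″))
        J′≤i : J′ ℕ.≤ i
        J′≤i = ℕ.≤-trans (ℕ.m≤m⊔n J′ J″) (ℕ.m≤n⊔m (I ℕ.⊔ J) (J′ ℕ.⊔ J″))
        J″≤i : J″ ℕ.≤ i
        J″≤i = ℕ.≤-trans (ℕ.m≤n⊔m J′ J″) (ℕ.m≤n⊔m (I ℕ.⊔ J) (J′ ℕ.⊔ J″))
        α q : ℚ
        α = seq A i
        q = seq Q i
        0≤α : 0ℚ ≤ α
        0≤α = proj₁ (approximates i I≤i)
        α≤n : α ≤ n
        α≤n = proj₁ (proj₂ (approximates i I≤i))
        n≤6α : n ≤ ι (pos 6) * α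
        n≤6α = proj₂ (proj₂ (approximates i I≤i))
        0≤q : 0ℚ ≤ q
        0≤q = ≤-trans (<⇒≤ (proj₁ (proj₂ Q-positive))) (subst (_≤ q) (+-identityˡ (proj₁ Q-positive)) (proj₂ (proj₂ (proj₂ Q-positive)) i J″≤i))
        Cq+ε≤x : C * q + ε ≤ x
        Cq+ε≤x = subst₂ (λ c m → c * q + ε ≤ m) (sym (ι-def (pos C₄))) (sym (ι-def (pos M))) (gap i J≤i)
        power≤ : α ^ℚ (s ℕ.* K) ≤ α * q ^ℚ K + ε′
        power≤ = subst₂ (λ l r → l ≤ r + ε′) (seq-^ A (s ℕ.* K) i)
          (cong₂ _*_ (*-identityʳ α) (seq-^ Q K i)) (proj₂ eventually i J′≤i)
        1≤n : 1ℚ ≤ n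
        1≤n = subst (_≤ n) ι-1 (ι-mono (ℤ.+≤+ (s≤s z≤n)))
        e≤ne : e ≤ n * e
        e≤ne = subst (_≤ n * e) (*-identityˡ e) (*-monoʳ {1ℚ} {n} e (<⇒≤ 0<e) 1≤n)
        Y : ℚ
        Y = (C * q) ^ℚ K
        main : n * Y + n * e ≤ n * Y + ½ * e
        main = begin
          n * Y + n * e
            ≡⟨ sym (*-distribˡ-+ n Y e) ⟩
          n * (Y + e)
            ≤⟨ *-monoˡ {Y + e} {x ^ℚ K} n (0≤ι (suc N)) (≤-trans (^ℚ-superadditive K (0≤* {C} {q} (0≤ι C₄) 0≤q) (<⇒≤ 0<ε))
                 (^ℚ-mono K (+-mono-≤ (0≤* {C} {q} (0≤ι C₄) 0≤q) (<⇒≤ 0<ε)) Cq+ε≤x)) ⟩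
          n * x ^ℚ K
            ≡⟨ *-comm n (x ^ℚ K) ⟩
          x ^ℚ K * n
            ≤⟨ embedded α 0≤α n≤6α ⟩
          C ^ℚ K * α ^ℚ (s ℕ.* K)
            ≤⟨ *-monoˡ {α ^ℚ (s ℕ.* K)} {n * q ^ℚ K + ε′} (C ^ℚ K) (0≤^ℚ K (0≤ι C₄))
                 (≤-trans power≤ (+-monoˡ-≤ ε′ (*-monoʳ {α} {n} (q ^ℚ K) (0≤^ℚ K 0≤q) α≤n))) ⟩
          C ^ℚ K * (n * q ^ℚ K + ε′)
            ≡⟨ lemma (C ^ℚ K) n (q ^ℚ K) ε′ ⟩
          n * (C ^ℚ K * q ^ℚ K) + C ^ℚ K * ε′
            ≡⟨ cong₂ (λ y z → n * y + z) (sym (^ℚ-distrib-* C q K)) C^Kε′ ⟩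
          n * Y + ½ * e ∎
          where
          open ≤-Reasoning
          lemma : ∀ c n q e → c * (n * q + e) ≡ n * (c * q) + c * e
          lemma = solve-∀ ℚ-ring
        ne≤½e : n * e ≤ ½ * e
        ne≤½e = ≤-from-0≤ (subst (0ℚ ≤_) (lemma (n * Y) (n * e) (½ * e)) (0≤-from-≤ main))
          where
          lemma : ∀ a b c → a + c - (a + b) ≡ c - b
          lemma = solve-∀ ℚ-ring

-- Choice of the exponents and removal of the double negation

module MainArgument where

  open BadPrimes using (Balanced; badConstant; badExponent; badConstant≢0)
  open Rationals
  open RealNumbers hiding (bounded)
  open SingularSeries using (primeBound; singularSeries-↘)
  open PowersAndRoots
  open CountingBound
  import Defs as R
  open import Defs using (ℝ; seq; fromℚ; fromℕ; 0ℝ; 1ℝ; IsPower; SmallSingularSeries; CardinalityAtMost; maxNorm)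
  open import Data.Integer as ℤ using (ℤ; 0ℤ) renaming (+_ to pos)
  import Data.List.Relation.Unary.All as List
  open import Data.Rational using (ℚ; 0ℚ; 1ℚ; ½; _+_; _*_; _-_; -_; _≤_; _<_; _/_)
  open import Data.Rational.Properties
  open import Tactic.RingSolver using (solve-∀)

  -- An exponent `- 1/(n+1)` strictly above `- η` yields `A P^(n+1) ≤ 1` for `P = A^(- η)`.
  negative-exponent : ∀ η → 0ℝ R.< η → ∃ λ n → (R.- η) R.< fromℚ ((0 ℤ.⊖ 1) / suc n)
  negative-exponent η (ε , 0<ε , I , ε≤η) = n , inv (suc n) , 0<inv (suc n) , I , below
    where
    fraction : ∃ λ n → inv (suc n) ≤ ½ * ε
    fraction = archimedean (0<½* {ε} 0<ε)
    n : ℕ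
    n = proj₁ fraction
    below : ∀ i → I ℕ.≤ i → - seq η i + inv (suc n) ≤ (0 ℤ.⊖ 1) / suc n
    below i I≤i = ≤-trans (≤-from-0≤ (subst (0ℚ ≤_)
      (trans (lemma (seq η i) ε (½ * ε) (inv (suc n))) (trans (cong (λ z → - inv (suc n) - (- seq η i + inv (suc n)) + (z - ε)) (halves ε))
        (lemma′ (- inv (suc n) - (- seq η i + inv (suc n))) ε)))
      (+-mono-≤ (+-mono-≤ (0≤-from-≤ (ε≤η i I≤i)) (0≤-from-≤ (proj₂ fraction))) (0≤-from-≤ (proj₂ fraction)))))
      (≤-reflexive (cong -_ (inv-def (suc n))))
      where
      lemma : ∀ η ε h i → (η - (0ℚ + ε)) + (h - i) + (h - i) ≡ - i - (- η + i) + (h + h - ε)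
      lemma = solve-∀ ℚ-ring
      lemma′ : ∀ x ε → x + (ε - ε) ≡ x
      lemma′ = solve-∀ ℚ-ring

  -- A lower bound `q` for `𝔖` is eventually one for `P`. In the Cauchy sequences `A P^(n+1) ≤ 1`
  -- holds up to an error, taken to be 1, and with `N + 1 ≤ 6 A` this gives `6 * 2 = 12`.
  small-value : ∀ n A P η N I → Approximates A N I →
    (R.- η) R.< fromℚ ((0 ℤ.⊖ 1) / suc n) → IsPower A (R.- η) P →
    ∀ 𝔖 → 𝔖 R.< P → ∀ q → 0ℚ ≤ q → 𝔖 ↘ q → ι (pos (suc N)) * q ^ℚ suc n ≤ ι (pos 12)
  small-value n A P η N I approximates exponent< power 𝔖 (ε , 0<ε , J , 𝔖<P) q 0≤q (J′ , q≤𝔖) = begin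
    ι (pos (suc N)) * q ^ℚ suc n
      ≤⟨ *-mono {ι (pos (suc N))} {ι (pos 6) * α} {q ^ℚ suc n} {seq P i ^ℚ suc n} (0≤ι (suc N)) (0≤^ℚ (suc n) (≤-trans 0≤q q≤P))
           (proj₂ (proj₂ (approximates i I≤i))) (^ℚ-mono (suc n) 0≤q q≤P) ⟩
    ι (pos 6) * α * seq P i ^ℚ suc n
      ≡⟨ *-assoc (ι (pos 6)) α (seq P i ^ℚ suc n) ⟩
    ι (pos 6) * (α * seq P i ^ℚ suc n)
      ≤⟨ *-monoˡ {α * seq P i ^ℚ suc n} {1ℚ + 1ℚ} (ι (pos 6)) (0≤ι 6) power≤ ⟩
    ι (pos 6) * (1ℚ + 1ℚ)
      ≡⟨ trans (cong (_* (1ℚ + 1ℚ)) (ι-def (pos 6))) (sym (ι-def (pos 12))) ⟩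
    ι (pos 12) ∎
    where
    open ≤-Reasoning
    eventually : ∃ λ J → ∀ i → J ℕ.≤ i → seq ((A R.^ 1) R.* (P R.^ suc n)) i ≤ 1ℚ + 1ℚ
    eventually = IsPower.below power 0 1 (suc n) exponent< 1ℚ (positive⁻¹ 1ℚ)
    J″ i : ℕ
    J″ = proj₁ eventually
    i = (I ℕ.⊔ J) ℕ.⊔ (J′ ℕ.⊔ J″)
    I≤i : I ℕ.≤ i
    I≤i = ℕ.≤-trans (ℕ.m≤m⊔n I J) (ℕ.m≤m⊔n (I ℕ.⊔ J) (J′ ℕ.⊔ J″))
    J≤i : J ℕ.≤ i
    J≤i = ℕ.≤-trans (ℕ.m≤n⊔m I J) (ℕ.m≤m⊔n (I ℕ.⊔ J) (J′ ℕ.⊔ J″))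
    J′≤i : J′ ℕ.≤ i
    J′≤i = ℕ.≤-trans (ℕ.m≤m⊔n J′ J″) (ℕ.m≤n⊔m (I ℕ.⊔ J) (J′ ℕ.⊔ J″))
    J″≤i : J″ ℕ.≤ i
    J″≤i = ℕ.≤-trans (ℕ.m≤n⊔m J′ J″) (ℕ.m≤n⊔m (I ℕ.⊔ J) (J′ ℕ.⊔ J″))
    α : ℚ
    α = seq A i
    q≤P : q ≤ seq P i
    q≤P = ≤-trans (q≤𝔖 i J′≤i) (≤-trans (subst (_≤ seq 𝔖 i + ε) (+-identityʳ (seq 𝔖 i)) (+-monoʳ-≤ (seq 𝔖 i) (<⇒≤ 0<ε))) (𝔖<P i J≤i))
    power≤ : α * seq P i ^ℚ suc n ≤ 1ℚ + 1ℚ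
    power≤ = subst (_≤ 1ℚ + 1ℚ) (cong₂ _*_ (*-identityʳ α) (seq-^ P (suc n) i)) (proj₂ eventually i J″≤i)

  module _ (k′ s′ : ℕ) (5≤s′ : 5 ℕ.≤ s′) (k′<s′ : k′ ℕ.< s′) (η : ℝ) (0<η : 0ℝ R.< η) where

    private
      k s n c E K D : ℕ
      k = suc k′
      s = suc s′
      n = proj₁ (negative-exponent η 0<η)
      c = badConstant k (primeBound k′ s′) s
      E = badExponent k (primeBound k′ s′) s
      -- One more than the exponent of `T` in the upper bound for `N`, so that this bound limits `T`
      -- itself.
      K = suc (E ℕ.* suc n)
      D = 12 ℕ.* (4 ℕ.* c) ℕ.^ suc n

      -- The conclusion is a decidable inequality, so it may be drawn from a lower bound for `𝔖`
      -- under a double negation.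
      T-bounded : ∀ A P N I → Approximates A N I →
        IsPower A (R.- η) P → ∀ T → suc T ℕ.^ K ℕ.≤ suc N → (a : Vec ℤ s) → SmallSingularSeries k A P a → Balanced (suc T) a → suc T ℕ.≤ D
      T-bounded A P N I approximates power T T^K≤N a small balanced = decidable-stable (suc T ℕ.≤? D) λ fail →
        singularSeries-↘ k′ s′ 5≤s′ k′<s′ (suc T) a nonZero balanced {𝔖} (proj₁ 𝔖-series) (proj₁ (proj₂ 𝔖-series)) (proj₂ (proj₂ 𝔖-series)) 𝔖-pos
          λ above → fail (lower-bound⇒T-bounded c E (suc n) (suc N) (suc T) T^K≤N
            (small-value n A P η N I approximates (proj₂ (negative-exponent η 0<η)) power 𝔖 𝔖-small q 0≤q above))
        where
        open SmallSingularSeries small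
        instance
          B≢0 : NonZero (c ℕ.* suc T ℕ.^ E)
          B≢0 = ℕ.m*n≢0 c (suc T ℕ.^ E) {{badConstant≢0 k (primeBound k′ s′) s}} {{ℕ.m^n≢0 (suc T) E}}
        q : ℚ
        q = ½ * (½ * inv (c ℕ.* suc T ℕ.^ E))
        0≤q : 0ℚ ≤ q
        0≤q = <⇒≤ (0<½* {½ * inv (c ℕ.* suc T ℕ.^ E)} (0<½* {inv (c ℕ.* suc T ℕ.^ E)} (0<inv (c ℕ.* suc T ℕ.^ E))))

    smallSeriesRare : Σ ℝ λ γ → 0ℝ R.< γ × (Σ ℝ λ C → (A : ℝ) → 1ℝ R.≤ A →
      (P Q : ℝ) → IsPower A (R.- η) P → IsPower A (fromℕ s R.- γ) Q → CardinalityAtMost (SmallSingularSeries {s} k A P) (C R.* Q))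
    smallSeriesRare = saving s K , fromℚ-pos (0<½* {inv K} (0<inv K)) , fromℕ (suc (countConstant s D ℕ.* 6 ℕ.^ s)) , bound
      where
      bound : (A : ℝ) → 1ℝ R.≤ A → (P Q : ℝ) → IsPower A (R.- η) P → IsPower A (fromℕ s R.- saving s K) Q →
        CardinalityAtMost (SmallSingularSeries {s} k A P) (fromℕ (suc (countConstant s D ℕ.* 6 ℕ.^ s)) R.* Q)
      bound A 1≤A P Q P-power Q-power as unique small = bound≤power s K (countConstant s D) (length as) N
        (count^K≤ s K D (suc N) (suc T) (proj₂ (proj₂ root)) as unique bounded balanced-bounded)
        A I approximates Q Q-power
        where
        approximation : ∃ λ N → (∀ m → fromℕ m R.≤ A → m ℕ.≤ suc N) × ∃ (Approximates A N)
        approximation = naturalApproximation A 1≤A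
        N I : ℕ
        N = proj₁ approximation
        I = proj₁ (proj₂ (proj₂ approximation))
        approximates : Approximates A N I
        approximates = proj₂ (proj₂ (proj₂ approximation))
        root : ∃ λ T → (suc T ℕ.^ K ℕ.≤ suc N) × (suc N ℕ.< suc (suc T) ℕ.^ K)
        root = integerRoot K N
        T : ℕ
        T = proj₁ root
        bounded : ∀ {a} → a ∈ as → All (_≢ 0ℤ) a × (maxNorm a ℕ.≤ suc N)
        bounded {a} a∈ = SmallSingularSeries.nonZero (List.lookup small a∈) ,
          proj₁ (proj₂ approximation) (maxNorm a) (SmallSingularSeries.norm≤ (List.lookup small a∈))
        balanced-bounded : ∀ {a} → a ∈ as → Balanced (suc T) a → suc T ℕ.≤ D
        balanced-bounded {a} a∈ balanced = T-bounded A P N I approximates P-power T (proj₁ (proj₂ root)) a (List.lookup small a∈) balanced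

open import Defs
open MainArgument using (smallSeriesRare)

theorem1p2 : (k s : ℕ) → 3 ℕ.≤ k → k ℕ.+ 3 ℕ.≤ s → (η : ℝ) → 0ℝ < η →
    Σ ℝ λ γ → 0ℝ < γ × (Σ ℝ λ C →
    (A : ℝ) → 1ℝ ≤ A →
    (P Q : ℝ) → IsPower A (- η) P → IsPower A (fromℕ s - γ) Q →
    CardinalityAtMost (SmallSingularSeries {s} k A P) (C * Q))
theorem1p2 (suc k′) (suc s′) (ℕ.s≤s 2≤k′) (ℕ.s≤s k′+3≤s′) =
  -- `s ≥ k + 3 ≥ 6` serves the good primes; `k - 1 < s - 1` makes the density vanish where
  -- primitive solutions fail.
  smallSeriesRare k′ s′ (ℕ.≤-trans (ℕ.+-monoˡ-≤ 3 2≤k′) k′+3≤s′)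
    (ℕ.≤-trans (subst (ℕ._≤ k′ ℕ.+ 3) (ℕ.+-comm k′ 1) (ℕ.+-monoʳ-≤ k′ (ℕ.s≤s ℕ.z≤n))) k′+3≤s′)
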